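{- Let $(\lambda/\mu,r)$ be an r-shape with edgewise connected diagram, $\mathbf a,\mathbf b$ column flags for it, and $\Theta=(\theta_1,\dots,\theta_k)$ an outer ribbon decomposition of $\lambda/\mu$. Then $$\mathsf S^{\mathbf a,\mathbf b}_{\lambda/\mu}(\mathbf y/\mathbf z)=\det\Big[\mathsf S^{\mathbf a^{ij},\mathbf b^{ij}}_{\theta_i\#\theta_j}(\mathbf y/\mathbf z)\Big]_{1\le i,j\le k},$$ where an entry equals $1$ if $\theta_i\#\theta_j=\varnothing$ and $0$ if $\theta_i\#\theta_j$ is undefined.
   Context: Skew diagram $\lambda/\mu=\{(i,j):\mu_i<j\le\lambda_i\}$ (English notation), conjugates $\lambda',\mu'$; an r-shape $(\lambda/\mu,r)$ has content $c(i,j)=j-i+r-1+\lambda'_1$; $\mathrm{row}(i,j)=i$, $\mathrm{col}(i,j)=j$. $e_n(\mathbf x/\mathbf y)=\sum_{i=0}^n(-1)^{n-i}e_i(\mathbf x)h_{n-i}(\mathbf y)$ ($0$ for $n<0$); $\mathbf y_{a,b}=(y_a,\dots,y_b)$ if $a\le b$, empty otherwise ($\mathbf y=(y_i)_{i\in\mathbb Z}$, $\mathbf z=(z_i)_{i\in\mathbb Z}$). For an r-shape $\kappa/\nu$ and $n\ge\kappa_1$: column flags are $\mathbf a,\mathbf b\in\mathbb Z^n$ with $a_i-a_{i+1}\le\nu'_i-\nu'_{i+1}+1$, $b_i-b_{i+1}\le\kappa'_i-\kappa'_{i+1}+1$ whenever $\nu'_i<\kappa'_{i+1}$; conjugate flags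 $a'_i=a_i+c(\nu'_i+1,i)$, $b'_i=b_i+c(\kappa'_i,i)$; $\mathsf S^{\mathbf a,\mathbf b}_{\kappa/\nu}(\mathbf y/\mathbf z)=\det[e_{\kappa'_i-i-\nu'_j+j}(\mathbf y_{a_j,b_i}/\mathbf z_{a'_j,b'_i})]_{1\le i,j\le n}$. Ribbons, outer ribbon decompositions, cutting strip, $\#$, induced ribbon flags: a ribbon is an edgewise connected skew diagram with no $2\times2$ block; head = bottom-left cell, tail = top-right cell. A cell of $\lambda/\mu$ is on the left/bottom/top/right perimeter if the adjacent position to its left/below/above/right is not in $\lambda/\mu$. An outer ribbon decomposition is a partition of the cells of $\lambda/\mu$ into ribbons $\theta_1,\dots,\theta_k$ with heads on the left or bottom perimeter and tails on the top or right perimeter. A cell $\gamma\in\theta_i$ goes up if the cell directly above is in $\theta_i$, or $\gamma$ is the tail of $\theta_i$ on the top perimeter; it goes right if the cell directly right is in $\theta_i$, or $\gamma$ is the tail on the right perimeter; the top-right cell of $\lambda/\mu$ instead goes up if the cell below it is in its ribbon, right if the cell left of it is in its ribbon. All cells of one content go the same direction. The cutting strip $\Theta(\lambda/\mu)$ has one cell of each content occurring in $\lambda/\mu$, the cell of content $c+1$ lying directly above (resp. right of) the one of content $c$ if cells of content $c$ go up (resp. right). For contents $p\le q$, $\Theta(p,q)$ = sub-ribbon with contents in $[p,q]$ (r-shape with inherited contents); $\Theta(q+1,q)=\varnothing$; undefined if $p>q+1$. With $\delta_i,\gamma_i$ the head and tail of $\theta_i$, $\theta_i\#\theta_j=\Theta(c(\delta_i),c(\gamma_j))$.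 If $\theta_i\#\theta_j$ is nonempty, let $\rho_1,\dots,\rho_K$ be its columns from left to right with bottom cells $\delta_s$ and top cells $\gamma_s$, $M_s$ the rightmost cell of $\lambda/\mu$ of content $c(\delta_s)$, $m_s$ the leftmost cell of $\lambda/\mu$ of content $c(\gamma_s)$; the induced ribbon flags are $a^{ij}_s=a_{\mathrm{col}(m_s)}-(\mu'_{\mathrm{col}(m_s)}+1)+\mathrm{row}(m_s)$, $b^{ij}_s=b_{\mathrm{col}(M_s)}-\lambda'_{\mathrm{col}(M_s)}+\mathrm{row}(M_s)$, $s\in[K]$; $\mathsf S^{\mathbf a^{ij},\mathbf b^{ij}}_{\theta_i\#\theta_j}$ is computed regarding $\theta_i\#\theta_j$ as a skew diagram in columns $1,\dots,K$ with its inherited contents, $n=K$. -}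

module Defs where

open import Data.Bool using (Bool; true; false; if_then_else_; _∧_; _∨_; not)
open import Data.Nat as ℕ using (ℕ; zero; suc; _∸_; _≤_; _<_; _⊔_; _⊓_)
import Data.Nat.Properties as ℕP
open import Data.Integer as ℤ using (ℤ; +_; _-_)
import Data.Integer.Properties as ℤP
open import Data.Fin using (Fin; toℕ; punchIn) renaming (zero to fzero; suc to fsuc)
open import Data.List using (List; []; _∷_; map; filter; length; upTo; concatMap; foldr; lookup)
open import Data.Bool.ListAction using (any)
open import Data.List.Membership.Propositional using (_∈_)
open import Data.List.Membership.DecPropositional as DecMem using ()
open import Data.Vec using (Vec)
import Data.Vec as Vec
open import Data.Product using (Σ; _×_; _,_; proj₁; proj₂; ∃)
open import Data.Product.Properties using (≡-dec)
open import Data.Sum using (_⊎_)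
open import Data.Empty using (⊥)
open import Relation.Nullary using (¬_; Dec; yes; no; does)
open import Relation.Nullary.Decidable using (_×-dec_)
open import Relation.Binary.PropositionalEquality using (_≡_; _≢_)
open import Algebra.Bundles using (CommutativeRing)

-- Cells, partitions, skew diagrams (English notation, rows/columns from 1)

Cell : Set
Cell = ℕ × ℕ

row col : Cell → ℕ
row = proj₁
col = proj₂

_≟c_ : (x y : Cell) → Dec (x ≡ y)
_≟c_ = ≡-dec ℕ._≟_ ℕ._≟_

open DecMem _≟c_ using (_∈?_)

-- i-th part of a partition given as a list (1-indexed, 0 beyond the end)
at : List ℕ → ℕ → ℕ
at []       _             = 0
at (x ∷ xs) zero          = 0
at (x ∷ xs) (suc zero)    = x
at (x ∷ xs) (suc (suc i)) = at xs (suc i)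

IsPartition : List ℕ → Set
IsPartition p = ∀ i → at p (suc (suc i)) ≤ at p (suc i)

_⊆ₚ_ : List ℕ → List ℕ → Set
mu ⊆ₚ la = ∀ i → at mu i ≤ at la i

conj : List ℕ → ℕ → ℕ
conj la j = length (filter (λ x → j ℕ.≤? x) la)

InSkew : List ℕ → List ℕ → Cell → Set
InSkew la mu (i , j) = (1 ≤ i) × (at mu i < j) × (j ≤ at la i)

inSkew? : (la mu : List ℕ) (x : Cell) → Dec (InSkew la mu x)
inSkew? la mu (i , j) = (1 ℕ.≤? i) ×-dec ((at mu i ℕ.<? j) ×-dec (j ℕ.≤? at la i))

skewCells : List ℕ → List ℕ → List Cell
skewCells la mu =
  concatMap (λ i → map (λ t → (suc i , suc (at mu (suc i) ℕ.+ t)))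
                       (upTo (at la (suc i) ∸ at mu (suc i))))
            (upTo (length la))

Adjacent : Cell → Cell → Set
Adjacent (i , j) (i' , j') =
  ((i ≡ i') × (suc j ≡ j')) ⊎ ((i ≡ i') × (j ≡ suc j')) ⊎
  ((suc i ≡ i') × (j ≡ j')) ⊎ ((i ≡ suc i') × (j ≡ j'))

data Reach (S : Cell → Set) : Cell → Cell → Set where
  here : ∀ {x} → Reach S x x
  step : ∀ {x y w} → Adjacent x y → S y → Reach S y w → Reach S x w

EdgeConnected : (Cell → Set) → Set
EdgeConnected S = ∀ x y → S x → S y → Reach S x y

-- Contents of an r-shape (kappa/nu, r), given via the conjugate kappa':
-- c(i,j) = j - i + r - 1 + kappa'_1

content : (κc : ℕ → ℕ) (r : ℤ) → ℕ → ℕ → ℤ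
content κc r i j = + j - + i ℤ.+ r - + 1 ℤ.+ + κc 1

-- Column flags (a, b ∈ ℤ^n, read 1-indexed)

vat : ∀ {n} → Vec ℤ n → ℕ → ℤ
vat {zero}  v       _       = + 0
vat {suc n} v       zero    = + 0
vat {suc n} (x Vec.∷ v) (suc zero)    = x
vat {suc n} (x Vec.∷ v) (suc (suc i)) = vat v (suc i)

ColumnFlags : (κ ν : List ℕ) (n : ℕ) (a b : Vec ℤ n) → Set
ColumnFlags κ ν n a b =
  ∀ i → 1 ≤ i → i < n → conj ν i < conj κ (suc i) →
    (vat a i - vat a (suc i) ℤ.≤ + conj ν i - + conj ν (suc i) ℤ.+ + 1)
  × (vat b i - vat b (suc i) ℤ.≤ + conj κ i - + conj κ (suc i) ℤ.+ + 1)

IsSkewDiagram : List Cell → Set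
IsSkewDiagram θ = Σ (List ℕ) λ κ → Σ (List ℕ) λ ν →
  IsPartition κ × IsPartition ν × ν ⊆ₚ κ × (∀ x → (x ∈ θ → InSkew κ ν x) × (InSkew κ ν x → x ∈ θ))

IsRibbon : List Cell → Set
IsRibbon θ =
  (θ ≢ []) × IsSkewDiagram θ × EdgeConnected (_∈ θ)
  × (∀ i j → ¬ (((i , j) ∈ θ) × ((suc i , j) ∈ θ) × ((i , suc j) ∈ θ) × ((suc i , suc j) ∈ θ)))

-- head = bottom-left cell (lowest row, leftmost in it); tail = top-right cell
pickHead : Cell → Cell → Cell
pickHead x y = if (row y ℕ.<ᵇ row x) ∨ ((row x ℕ.≡ᵇ row y) ∧ (col x ℕ.<ᵇ col y)) then x else y

pickTail : Cell → Cell → Cell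
pickTail x y = if (row x ℕ.<ᵇ row y) ∨ ((row x ℕ.≡ᵇ row y) ∧ (col y ℕ.<ᵇ col x)) then x else y

headC tailC : List Cell → Cell
headC []       = (0 , 0)
headC (x ∷ xs) = foldr pickHead x xs
tailC []       = (0 , 0)
tailC (x ∷ xs) = foldr pickTail x xs

up down left right : Cell → Cell
up    (i , j) = (i ∸ 1 , j)
down  (i , j) = (suc i , j)
left  (i , j) = (i , j ∸ 1)
right (i , j) = (i , suc j)

module Shape (la mu : List ℕ) (r : ℤ) where

  cont : Cell → ℤ
  cont (i , j) = content (conj la) r i j

  OnLeft OnBottom OnTop OnRight : Cell → Set
  OnLeft   x = ¬ InSkew la mu (left x)
  OnBottom x = ¬ InSkew la mu (down x)
  OnTop    x = ¬ InSkew la mu (up x)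
  OnRight  x = ¬ InSkew la mu (right x)

  OuterRibbonDecomp : List (List Cell) → Set
  OuterRibbonDecomp Θ =
    (∀ (i : Fin (length Θ)) → IsRibbon (lookup Θ i)
        × (∀ x → x ∈ lookup Θ i → InSkew la mu x)
        × (OnLeft (headC (lookup Θ i)) ⊎ OnBottom (headC (lookup Θ i)))
        × (OnTop (tailC (lookup Θ i)) ⊎ OnRight (tailC (lookup Θ i))))
    × (∀ x → InSkew la mu x → Σ (Fin (length Θ)) λ i →
          (x ∈ lookup Θ i) × (∀ j → x ∈ lookup Θ j → j ≡ i))

  -- leftmost / rightmost cell of la/mu with content c (default (0,0) if none)
  leftmostOf rightmostOf : ℤ → Cell
  leftmostOf c = foldr (λ x m → if (row m ℕ.≡ᵇ 0) ∨ (col x ℕ.<ᵇ col m) then x else m) (0 , 0)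
                       (filter (λ x → cont x ℤ.≟ c) (skewCells la mu))
  rightmostOf c = foldr (λ x m → if (row m ℕ.≡ᵇ 0) ∨ (col m ℕ.<ᵇ col x) then x else m) (0 , 0)
                        (filter (λ x → cont x ℤ.≟ c) (skewCells la mu))

  topRight : Cell
  topRight = tailC (skewCells la mu)

  sameRibbon : List (List Cell) → Cell → Cell → Bool
  sameRibbon Θ x y = any (λ θ → does (x ∈? θ) ∧ does (y ∈? θ)) Θ

  isTail : List (List Cell) → Cell → Bool
  isTail Θ x = any (λ θ → does (x ∈? θ) ∧ does (tailC θ ≟c x)) Θ

  goesUp : List (List Cell) → Cell → Bool
  goesUp Θ x with does (x ≟c topRight)
  ... | true  = sameRibbon Θ x (down x)
  ... | false = sameRibbon Θ x (up x) ∨ (isTail Θ x ∧ not (does (inSkew? la mu (up x))))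

  -- direction of content c (all cells of one content go the same way);
  -- read off from the leftmost cell of that content
  dirUp : List (List Cell) → ℤ → Bool
  dirUp Θ c = goesUp Θ (leftmostOf c)

-- Sub-ribbon Θ(p,q) of the cutting strip, as a skew diagram in columns 1..K
-- (direction function d : content ↦ goes up?)

upsFrom : (ℤ → Bool) → ℤ → ℕ → ℕ
upsFrom d p zero    = 0
upsFrom d p (suc t) = upsFrom d p t ℕ.+ (if d (p ℤ.+ + t) then 1 else 0)

-- the L cells of contents p, p+1, …, p+L-1; content p in column 1, top row 1
stripCells : (ℤ → Bool) → ℤ → ℕ → List Cell
stripCells d p L =
  map (λ t → (suc (U ∸ upsFrom d p t) , suc (t ∸ upsFrom d p t))) (upTo L)
  where U = upsFrom d p (L ∸ 1)

stripWidth : (ℤ → Bool) → ℤ → ℕ → ℕ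
stripWidth d p L = suc ((L ∸ 1) ∸ upsFrom d p (L ∸ 1))

maxL minL : List ℕ → ℕ
maxL = foldr _⊔_ 0
minL []       = 0
minL (x ∷ xs) = foldr _⊓_ x xs

rowsInCol : List Cell → ℕ → List ℕ
rowsInCol cs s = map row (filter (λ x → col x ℕ.≟ s) cs)

conjOuter conjInner : List Cell → ℕ → ℕ
conjOuter cs s = maxL (rowsInCol cs s)
conjInner cs s = minL (rowsInCol cs s) ∸ 1

module RingDefs {c ℓ} (R : CommutativeRing c ℓ) where
  open CommutativeRing R using (Carrier; _+_; _*_; -_; 0#; 1#)

  elem : ℕ → List Carrier → Carrier
  elem zero    _        = 1#
  elem (suc k) []       = 0#
  elem (suc k) (x ∷ xs) = elem (suc k) xs + x * elem k xs

  hom : ℕ → List Carrier → Carrier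
  hom zero    _        = 1#
  hom (suc k) []       = 0#
  hom (suc k) (x ∷ xs) = hom (suc k) xs + x * hom k (x ∷ xs)

  sign : ℕ → Carrier
  sign zero    = 1#
  sign (suc k) = - sign k

  eRel : ℤ → List Carrier → List Carrier → Carrier
  eRel (ℤ.-[1+ _ ]) xs ys = 0#
  eRel (+ n) xs ys = foldr _+_ 0# (map (λ i → sign (n ∸ i) * (elem i xs * hom (n ∸ i) ys)) (upTo (suc n)))

  seg : (ℤ → Carrier) → ℤ → ℤ → List Carrier
  seg x a b with a ℤ.≤? b
  ... | yes _ = map (λ t → x (a ℤ.+ + t)) (upTo (suc ℤ.∣ b - a ∣))
  ... | no  _ = []

  sumFin : ∀ n → (Fin n → Carrier) → Carrier
  sumFin zero    f = 0#
  sumFin (suc n) f = f fzero + sumFin n (λ i → f (fsuc i))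

  det : ∀ n → (Fin n → Fin n → Carrier) → Carrier
  det zero    M = 1#
  det (suc n) M = sumFin (suc n) λ j →
    sign (toℕ j) * (M fzero j * det n (λ i k → M (fsuc i) (punchIn j k)))

  SS : (κc νc : ℕ → ℕ) (r : ℤ) (n : ℕ) (a b : ℕ → ℤ) (y z : ℤ → Carrier) → Carrier
  SS κc νc r n a b y z = det n λ i j →
    let i' = suc (toℕ i) ; j' = suc (toℕ j) in
    eRel (+ κc i' - + i' - + νc j' ℤ.+ + j')
         (seg y (a j') (b i'))
         (seg z (a j' ℤ.+ content κc r (suc (νc j')) j') (b i' ℤ.+ content κc r (κc i') i'))

  lhsS : (la mu : List ℕ) (r : ℤ) (n : ℕ) (a b : Vec ℤ n) (y z : ℤ → Carrier) → Carrier
  lhsS la mu r n a b y z = SS (conj la) (conj mu) r n (vat a) (vat b) y z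

  module _ (la mu : List ℕ) (r : ℤ) {n : ℕ} (a b : Vec ℤ n) (Θ : List (List Cell))
           (y z : ℤ → Carrier) where
    open Shape la mu r

    -- S^{a^{ij},b^{ij}}_{Θ(p,q)} for contents p ≤ q
    ribbonS : ℤ → ℤ → Carrier
    ribbonS p q = SS κc νc p K aij bij y z
      where
        d  = dirUp Θ
        L  = suc ℤ.∣ q - p ∣
        cs = stripCells d p L
        K  = stripWidth d p L
        κc = conjOuter cs
        νc = conjInner cs
        aij : ℕ → ℤ
        aij s = let m = leftmostOf (content κc p (suc (νc s)) s) in
                vat a (col m) - (+ conj mu (col m) ℤ.+ + 1) ℤ.+ + row m
        bij : ℕ → ℤ
        bij s = let M = rightmostOf (content κc p (κc s) s) in
                vat b (col M) - + conj la (col M) ℤ.+ + row M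

    -- θ_i # θ_j = Θ(c(δ_i), c(γ_j)); 1 if empty, 0 if undefined
    entry : Fin (length Θ) → Fin (length Θ) → Carrier
    entry i j with cont (headC (lookup Θ i)) | cont (tailC (lookup Θ j))
    ... | p | q with q ℤ.+ + 1 ℤ.<? p
    ...   | yes _ = 0#
    ...   | no  _ with p ℤ.≟ q ℤ.+ + 1
    ...     | yes _ = 1#
    ...     | no  _ = ribbonS p q

    rhsDet : Carrier
    rhsDet = det (length Θ) entry

{-# OPTIONS --safe #-}

-- Index rows by bottom contents and columns by top contents plus one. All entries of all the determinants
-- involved then come from one upper unitriangular matrix X, because a flag only depends on the content at which
-- it is used: the left side is the minor of X given by the columns of the diagram, and S of a ribbon with head p,
-- tail q and interior column bottoms C is the minor with rows p, C and columns C, q + 1.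
--
-- Process the diagonals of the diagram by increasing content. After step s the diagram is cut into the pieces
-- that follow the ribbons up to content s and the columns beyond it, and X has been replaced by the matrix
-- whose entries are the ribbon minors of the cutting strip turning right only at contents below s. When the
-- cells of content s go up nothing changes. When they go right the matrix undergoes a principal pivot transform
-- at c = s + 1, up to signs: for p < c < v the entry X(p, v) becomes X(p, c) X(c, v) - X(p, v). At the same time
-- the pieces crossing this diagonal are cyclically rematched, and the label c is exchanged between the rows and
-- the columns; these effects cancel, so the determinant does not change.

module Submission where

open import Defs
open import Data.Bool using (Bool; true; false; not; if_then_else_; _∨_; _∧_; T)
open import Data.Bool.ListAction using (any)
open import Data.Empty using (⊥; ⊥-elim)
open import Data.Fin using (Fin; toℕ; punchIn) renaming (zero to fzero; suc to fsuc)
open import Data.Integer as ℤ using (ℤ)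
import Data.Integer.Properties as ℤP
import Data.Integer.Tactic.RingSolver as ℤ-Solver
open import Data.List using (List; []; _∷_; _++_; map; length; tabulate; foldr; filter; lookup; zip; upTo; applyUpTo; allFin)
import Data.List.Properties as ListP
open ListP using (++-identityʳ; map-++; ++-assoc; filter-reject; filter-accept; map-∘; length-++; length-map; map-id; map-upTo)
open import Data.List.Membership.Propositional using (_∈_; _∉_; find; lose)
open import Data.List.Membership.Propositional.Properties
  using (∈-++⁻; ∈-map⁺; ∈-map⁻; ∈-filter⁺; ∈-filter⁻; ∈-upTo⁺; ∈-upTo⁻; ∈-concatMap⁺; ∈-concatMap⁻; ∈-allFin)
import Data.List.Membership.DecPropositional as DecMem
open import Data.List.Relation.Unary.Any using (here; there; satisfied)
import Data.List.Relation.Unary.Any.Properties as AnyP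
open import Data.List.Relation.Unary.All as All using (All; []; _∷_)
import Data.List.Relation.Unary.All.Properties as AllP
open import Data.List.Relation.Unary.AllPairs using (AllPairs; []; _∷_)
import Data.List.Relation.Unary.AllPairs.Properties as AllPairsP
open import Data.List.Relation.Unary.Unique.Propositional using (Unique)
import Data.List.Relation.Unary.Unique.Propositional.Properties as UniqueP
open import Data.List.Relation.Binary.Pointwise as Pointwise using (Pointwise; []; _∷_)
open import Data.List.Relation.Binary.Permutation.Propositional as Perm
  using (_↭_; prep; swap; ↭-refl; ↭-trans; ↭-sym; ↭-reflexive)
import Data.List.Relation.Binary.Permutation.Propositional.Properties as PermP
open import Data.Maybe using (Maybe; just; nothing)
open import Data.Nat as ℕ using (ℕ; zero; suc; s≤s; z≤n; _≤_; _<_; _<?_; _≤?_; _∸_)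
import Data.Nat.Properties as ℕP
open ℕP using
  ( ≤-trans; ≤-refl; <⇒≤; ≤-reflexive; n≤1+n; ≤-pred; <⇒≱; ≤-antisym; ≮⇒≥; m≤n⇒m≤1+n; 1+n≰n
  ; 1+n≢n; ≤⇒≯; ≰⇒>; <-trans; <⇒≢; ≤∧≢⇒<; m∸n+n≡m; <-cmp; suc-injective; m≤m+n )
open import Data.Product using (Σ; _×_; _,_; proj₁; proj₂)
open import Data.Sum using (_⊎_; inj₁; inj₂)
open import Data.Unit using (tt)
open import Data.Vec using (Vec)
open import Function using (_∘_)
open import Level using (Level)
open import Relation.Nullary using (¬_; Dec; yes; no; does; contradiction)
open import Relation.Nullary.Decidable using (_×-dec_)
open import Relation.Binary.Definitions using (tri<; tri≈; tri>)
open import Relation.Binary.PropositionalEquality as ≡ using (_≡_; _≢_)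
open import Algebra.Bundles using (CommutativeRing; RawRing)
open import Algebra.Solver.Ring.AlmostCommutativeRing using (fromCommutativeRing; _-Raw-AlmostCommutative⟶_)
import Algebra.Solver.Ring
import Algebra.Properties.AbelianGroup
import Algebra.Properties.CommutativeSemigroup
import Algebra.Properties.Ring
import Algebra.Properties.Semiring.Mult
import Relation.Binary.Reasoning.Setoid

-- A ring solver with integer coefficients

-- The pivot is available because the diagonal entries are 1: a minor of the principal pivot
-- transform at `c` is, up to sign, the minor of the original matrix with `c` exchanged between rows
-- and columns. The sign is under control because a piece not crossing the diagonal has both labels
-- on the same side of `c`, while every crossing piece has its head before and its top after `c`.
-- What remains is one factor -1 per crossing head, which is also the sign of moving `c` past the
-- list of heads. This is why heads and tops are kept in diagonal order. The pivot formula is the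
-- recursion of a ribbon minor in its last cut. The ends of neighbouring diagonals differ by at most
-- one row, so each step has four forms, told apart by two Booleans. Since labels are inserted and
-- deleted at every step, minors are indexed by lists of labels. The flags agree on both sides
-- because the top of a column is the leftmost cell of its content and the bottom is the rightmost
-- one, so the induced flags there are the given ones.

module RingSolver {c ℓ} (R : CommutativeRing c ℓ) where
  open CommutativeRing R
  open Algebra.Properties.Ring ring
  open Algebra.Properties.Semiring.Mult semiring renaming (_×_ to _·_)
  open Algebra.Properties.CommutativeSemigroup +-commutativeSemigroup using (interchange)
  open Relation.Binary.Reasoning.Setoid setoid

  -- Integer coefficients as formal differences (a , b) of naturals.
  differences : RawRing _ _
  differences = record
    { Carrier = ℕ × ℕ
    ; _≈_     = _≡_
    ; _+_     = λ (a , b) (a' , b') → a ℕ.+ a' , b ℕ.+ b'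
    ; _*_     = λ (a , b) (a' , b') → a ℕ.* a' ℕ.+ b ℕ.* b' , a ℕ.* b' ℕ.+ b ℕ.* a'
    ; -_      = λ (a , b) → b , a
    ; 0#      = 0 , 0
    ; 1#      = 1 , 0
    }

  ⟦_⟧ : ℕ × ℕ → Carrier
  ⟦ a , b ⟧ = a · 1# - b · 1#

  private
    -‿+ : ∀ x y → - (x + y) ≈ - x + - y
    -‿+ x y = sym (-‿+-comm x y)

    +-homo : ∀ a b a' b' → (a ℕ.+ a') · 1# - (b ℕ.+ b') · 1# ≈ (a · 1# - b · 1#) + (a' · 1# - b' · 1#)
    +-homo a b a' b' = begin
      (a ℕ.+ a') · 1# - (b ℕ.+ b') · 1#
        ≈⟨ +-cong (×-homo-+ 1# a a') (trans (-‿cong (×-homo-+ 1# b b')) (-‿+ _ _)) ⟩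
      (a · 1# + a' · 1#) + (- (b · 1#) + - (b' · 1#)) ≈⟨ interchange _ _ _ _ ⟩
      (a · 1# - b · 1#) + (a' · 1# - b' · 1#) ∎

    sum-of-products : ∀ a b a' b' → (a ℕ.* a' ℕ.+ b ℕ.* b') · 1# ≈ (a · 1#) * (a' · 1#) + (b · 1#) * (b' · 1#)
    sum-of-products a b a' b' =
      trans (×-homo-+ 1# (a ℕ.* a') (b ℕ.* b')) (+-cong (×1-homo-* a a') (×1-homo-* b b'))

    *-homo : ∀ a b a' b' → ⟦ a ℕ.* a' ℕ.+ b ℕ.* b' , a ℕ.* b' ℕ.+ b ℕ.* a' ⟧ ≈ ⟦ a , b ⟧ * ⟦ a' , b' ⟧
    *-homo a b a' b' = begin
      ⟦ a ℕ.* a' ℕ.+ b ℕ.* b' , a ℕ.* b' ℕ.+ b ℕ.* a' ⟧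
        ≈⟨ +-cong (sum-of-products a b a' b') (-‿cong (sum-of-products a b b' a')) ⟩
      (A * A' + B * B') - (A * B' + B * A') ≈⟨ +-congˡ (trans (-‿+ _ _) (+-comm _ _)) ⟩
      (A * A' + B * B') + (- (B * A') + - (A * B')) ≈⟨ interchange _ _ _ _ ⟩
      (A * A' - B * A') + (B * B' - A * B')
        ≈⟨ +-cong (sym ([y-z]x≈yx-zx _ _ _))
            (trans (+-comm _ _) (trans (+-congˡ (sym (-‿involutive _)))
            (trans (-‿+-comm _ _) (-‿cong (sym ([y-z]x≈yx-zx _ _ _)))))) ⟩
      (A - B) * A' - (A - B) * B' ≈⟨ x[y-z]≈xy-xz _ _ _ ⟨
      (A - B) * (A' - B') ∎
      where
        A = a · 1#
        B = b · 1#
        A' = a' · 1#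
        B' = b' · 1#

    +-cancel-differences : ∀ w x y z → w + z ≈ y + x → w - x ≈ y - z
    +-cancel-differences w x y z eq = begin
      w - x                ≈⟨ +-congʳ (+-identityʳ w) ⟨
      (w + 0#) - x         ≈⟨ +-congʳ (+-congˡ (-‿inverseʳ z)) ⟨
      (w + (z - z)) - x    ≈⟨ +-congʳ (+-assoc w z (- z)) ⟨
      ((w + z) - z) - x    ≈⟨ +-congʳ (+-congʳ eq) ⟩
      ((y + x) - z) - x    ≈⟨ +-assoc _ _ _ ⟩
      (y + x) + (- z + - x) ≈⟨ interchange _ _ _ _ ⟩
      (y - z) + (x - x)    ≈⟨ +-congˡ (-‿inverseʳ x) ⟩
      (y - z) + 0#         ≈⟨ +-identityʳ _ ⟩
      y - z ∎

    morphism : differences -Raw-AlmostCommutative⟶ fromCommutativeRing R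
    morphism = record
      { ⟦_⟧    = ⟦_⟧
      ; +-homo = λ (a , b) (a' , b') → +-homo a b a' b'
      ; *-homo = λ (a , b) (a' , b') → *-homo a b a' b'
      ; -‿homo = λ (a , b) → trans (+-comm _ _) (trans (+-congˡ (sym (-‿involutive _))) (-‿+-comm _ _))
      ; 0-homo = -‿inverseʳ 0#
      ; 1-homo = trans (+-cong (+-identityʳ 1#) -0#≈0#) (+-identityʳ 1#)
      }

    -- Formal differences are not normalised, so equality of coefficients is tested by cross sums.
    -- This lets the solver cancel, for instance, `1 , 1` against `0 , 0`.
    _≟_ : ∀ x y → Maybe (⟦ x ⟧ ≈ ⟦ y ⟧)
    (a , b) ≟ (a' , b') with a ℕ.+ b' ℕ.≟ a' ℕ.+ b
    ... | no  _  = nothing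
    ... | yes eq = just (+-cancel-differences _ _ _ _
      (trans (sym (×-homo-+ 1# a b')) (trans (reflexive (≡.cong (_· 1#) eq)) (×-homo-+ 1# a' b))))

  open Algebra.Solver.Ring differences (fromCommutativeRing R) morphism _≟_ public
    using (solve; _:=_; _:+_; _:*_; _:-_; :-_)

-- Determinants as iterated interior products

module Determinant {c ℓ} (R : CommutativeRing c ℓ) where
  open CommutativeRing R hiding (zero)
  open RingDefs R using (sign; sumFin; det)
  open RingSolver R
  open Algebra.Properties.Ring ring
  open Relation.Binary.Reasoning.Setoid setoid

  private
    variable
      p : Level
      A A' B B' : Set p

    a*0-0≈0 : ∀ {x y z} → y ≈ 0# → z ≈ 0# → x * y - z ≈ 0#
    a*0-0≈0 {x} y≈0 z≈0 = trans (+-cong (trans (*-congˡ y≈0) (zeroʳ x)) (trans (-‿cong z≈0) -0#≈0#)) (+-identityʳ 0#)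

  -- Interior product: ι r f is the signed sum over the entries x of a list of
  -- r x times f of the list with x deleted.
  ι : (B → Carrier) → (List B → Carrier) → List B → Carrier
  ι r f []       = 0#
  ι r f (x ∷ xs) = r x * f xs - ι r (f ∘ (x ∷_)) xs

  -- The minor without rows. Its value 0 on a nonempty list makes every minor with unequal numbers
  -- of rows and columns vanish, so no length condition has to be carried along.
  ε : List B → Carrier
  ε []      = 1#
  ε (_ ∷ _) = 0#

  -- Laplace expansion along the rows. A row acts as the operator `ι (M a)`, so facts about rows
  -- become operator identities, and facts about columns become properties of functions of lists.
  Det : (A → B → Carrier) → List A → List B → Carrier
  Det M []       = ε
  Det M (a ∷ as) = ι (M a) (Det M as)

  ι-map : (Q : B → Set p) {r : B → Carrier} {r' : B' → Carrier} {f : List B → Carrier} {f' : List B' → Carrier}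
        → (g : B → B') → (∀ {x} → Q x → r x ≈ r' (g x)) → (∀ {zs} → All Q zs → f zs ≈ f' (map g zs))
        → ∀ {xs} → All Q xs → ι r f xs ≈ ι r' f' (map g xs)
  ι-map Q g r≈ f≈ []       = refl
  ι-map Q g r≈ f≈ (q ∷ qs) =
    +-cong (*-cong (r≈ q) (f≈ qs)) (-‿cong (ι-map Q g r≈ (λ qs' → f≈ (q ∷ qs')) qs))

  Det-map : (M : A → B → Carrier) (M' : A' → B' → Carrier) (f : A → A') (g : B → B') (as : List A) (bs : List B)
          → (∀ {a b} → a ∈ as → b ∈ bs → M a b ≈ M' (f a) (g b))
          → Det M as bs ≈ Det M' (map f as) (map g bs)
  Det-map {A = A} M M' f g as bs M≈ = go as (All.tabulate (λ b∈ _ a∈ → M≈ a∈ b∈))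
    where
      go : ∀ as {xs} → All (λ b → ∀ a → a ∈ as → M a b ≈ M' (f a) (g b)) xs
         → Det M as xs ≈ Det M' (map f as) (map g xs)
      go []       []      = refl
      go []       (_ ∷ _) = refl
      go (a ∷ as) qs      = ι-map (λ b → ∀ a' → a' ∈ a ∷ as → M a' b ≈ M' (f a') (g b)) g
        (λ q → q a (here ≡.refl)) (λ qs' → go as (All.map (λ q a' a∈ → q a' (there a∈)) qs')) qs

  Det-cong : (M M' : A → B → Carrier) (as : List A) (bs : List B)
           → (∀ {a b} → a ∈ as → b ∈ bs → M a b ≈ M' a b) → Det M as bs ≈ Det M' as bs
  Det-cong M M' as bs M≈ = trans (Det-map M M' (λ a → a) (λ b → b) as bs M≈)
    (reflexive (≡.cong₂ (Det M') (map-id as) (map-id bs)))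

  ι-cong : {r : B → Carrier} {f f' : List B → Carrier} → (∀ zs → f zs ≈ f' zs) → ∀ xs → ι r f xs ≈ ι r f' xs
  ι-cong f≈ []       = refl
  ι-cong f≈ (x ∷ xs) = +-cong (*-congˡ (f≈ xs)) (-‿cong (ι-cong (λ zs → f≈ (x ∷ zs)) xs))

  ι-zero : {r : B → Carrier} {f : List B → Carrier} → (∀ zs → f zs ≈ 0#) → ∀ xs → ι r f xs ≈ 0#
  ι-zero f≈0 []       = refl
  ι-zero f≈0 (x ∷ xs) = a*0-0≈0 (f≈0 xs) (ι-zero (λ zs → f≈0 (x ∷ zs)) xs)

  -- Linearity in exactly the combination that one clause of `ι` produces when the argument is
  -- itself an interior product.
  ι-*- : (r : B → Carrier) (a : Carrier) (f g : List B → Carrier) → ∀ xs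
       → ι r (λ zs → a * f zs - g zs) xs ≈ a * ι r f xs - ι r g xs
  ι-*- r a f g []       = sym (a*0-0≈0 refl refl)
  ι-*- r a f g (x ∷ xs) = trans (+-congˡ (-‿cong (ι-*- r a (f ∘ (x ∷_)) (g ∘ (x ∷_)) xs)))
    (solve 6 (λ k a u v w z → k :* (a :* u :- v) :- (a :* w :- z) := a :* (k :* u :- w) :- (k :* v :- z))
      refl (r x) a (f xs) (g xs) (ι r (f ∘ (x ∷_)) xs) (ι r (g ∘ (x ∷_)) xs))

  ι-neg : (r : B → Carrier) (f : List B → Carrier) → ∀ xs → ι r (λ zs → - f zs) xs ≈ - ι r f xs
  ι-neg r f []       = sym -0#≈0#
  ι-neg r f (x ∷ xs) = trans (+-congˡ (-‿cong (ι-neg r (f ∘ (x ∷_)) xs)))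
    (solve 3 (λ k u w → k :* (:- u) :- (:- w) := :- (k :* u :- w)) refl (r x) (f xs) (ι r (f ∘ (x ∷_)) xs))

  ι-row+ : (r s : B → Carrier) (a : Carrier) (f : List B → Carrier) → ∀ xs
         → ι (λ x → r x + a * s x) f xs ≈ ι r f xs + a * ι s f xs
  ι-row+ r s a f []       = sym (trans (+-identityˡ _) (zeroʳ a))
  ι-row+ r s a f (x ∷ xs) = trans (+-congˡ (-‿cong (ι-row+ r s a (f ∘ (x ∷_)) xs)))
    (solve 6 (λ k l a u v w → (k :+ a :* l) :* u :- (v :+ a :* w) := (k :* u :- v) :+ a :* (l :* u :- w))
      refl (r x) (s x) a (f xs) (ι r (f ∘ (x ∷_)) xs) (ι s (f ∘ (x ∷_)) xs))

  -- Induction on the list: the terms in which one of the two rows takes the entry in front match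
  -- crosswise, and the terms in which neither does are the induction hypothesis.
  ι-anticomm : (r s : B → Carrier) (f : List B → Carrier) → ∀ xs → ι r (ι s f) xs ≈ - ι s (ι r f) xs
  ι-anticomm r s f []       = sym -0#≈0#
  ι-anticomm r s f (x ∷ xs) = begin
    r x * ι s f xs - ι r (λ zs → s x * f zs - ι s fₓ zs) xs
      ≈⟨ +-congˡ (-‿cong (trans (ι-*- r (s x) f (ι s fₓ) xs) (+-congˡ (-‿cong (ι-anticomm r s fₓ xs))))) ⟩
    r x * ι s f xs - (s x * ι r f xs - (- ι s (ι r fₓ) xs))
      ≈⟨ solve 3 (λ u v w → u :- (v :- (:- w)) := :- (v :- (u :- w))) refl _ _ _ ⟩
    - (s x * ι r f xs - (r x * ι s f xs - ι s (ι r fₓ) xs))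
      ≈⟨ -‿cong (+-congˡ (-‿cong (ι-*- s (r x) f (ι r fₓ) xs))) ⟨
    - (s x * ι r f xs - ι s (λ zs → r x * f zs - ι r fₓ zs) xs) ∎
    where fₓ = f ∘ (x ∷_)

  -- Anticommutativity only shows that twice this value is zero, which says too little when 2 is a
  -- zero divisor, hence a separate induction.
  ι-square : (r : B → Carrier) (f : List B → Carrier) → ∀ xs → ι r (ι r f) xs ≈ 0#
  ι-square r f []       = refl
  ι-square r f (x ∷ xs) = begin
    r x * ι r f xs - ι r (λ zs → r x * f zs - ι r fₓ zs) xs
      ≈⟨ +-congˡ (-‿cong (trans (ι-*- r (r x) f (ι r fₓ) xs) (+-congˡ (-‿cong (ι-square r fₓ xs))))) ⟩
    r x * ι r f xs - (r x * ι r f xs - 0#)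
      ≈⟨ solve 2 (λ u v → u :- (u :- v) := v) refl _ _ ⟩
    0# ∎
    where fₓ = f ∘ (x ∷_)

  Alternating : (List B → Carrier) → Set _
  Alternating f = ∀ pre x y zs → f (pre ++ x ∷ y ∷ zs) ≈ - f (pre ++ y ∷ x ∷ zs)

  ι-alternating : (r : B → Carrier) {f : List B → Carrier} → Alternating f → Alternating (ι r f)
  ι-alternating r alt (w ∷ pre) x y zs = trans
    (+-cong (*-congˡ (alt pre x y zs)) (-‿cong (ι-alternating r (λ pre' → alt (w ∷ pre')) pre x y zs)))
    (solve 3 (λ k u v → k :* (:- u) :- (:- v) := :- (k :* u :- v)) refl _ _ _)
  ι-alternating r {f} alt [] x y zs = trans
    (+-congˡ (-‿cong (+-congˡ (-‿cong (trans (ι-cong (alt [] x y) zs) (ι-neg r (λ zs' → f (y ∷ x ∷ zs')) zs))))))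
    (solve 3 (λ u v w → u :- (v :- (:- w)) := :- (v :- (u :- w))) refl _ _ _)

  Det-alternating : (M : A → B → Carrier) (as : List A) → Alternating (Det M as)
  Det-alternating M []       []        x y zs = sym -0#≈0#
  Det-alternating M []       (_ ∷ pre) x y zs = sym -0#≈0#
  Det-alternating M (a ∷ as)                  = ι-alternating (M a) (Det-alternating M as)

  Det-row-swap : (M : A → B → Carrier) (pre : List A) (a b : A) (as : List A) → ∀ xs
               → Det M (pre ++ a ∷ b ∷ as) xs ≈ - Det M (pre ++ b ∷ a ∷ as) xs
  Det-row-swap M []        a b as xs = ι-anticomm (M a) (M b) (Det M as) xs
  Det-row-swap M (w ∷ pre) a b as xs = trans (ι-cong (Det-row-swap M pre a b as) xs) (ι-neg (M w) _ xs)

  -- A minor whose rows and columns are matched. Permuting the pairs permutes rows and columns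
  -- alike, so the two signs cancel and the pieces of the diagram can be treated as an unordered
  -- collection.
  DetPairs : (A → B → Carrier) → List (A × B) → Carrier
  DetPairs M L = Det M (map proj₁ L) (map proj₂ L)

  private
    DetPairs-swap : (M : A → B → Carrier) (pre : List (A × B)) (x y : A × B) (L : List (A × B))
                  → DetPairs M (pre ++ x ∷ y ∷ L) ≈ DetPairs M (pre ++ y ∷ x ∷ L)
    DetPairs-swap M pre x y L
      rewrite map-++ proj₁ pre (x ∷ y ∷ L) | map-++ proj₂ pre (x ∷ y ∷ L)
            | map-++ proj₁ pre (y ∷ x ∷ L) | map-++ proj₂ pre (y ∷ x ∷ L) = begin
      Det M (p₁ ++ proj₁ x ∷ proj₁ y ∷ l₁) (p₂ ++ proj₂ x ∷ proj₂ y ∷ l₂)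
        ≈⟨ Det-row-swap M p₁ _ _ l₁ _ ⟩
      - Det M (p₁ ++ proj₁ y ∷ proj₁ x ∷ l₁) (p₂ ++ proj₂ x ∷ proj₂ y ∷ l₂)
        ≈⟨ -‿cong (Det-alternating M (p₁ ++ proj₁ y ∷ proj₁ x ∷ l₁) p₂ _ _ l₂) ⟩
      - - Det M (p₁ ++ proj₁ y ∷ proj₁ x ∷ l₁) (p₂ ++ proj₂ y ∷ proj₂ x ∷ l₂)
        ≈⟨ -‿involutive _ ⟩
      Det M (p₁ ++ proj₁ y ∷ proj₁ x ∷ l₁) (p₂ ++ proj₂ y ∷ proj₂ x ∷ l₂) ∎
      where
        p₁ = map proj₁ pre
        p₂ = map proj₂ pre
        l₁ = map proj₁ L
        l₂ = map proj₂ L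

    -- The prefix is what makes induction on the permutation work: a permutation below some leading
    -- entries has to be applied with these entries still present in the minor.
    DetPairs-↭-prefix : (M : A → B → Carrier) {L L' : List (A × B)} → L ↭ L'
                      → ∀ pre → DetPairs M (pre ++ L) ≈ DetPairs M (pre ++ L')
    DetPairs-↭-prefix M Perm.refl        pre = refl
    DetPairs-↭-prefix M (prep {L} {L'} x q) pre = begin
      DetPairs M (pre ++ x ∷ L)         ≡⟨ ≡.cong (DetPairs M) (++-assoc pre (x ∷ []) L) ⟨
      DetPairs M ((pre ++ x ∷ []) ++ L) ≈⟨ DetPairs-↭-prefix M q (pre ++ x ∷ []) ⟩
      DetPairs M ((pre ++ x ∷ []) ++ L') ≡⟨ ≡.cong (DetPairs M) (++-assoc pre (x ∷ []) L') ⟩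
      DetPairs M (pre ++ x ∷ L') ∎
    DetPairs-↭-prefix M (swap {L} {L'} x y q) pre = begin
      DetPairs M (pre ++ x ∷ y ∷ L)         ≈⟨ DetPairs-swap M pre x y L ⟩
      DetPairs M (pre ++ y ∷ x ∷ L)         ≡⟨ ≡.cong (DetPairs M) (++-assoc pre (y ∷ x ∷ []) L) ⟨
      DetPairs M ((pre ++ y ∷ x ∷ []) ++ L) ≈⟨ DetPairs-↭-prefix M q (pre ++ y ∷ x ∷ []) ⟩
      DetPairs M ((pre ++ y ∷ x ∷ []) ++ L') ≡⟨ ≡.cong (DetPairs M) (++-assoc pre (y ∷ x ∷ []) L') ⟩
      DetPairs M (pre ++ y ∷ x ∷ L') ∎
    DetPairs-↭-prefix M (Perm.trans q q') pre = trans (DetPairs-↭-prefix M q pre) (DetPairs-↭-prefix M q' pre)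

  DetPairs-↭ : (M : A → B → Carrier) {L L' : List (A × B)} → L ↭ L' → DetPairs M L ≈ DetPairs M L'
  DetPairs-↭ M q = DetPairs-↭-prefix M q []

  private
    sign-suc : ∀ n x → - (sign n * x) ≈ sign (suc n) * x
    sign-suc n x = -‿distribˡ-* (sign n) x

  Det-row-to-front : (M : A → B → Carrier) (pre : List A) (a : A) (as : List A) → ∀ xs
                   → Det M (pre ++ a ∷ as) xs ≈ sign (length pre) * Det M (a ∷ pre ++ as) xs
  Det-row-to-front M []        a as xs = sym (*-identityˡ _)
  Det-row-to-front M (w ∷ pre) a as xs = begin
    ι (M w) (Det M (pre ++ a ∷ as)) xs ≈⟨ ι-cong (Det-row-to-front M pre a as) xs ⟩
    -- The scalar is pulled out through `ι-*-` with the zero function as subtrahend.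
    ι (M w) (λ zs → sign n * Det M (a ∷ pre ++ as) zs) xs ≈⟨ ι-cong (λ zs → trans (+-congˡ -0#≈0#) (+-identityʳ _)) xs ⟨
    ι (M w) (λ zs → sign n * Det M (a ∷ pre ++ as) zs - 0#) xs ≈⟨ ι-*- (M w) (sign n) _ _ xs ⟩
    sign n * ι (M w) (Det M (a ∷ pre ++ as)) xs - ι (M w) (λ _ → 0#) xs
      ≈⟨ +-cong (*-congˡ (ι-anticomm (M w) (M a) (Det M (pre ++ as)) xs)) (-‿cong (ι-zero (λ _ → refl) xs)) ⟩
    sign n * (- Det M (a ∷ w ∷ pre ++ as) xs) - 0#
      ≈⟨ trans (+-congˡ -0#≈0#) (+-identityʳ _) ⟩
    sign n * (- Det M (a ∷ w ∷ pre ++ as) xs)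
      ≈⟨ trans (sym (-‿distribʳ-* _ _)) (sign-suc n _) ⟩
    sign (suc n) * Det M (a ∷ w ∷ pre ++ as) xs ∎
    where n = length pre

  Alternating-to-front : {f : List B → Carrier} → Alternating f → ∀ pre x zs
                       → f (pre ++ x ∷ zs) ≈ sign (length pre) * f (x ∷ pre ++ zs)
  Alternating-to-front alt []        x zs = sym (*-identityˡ _)
  Alternating-to-front {f = f} alt (w ∷ pre) x zs = begin
    f (w ∷ pre ++ x ∷ zs)                       ≈⟨ Alternating-to-front {f = f ∘ (w ∷_)} (λ pre' → alt (w ∷ pre')) pre x zs ⟩
    sign (length pre) * f (w ∷ x ∷ pre ++ zs)   ≈⟨ *-congˡ (alt [] w x (pre ++ zs)) ⟩
    sign (length pre) * - f (x ∷ w ∷ pre ++ zs) ≈⟨ trans (sym (-‿distribʳ-* _ _)) (sign-suc (length pre) _) ⟩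
    sign (suc (length pre)) * f (x ∷ w ∷ pre ++ zs) ∎

  Det-col-to-front : (M : A → B → Carrier) (as : List A) → ∀ pre x zs
                   → Det M as (pre ++ x ∷ zs) ≈ sign (length pre) * Det M as (x ∷ pre ++ zs)
  Det-col-to-front M as = Alternating-to-front {f = Det M as} (Det-alternating M as)

  Det-zero-col : (M : A → B → Carrier) (as : List A) (b : B) → (∀ {a} → a ∈ as → M a b ≈ 0#)
               → ∀ pre zs → Det M as (pre ++ b ∷ zs) ≈ 0#
  Det-zero-col M []       b z []        zs = refl
  Det-zero-col M []       b z (_ ∷ pre) zs = refl
  Det-zero-col {B = B} M (a ∷ as) b z = go (Det-zero-col M as b (z ∘ there))
    where
      go : {f : List B → Carrier} → (∀ pre zs → f (pre ++ b ∷ zs) ≈ 0#) → ∀ pre zs → ι (M a) f (pre ++ b ∷ zs) ≈ 0#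
      go f≈0 (x ∷ pre) zs = a*0-0≈0 (f≈0 pre zs) (go (λ pre' → f≈0 (x ∷ pre')) pre zs)
      go f≈0 []        zs = trans (+-cong (trans (*-congʳ (z (here ≡.refl))) (zeroˡ _))
        (trans (-‿cong (ι-zero (f≈0 []) zs)) -0#≈0#)) (+-identityʳ 0#)

  Det-equal-cols : (M : A → B → Carrier) (as : List A) (x y : B) → (∀ {a} → a ∈ as → M a x ≈ M a y)
                 → ∀ zs → Det M as (x ∷ y ∷ zs) ≈ 0#
  Det-equal-cols M []       x y e zs = refl
  Det-equal-cols M (a ∷ as) x y e zs = begin
    M a x * Det M as (y ∷ zs) - (M a y * Det M as (x ∷ zs) - ι (M a) (λ zs' → Det M as (x ∷ y ∷ zs')) zs)
      ≈⟨ +-cong (*-congʳ (e (here ≡.refl)))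
          (-‿cong (+-cong (*-congˡ (same zs)) (-‿cong (ι-zero (Det-equal-cols M as x y (e ∘ there)) zs)))) ⟩
    M a y * Det M as (y ∷ zs) - (M a y * Det M as (y ∷ zs) - 0#)
      ≈⟨ solve 2 (λ u v → u :- (u :- v) := v) refl _ _ ⟩
    0# ∎
    where
      same : ∀ zs → Det M as (x ∷ zs) ≈ Det M as (y ∷ zs)
      same = go as (e ∘ there)
        where
          go : ∀ as → (∀ {a} → a ∈ as → M a x ≈ M a y) → ∀ zs → Det M as (x ∷ zs) ≈ Det M as (y ∷ zs)
          go []       e zs = refl
          go (a ∷ as) e zs = +-cong (*-congʳ (e (here ≡.refl))) (-‿cong (ι-cong (go as (e ∘ there)) zs))

  -- With the row `w` in front, each multiple of `w` added to another row contributes a term with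
  -- `w` twice, which dies by `ι-square`.
  Det-row-op : (M N : A → B → Carrier) (w : B → Carrier) (k : A → Carrier) (as : List A)
             → (∀ {a} → a ∈ as → ∀ b → N a b ≈ M a b + k a * w b)
             → ∀ xs → ι w (Det N as) xs ≈ ι w (Det M as) xs
  Det-row-op M N w k []       N≈ xs = refl
  Det-row-op M N w k (a ∷ as) N≈ xs = begin
    ι w (ι (N a) (Det N as)) xs ≈⟨ ι-anticomm w (N a) (Det N as) xs ⟩
    - ι (N a) (ι w (Det N as)) xs ≈⟨ -‿cong (ι-cong (Det-row-op M N w k as (N≈ ∘ there)) xs) ⟩
    - ι (N a) (ι w (Det M as)) xs ≈⟨ -‿cong (ι-row-cong (N≈ (here ≡.refl)) xs) ⟩
    - ι (λ b → M a b + k a * w b) (ι w (Det M as)) xs ≈⟨ -‿cong (ι-row+ (M a) w (k a) _ xs) ⟩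
    - (ι (M a) (ι w (Det M as)) xs + k a * ι w (ι w (Det M as)) xs)
      ≈⟨ -‿cong (+-congˡ (trans (*-congˡ (ι-square w (Det M as) xs)) (zeroʳ (k a)))) ⟩
    - (ι (M a) (ι w (Det M as)) xs + 0#) ≈⟨ -‿cong (+-identityʳ _) ⟩
    - ι (M a) (ι w (Det M as)) xs ≈⟨ ι-anticomm w (M a) (Det M as) xs ⟨
    ι w (ι (M a) (Det M as)) xs ∎
    where
      ι-row-cong : {r r' : B → Carrier} {f : List B → Carrier} → (∀ x → r x ≈ r' x) → ∀ xs → ι r f xs ≈ ι r' f xs
      ι-row-cong r≈ []       = refl
      ι-row-cong r≈ (x ∷ xs) = +-cong (*-congʳ (r≈ x)) (-‿cong (ι-row-cong r≈ xs))

  Det-unit-col : (M : A → B → Carrier) (a : A) (as : List A) (b : B) → M a b ≈ 1# → (∀ {a} → a ∈ as → M a b ≈ 0#)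
               → ∀ xs → Det M (a ∷ as) (b ∷ xs) ≈ Det M as xs
  Det-unit-col M a as b one z xs = begin
    M a b * Det M as xs - ι (M a) (λ zs → Det M as (b ∷ zs)) xs
      ≈⟨ +-cong (trans (*-congʳ one) (*-identityˡ _)) (trans (-‿cong (ι-zero (Det-zero-col M as b z []) xs)) -0#≈0#) ⟩
    Det M as xs + 0# ≈⟨ +-identityʳ _ ⟩
    Det M as xs ∎

  -- Chio condensation: clearing the column `b` by means of the row `a` leaves the Schur complement
  -- of the unit entry.
  Det-condense : (M : A → B → Carrier) (a : A) (b : B) → M a b ≈ 1# → ∀ as xs
               → Det M (a ∷ as) (b ∷ xs) ≈ Det (λ a' b' → M a' b' - M a' b * M a b') as xs
  Det-condense {A = A} {B = B} M a b one as xs = begin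
    ι (M a) (Det M as) (b ∷ xs) ≈⟨ Det-row-op M N (M a) (λ a' → - M a' b) as (λ _ b' → +-congˡ (-‿distribˡ-* _ _)) (b ∷ xs) ⟨
    ι (M a) (Det N as) (b ∷ xs) ≈⟨ +-cong (trans (*-congʳ one) (*-identityˡ _))
        (trans (-‿cong (ι-zero (Det-zero-col N as b (λ _ → zero-at-b) []) xs)) -0#≈0#) ⟩
    Det N as xs + 0# ≈⟨ +-identityʳ _ ⟩
    Det N as xs ∎
    where
      N : A → B → Carrier
      N a' b' = M a' b' - M a' b * M a b'
      zero-at-b : ∀ {a'} → N a' b ≈ 0#
      zero-at-b = trans (+-congˡ (-‿cong (trans (*-congˡ one) (*-identityʳ _)))) (-‿inverseʳ _)

  -- Reduced to condensation by bordering the matrix with an extra copy of the column b.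
  Det-col-op : (M : A → B → Carrier) (b : B) (t : B → Carrier) → t b ≈ 0# → ∀ as xs
             → Det (λ a x → M a x - M a b * t x) as (b ∷ xs) ≈ Det M as (b ∷ xs)
  Det-col-op {A = A} {B = B} M b t tb as xs = begin
    Det (λ a x → M a x - M a b * t x) as (b ∷ xs)
      ≈⟨ Det-map _ _ just just as (b ∷ xs) (λ _ _ → refl) ⟩
    Det (λ a x → M⁺ a x - M⁺ a nothing * M⁺ nothing x) as⁺ (just b ∷ xs⁺)
      ≈⟨ Det-condense M⁺ nothing nothing refl as⁺ (just b ∷ xs⁺) ⟨
    1# * D (just b ∷ xs⁺) - (t b * D (nothing ∷ xs⁺) - ι (M⁺ nothing) (λ zs → D (nothing ∷ just b ∷ zs)) xs⁺)
      ≈⟨ +-cong (*-identityˡ _) (-‿cong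
          (+-cong (trans (*-congʳ tb) (zeroˡ _)) (-‿cong (ι-zero (Det-equal-cols M⁺ as⁺ nothing (just b) same) xs⁺)))) ⟩
    D (just b ∷ xs⁺) - (0# - 0#) ≈⟨ solve 2 (λ u v → u :- (v :- v) := u) refl _ _ ⟩
    D (just b ∷ xs⁺) ≈⟨ Det-map _ _ just just as (b ∷ xs) (λ _ _ → refl) ⟨
    Det M as (b ∷ xs) ∎
    where
      M⁺ : Maybe A → Maybe B → Carrier
      M⁺ (just a) (just x) = M a x
      M⁺ (just a) nothing  = M a b
      M⁺ nothing  (just x) = t x
      M⁺ nothing  nothing  = 1#
      as⁺ = map just as
      xs⁺ = map just xs
      D = Det M⁺ as⁺
      same : ∀ {a} → a ∈ as⁺ → M⁺ a nothing ≈ M⁺ a (just b)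
      same a∈ with AnyP.map⁻ a∈
      ... | q with satisfied q
      ... | _ , ≡.refl = refl

  prod : (A → Carrier) → List A → Carrier
  prod s = foldr (λ x k → s x * k) 1#

  ι-scale : (r t : B → Carrier) (f g : List B → Carrier) → (∀ zs → g zs ≈ prod t zs * f zs)
          → ∀ xs → ι (λ x → r x * t x) g xs ≈ prod t xs * ι r f xs
  ι-scale r t f g g≈ []       = sym (zeroʳ _)
  ι-scale r t f g g≈ (x ∷ xs) = begin
    r x * t x * g xs - ι (λ x → r x * t x) (g ∘ (x ∷_)) xs
      ≈⟨ +-cong (*-congˡ (g≈ xs)) (-‿cong (ι-scale r t (λ zs → t x * f (x ∷ zs)) _
           (λ zs → trans (g≈ (x ∷ zs)) (solve 3 (λ k p u → k :* p :* u := p :* (k :* u)) refl _ _ _)) xs)) ⟩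
    r x * t x * (prod t xs * f xs) - prod t xs * ι r (λ zs → t x * f (x ∷ zs)) xs
      ≈⟨ +-congˡ (-‿cong (*-congˡ (scalar xs))) ⟩
    r x * t x * (prod t xs * f xs) - prod t xs * (t x * ι r (f ∘ (x ∷_)) xs)
      ≈⟨ solve 5 (λ r t p u v → r :* t :* (p :* u) :- p :* (t :* v) := t :* p :* (r :* u :- v)) refl _ _ _ _ _ ⟩
    t x * prod t xs * (r x * f xs - ι r (f ∘ (x ∷_)) xs) ∎
    where
      scalar : ∀ xs → ι r (λ zs → t x * f (x ∷ zs)) xs ≈ t x * ι r (f ∘ (x ∷_)) xs
      scalar xs = begin
        ι r (λ zs → t x * f (x ∷ zs)) xs ≈⟨ ι-cong (λ zs → trans (+-congˡ -0#≈0#) (+-identityʳ _)) xs ⟨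
        ι r (λ zs → t x * f (x ∷ zs) - 0#) xs ≈⟨ ι-*- r (t x) (f ∘ (x ∷_)) (λ _ → 0#) xs ⟩
        t x * ι r (f ∘ (x ∷_)) xs - ι r (λ _ → 0#) xs ≈⟨ +-congˡ (trans (-‿cong (ι-zero (λ _ → refl) xs)) -0#≈0#) ⟩
        t x * ι r (f ∘ (x ∷_)) xs + 0# ≈⟨ +-identityʳ _ ⟩
        t x * ι r (f ∘ (x ∷_)) xs ∎

  Det-scale : (M : A → B → Carrier) (s : A → Carrier) (t : B → Carrier) → ∀ as xs
            → Det (λ a b → s a * M a b * t b) as xs ≈ prod s as * (prod t xs * Det M as xs)
  Det-scale M s t []       []      = sym (trans (*-identityˡ _) (*-identityˡ _))
  Det-scale M s t []       (_ ∷ _) = sym (trans (*-congˡ (zeroʳ _)) (zeroʳ _))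
  Det-scale M s t (a ∷ as) xs = begin
    ι (λ b → s a * M a b * t b) (Det (λ a b → s a * M a b * t b) as) xs
      ≈⟨ ι-scale (λ b → s a * M a b) t (λ zs → prod s as * Det M as zs) _ (λ zs → trans (Det-scale M s t as zs)
           (solve 3 (λ p q u → p :* (q :* u) := q :* (p :* u)) refl _ _ _)) xs ⟩
    prod t xs * ι (λ b → s a * M a b) (λ zs → prod s as * Det M as zs) xs
      ≈⟨ *-congˡ (scalars xs) ⟩
    prod t xs * (s a * prod s as * ι (M a) (Det M as) xs)
      ≈⟨ solve 3 (λ p q u → p :* (q :* u) := q :* (p :* u)) refl _ _ _ ⟩
    s a * prod s as * (prod t xs * ι (M a) (Det M as) xs) ∎
    where
      scalars : {k l : Carrier} {r : B → Carrier} {f : List B → Carrier} → ∀ xs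
              → ι (λ b → k * r b) (λ zs → l * f zs) xs ≈ k * l * ι r f xs
      scalars []       = sym (zeroʳ _)
      scalars (x ∷ xs) = trans (+-congˡ (-‿cong (scalars xs)))
        (solve 5 (λ k l r u v → k :* r :* (l :* u) :- k :* l :* v := k :* l :* (r :* u :- v)) refl _ _ _ _ _)

  private
    sumFin-cong : ∀ n {f g : Fin n → Carrier} → (∀ i → f i ≈ g i) → sumFin n f ≈ sumFin n g
    sumFin-cong zero    f≈g = refl
    sumFin-cong (suc n) f≈g = +-cong (f≈g fzero) (sumFin-cong n (λ i → f≈g (fsuc i)))

    sumFin-neg : ∀ n (f : Fin n → Carrier) → sumFin n (λ i → - f i) ≈ - sumFin n f
    sumFin-neg zero    f = sym -0#≈0#
    sumFin-neg (suc n) f = trans (+-congˡ (sumFin-neg n (λ i → f (fsuc i)))) (-‿+-comm _ _)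

    -- The nested subtractions in `ι` unfold to the alternating signs of `det`, and deleting the
    -- entry in position `j` is composition with `punchIn j`.
    ι-tabulate : ∀ n (r : B → Carrier) (f : List B → Carrier) (g : Fin (suc n) → B)
               → ι r f (tabulate g) ≈ sumFin (suc n) (λ j → sign (toℕ j) * (r (g j) * f (tabulate (g ∘ punchIn j))))
    ι-tabulate zero    r f g = +-cong (sym (*-identityˡ _)) -0#≈0#
    ι-tabulate (suc n) r f g = +-cong (sym (*-identityˡ _)) (begin
      - ι r (f ∘ (g fzero ∷_)) (tabulate (g ∘ fsuc))
        ≈⟨ -‿cong (ι-tabulate n r (f ∘ (g fzero ∷_)) (g ∘ fsuc)) ⟩
      - sumFin (suc n) t ≈⟨ sumFin-neg (suc n) t ⟨
      sumFin (suc n) (λ j → - t j) ≈⟨ sumFin-cong (suc n)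
          (λ j → sign-suc (toℕ j) (r (g (fsuc j)) * f (g fzero ∷ tabulate (g ∘ fsuc ∘ punchIn j)))) ⟩
      sumFin (suc n) (λ j → sign (suc (toℕ j)) * (r (g (fsuc j)) * f (tabulate (g ∘ punchIn (fsuc j))))) ∎)
      where t = λ j → sign (toℕ j) * (r (g (fsuc j)) * f (g fzero ∷ tabulate (g ∘ fsuc ∘ punchIn j)))

  det≈Det : ∀ n (M : A → B → Carrier) (f : Fin n → A) (g : Fin n → B)
          → det n (λ i j → M (f i) (g j)) ≈ Det M (tabulate f) (tabulate g)
  det≈Det zero    M f g = refl
  det≈Det (suc n) M f g = trans
    (sumFin-cong (suc n) (λ j → *-congˡ {sign (toℕ j)}
        (*-congˡ {M (f fzero) (g j)} (det≈Det n M (f ∘ fsuc) (g ∘ punchIn j)))))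
    (sym (ι-tabulate n (M (f fzero)) (Det M (tabulate (f ∘ fsuc))) g))

  det-cong : ∀ n {M M' : Fin n → Fin n → Carrier} → (∀ i j → M i j ≈ M' i j) → det n M ≈ det n M'
  det-cong zero    M≈ = refl
  det-cong (suc n) M≈ = sumFin-cong (suc n) (λ j →
    *-congˡ {sign (toℕ j)} (*-cong (M≈ fzero j) (det-cong n (λ i k → M≈ (fsuc i) (punchIn j k)))))

  private
    -- `P` marks the columns that vanish on the lower rows. Expanding `k` upper rows can absorb at
    -- most `k` of them, so with more than `k` in front the value is zero; with exactly `k` in front
    -- only the rest of the list is left for the lower rows.
    module BlockTriangular {B : Set} (P : B → Set ℓ) (w w' : List B) where
      VanishesFrom : ℕ → (List B → Carrier) → Set _
      VanishesFrom k f = ∀ {xs} → All P xs → k ≤ length xs → ∀ zs → f (xs ++ zs) ≈ 0#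

      AgreeFrom : ℕ → (f f' : List B → Carrier) → Set _
      AgreeFrom k f f' = ∀ {xs} → All P xs → k ≤ length xs → f (xs ++ w) ≈ f' (xs ++ w')

      ι-vanishesFrom : ∀ k r {f} → VanishesFrom k f → VanishesFrom (suc k) (ι r f)
      ι-vanishesFrom zero    r f0 {x ∷ xs} (p ∷ ps) (s≤s k≤) zs = ι-zero (f0 [] z≤n) (x ∷ xs ++ zs)
      ι-vanishesFrom (suc k) r f0 {x ∷ xs} (p ∷ ps) (s≤s k≤) zs =
        a*0-0≈0 (f0 ps k≤ zs) (ι-vanishesFrom k r (λ ps' k≤' → f0 (p ∷ ps') (s≤s k≤')) ps k≤ zs)

      ι-agreeFrom : ∀ k r {f f'} → AgreeFrom k f f' → VanishesFrom (suc k) f → VanishesFrom (suc k) f'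
                  → AgreeFrom (suc k) (ι r f) (ι r f')
      ι-agreeFrom k r {f} {f'} fg f0 f0' {x ∷ xs} (p ∷ ps) (s≤s k≤) =
        +-cong (*-congˡ (fg ps k≤)) (-‿cong (rest k fg f0 f0' k≤))
        where
          rest : ∀ k → AgreeFrom k f f' → VanishesFrom (suc k) f → VanishesFrom (suc k) f' → k ≤ length xs
               → ι r (f ∘ (x ∷_)) (xs ++ w) ≈ ι r (f' ∘ (x ∷_)) (xs ++ w')
          rest zero    fg f0 f0' k≤ = trans (ι-zero (f0 (p ∷ []) (s≤s z≤n)) (xs ++ w))
              (sym (ι-zero (f0' (p ∷ []) (s≤s z≤n)) (xs ++ w')))
          rest (suc k) fg f0 f0' k≤ = ι-agreeFrom k r (λ ps' k≤' → fg (p ∷ ps') (s≤s k≤'))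
            (λ ps' k≤' → f0 (p ∷ ps') (s≤s k≤')) (λ ps' k≤' → f0' (p ∷ ps') (s≤s k≤')) ps k≤

  -- Rows from `a` on vanish on `bs`, so the columns `bs` must be used up by the rows `as`. If there
  -- are as many, `a` then meets the unit column `b`; if there are fewer rows, both sides are zero.
  Det-trim : {A B : Set} (M : A → B → Carrier) (as as' : List A) (a : A) (bs bs' : List B) (b : B)
           → length as ≤ length bs → M a b ≈ 1# → (∀ {x} → x ∈ as' → M x b ≈ 0#)
           → (∀ {x y} → x ∈ a ∷ as' → y ∈ bs → M x y ≈ 0#)
           → Det M (as ++ a ∷ as') (bs ++ b ∷ bs') ≈ Det M (as ++ as') (bs ++ bs')
  Det-trim {A} {B} M as as' a bs bs' b len one zb z = proj₁ (go as) (All.tabulate (λ y∈ x x∈ → z x∈ y∈)) len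
    where
      P : B → Set _
      P y = ∀ x → x ∈ a ∷ as' → M x y ≈ 0#
      open BlockTriangular P (b ∷ bs') bs'
      go : ∀ as → AgreeFrom (length as) (Det M (as ++ a ∷ as')) (Det M (as ++ as'))
                × VanishesFrom (suc (length as)) (Det M (as ++ a ∷ as'))
                × VanishesFrom (suc (length as)) (Det M (as ++ as'))
      go [] = agree
            , (λ { {x ∷ xs} (p ∷ ps) _ zs → Det-zero-col M (a ∷ as') x (p _) [] (xs ++ zs) })
            , (λ { {x ∷ xs} (p ∷ ps) _ zs → Det-zero-col M as' x (λ x∈ → p _ (there x∈)) [] (xs ++ zs) })
        where
          agree : AgreeFrom 0 (Det M (a ∷ as')) (Det M as')
          agree {[]}     _        _ = Det-unit-col M a as' b one zb bs'
          agree {x ∷ xs} (p ∷ ps) _ = trans (Det-zero-col M (a ∷ as') x (p _) [] (xs ++ b ∷ bs'))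
            (sym (Det-zero-col M as' x (λ x∈ → p _ (there x∈)) [] (xs ++ bs')))
      go (x ∷ as) with go as
      ... | fg , f0 , f0' = ι-agreeFrom _ (M x) fg f0 f0' , ι-vanishesFrom _ (M x) f0 , ι-vanishesFrom _ (M x) f0'

-- Principal pivot transforms

opt : Bool → ℕ → List ℕ
opt true  c = c ∷ []
opt false c = []

-- Pairs whose two labels receive the same sign when the pivoted matrix is compared with the
-- principal pivot transform, so that they contribute no sign to a minor.
SameSide : ℕ → ℕ × ℕ → Set
SameSide c (p , v) = (p < c × v < c) ⊎ (c < p × c < v)

module Pivot {c ℓ} (R : CommutativeRing c ℓ) where
  open CommutativeRing R hiding (zero)
  open RingDefs R using (sign)
  open RingSolver R
  open Determinant R
  open Algebra.Properties.Ring ring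
  open Relation.Binary.Reasoning.Setoid setoid

  -- The sign is chosen so that the new entries are ribbon minors without correction: compare
  -- `ribbon-snoc`. The untouched entries are those in which triangularity makes the product
  -- `M p c * M c v` vanish or in which `c` itself is an index.
  pivot : ℕ → (ℕ → ℕ → Carrier) → ℕ → ℕ → Carrier
  pivot c M p v with p <? c | c <? v
  ... | yes _ | yes _ = M p c * M c v - M p v
  ... | _     | _     = M p v

  pivot-between : ∀ {c M p v} → p < c → c < v → pivot c M p v ≈ M p c * M c v - M p v
  pivot-between {c} {M} {p} {v} p<c c<v with p <? c | c <? v
  ... | yes _ | yes _ = refl
  ... | no ¬q | _     = contradiction p<c ¬q
  ... | yes _ | no ¬q = contradiction c<v ¬q

  pivot-above : ∀ {c M p v} → c ≤ p → pivot c M p v ≈ M p v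
  pivot-above {c} {M} {p} {v} c≤p with p <? c | c <? v
  ... | yes p<c | _     = contradiction p<c (≤⇒≯ c≤p)
  ... | no _    | yes _ = refl
  ... | no _    | no _  = refl

  pivot-below : ∀ {c M p v} → v ≤ c → pivot c M p v ≈ M p v
  pivot-below {c} {M} {p} {v} v≤c with p <? c | c <? v
  ... | _     | yes c<v = contradiction c<v (≤⇒≯ v≤c)
  ... | yes _ | no _    = refl
  ... | no _  | no _    = refl

  UpperUnitriangular : (ℕ → ℕ → Carrier) → Set _
  UpperUnitriangular M = (∀ {p v} → v < p → M p v ≈ 0#) × (∀ p → M p p ≈ 1#)

  pivot-unitriangular : ∀ c {M} → UpperUnitriangular M → UpperUnitriangular (pivot c M)
  pivot-unitriangular c (lower , diag) = lower' , diag'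
    where
      lower' : ∀ {p v} → v < p → _
      lower' {p} {v} v<p with ℕP.≤-total c p
      ... | inj₁ c≤p = trans (pivot-above c≤p) (lower v<p)
      ... | inj₂ p≤c = trans (pivot-below (≤-trans (<⇒≤ v<p) p≤c)) (lower v<p)
      diag' : ∀ p → _
      diag' p with ℕP.≤-total c p
      ... | inj₁ c≤p = trans (pivot-above c≤p) (diag p)
      ... | inj₂ p≤c = trans (pivot-below p≤c) (diag p)

  sign-square : ∀ n → sign n * sign n ≈ 1#
  sign-square zero    = *-identityˡ 1#
  sign-square (suc n) = trans (solve 1 (λ u → (:- u) :* (:- u) := u :* u) refl (sign n)) (sign-square n)

  private
    cancel-sign : ∀ n x → sign n * (sign n * x) ≈ x
    cancel-sign n x = trans (sym (*-assoc _ _ _)) (trans (*-congʳ (sign-square n)) (*-identityˡ x))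

    prod-++ : {A : Set} (f : A → Carrier) (xs ys : List A) → prod f (xs ++ ys) ≈ prod f xs * prod f ys
    prod-++ f []       ys = sym (*-identityˡ _)
    prod-++ f (x ∷ xs) ys = trans (*-congˡ (prod-++ f xs ys)) (sym (*-assoc _ _ _))

    prod-one : {A : Set} (f : A → Carrier) (xs : List A) → All (λ x → f x ≈ 1#) xs → prod f xs ≈ 1#
    prod-one f []       []       = refl
    prod-one f (x ∷ xs) (e ∷ es) = trans (*-cong e (prod-one f xs es)) (*-identityˡ 1#)

    Det-cong-first : (M N : ℕ → ℕ → Carrier) (w w' : ℕ → Carrier) (as bs : List ℕ)
                   → (∀ {b} → b ∈ bs → w b ≈ w' b) → (∀ {a b} → a ∈ as → b ∈ bs → M a b ≈ N a b)
                   → ι w (Det M as) bs ≈ ι w' (Det N as) bs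
    Det-cong-first M N w w' as bs w≈ M≈ = trans
      (ι-map (_∈ bs) (λ b → b) w≈ (λ {zs} qs → trans (Det-cong M N as zs (λ a∈ b∈ → M≈ a∈ (All.lookup qs b∈)))
         (reflexive (≡.cong (Det N as) (≡.sym (map-id zs))))) (All.tabulate (λ b∈ → b∈)))
      (reflexive (≡.cong (ι w' (Det N as)) (map-id bs)))

  module _ (c : ℕ) (M : ℕ → ℕ → Carrier) (M-upper : UpperUnitriangular M) where
    private
      lower = proj₁ M-upper
      M' = pivot c M

      -- The label `c` counts as lying above: row `c` keeps its sign and column `c` changes it, as
      -- in the principal pivot transform.
      sg : ℕ → Carrier
      sg x with x <? c
      ... | yes _ = - 1#
      ... | no _  = 1#

      sg-below : ∀ {x} → x < c → sg x ≈ - 1#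
      sg-below {x} x<c with x <? c
      ... | yes _ = refl
      ... | no ¬q = contradiction x<c ¬q

      sg-above : ∀ {x} → c ≤ x → sg x ≈ 1#
      sg-above {x} c≤x with x <? c
      ... | yes q = contradiction q (≤⇒≯ c≤x)
      ... | no _  = refl

      minus-one-square : - 1# * - 1# ≈ 1#
      minus-one-square = sign-square 1

      sg-square : ∀ x → sg x * sg x ≈ 1#
      sg-square x with x <? c
      ... | yes _ = minus-one-square
      ... | no _  = *-identityˡ 1#

      prod-sg-square : ∀ xs → prod sg xs * prod sg xs ≈ 1#
      prod-sg-square []       = *-identityˡ 1#
      prod-sg-square (x ∷ xs) = begin
        (sg x * prod sg xs) * (sg x * prod sg xs) ≈⟨ solve 2 (λ u v → (u :* v) :* (u :* v) :=
            (u :* u) :* (v :* v)) refl _ _ ⟩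
        (sg x * sg x) * (prod sg xs * prod sg xs) ≈⟨ *-cong (sg-square x) (prod-sg-square xs) ⟩
        1# * 1# ≈⟨ *-identityˡ 1# ⟩
        1# ∎

      -- The principal pivot transform of M at c, which equals M' up to the signs sg.
      N : ℕ → ℕ → Carrier
      N p v = sg p * M' p v * sg v

      -- Outside the region `p < c < v` one of the factors `M p c`, `M c v` is zero by
      -- triangularity; inside it the sign of the row `p` reverses the difference in `pivot`.
      N-generic : ∀ {p v} → p ≢ c → v ≢ c → N p v ≈ M p v - M p c * M c v
      N-generic {p} {v} p≢c v≢c with <-cmp p c | <-cmp v c
      ... | tri≈ _ p≡c _ | _            = contradiction p≡c p≢c
      ... | tri< _ _ _   | tri≈ _ v≡c _ = contradiction v≡c v≢c
      ... | tri> _ _ _   | tri≈ _ v≡c _ = contradiction v≡c v≢c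
      ... | tri< p<c _ _ | tri< v<c _ _ = begin
        sg p * M' p v * sg v ≈⟨ *-cong (*-cong (sg-below p<c) (pivot-below {M = M} (<⇒≤ v<c))) (sg-below v<c) ⟩
        - 1# * M p v * - 1# ≈⟨ solve 2 (λ o x → (:- o) :* x :* (:- o) := o :* (o :* x)) refl 1# (M p v) ⟩
        1# * (1# * M p v) ≈⟨ trans (*-identityˡ _) (*-identityˡ _) ⟩
        M p v ≈⟨ trans (+-congˡ (trans (-‿cong (trans (*-congˡ (lower v<c)) (zeroʳ _))) -0#≈0#)) (+-identityʳ _) ⟨
        M p v - M p c * M c v ∎
      ... | tri< p<c _ _ | tri> _ _ c<v = begin
        sg p * M' p v * sg v ≈⟨ *-cong (*-cong (sg-below p<c) (pivot-between p<c c<v)) (sg-above (<⇒≤ c<v)) ⟩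
        - 1# * (M p c * M c v - M p v) * 1# ≈⟨ trans (*-identityʳ _) (-1*x≈-x _) ⟩
        - (M p c * M c v - M p v) ≈⟨ solve 2 (λ x y → :- (x :- y) := y :- x) refl _ _ ⟩
        M p v - M p c * M c v ∎
      ... | tri> _ _ c<p | tri< v<c _ _ = begin
        sg p * M' p v * sg v ≈⟨ *-congʳ (*-congˡ (trans (pivot-above (<⇒≤ c<p)) (lower (<-trans v<c c<p)))) ⟩
        sg p * 0# * sg v ≈⟨ trans (*-congʳ (zeroʳ _)) (zeroˡ _) ⟩
        0# ≈⟨ trans (+-cong (lower (<-trans v<c c<p)) (trans (-‿cong (trans (*-congˡ (lower v<c)) (zeroʳ _))) -0#≈0#))
            (+-identityʳ _) ⟨
        M p v - M p c * M c v ∎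
      ... | tri> _ _ c<p | tri> _ _ c<v = begin
        sg p * M' p v * sg v ≈⟨ *-cong (*-cong (sg-above (<⇒≤ c<p)) (pivot-above (<⇒≤ c<p))) (sg-above (<⇒≤ c<v)) ⟩
        1# * M p v * 1# ≈⟨ trans (*-identityʳ _) (*-identityˡ _) ⟩
        M p v ≈⟨ trans (+-congˡ (trans (-‿cong (trans (*-congʳ (lower c<p)) (zeroˡ _))) -0#≈0#)) (+-identityʳ _) ⟨
        M p v - M p c * M c v ∎

      N-col : ∀ {p} → p ≢ c → N p c ≈ - M p c
      N-col {p} p≢c with <-cmp p c
      ... | tri≈ _ p≡c _ = contradiction p≡c p≢c
      ... | tri< p<c _ _ = trans (*-cong (*-cong (sg-below p<c) (pivot-below {c} {M} {p} {c} ≤-refl)) (sg-above ≤-refl))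
        (trans (*-identityʳ _) (-1*x≈-x _))
      ... | tri> _ _ c<p = trans (*-cong (*-cong (sg-above (<⇒≤ c<p)) (pivot-below {c} {M} {p} {c} ≤-refl)) (sg-above ≤-refl))
        (trans (*-identityʳ _) (trans (*-identityˡ _) (trans (lower c<p) (trans (sym -0#≈0#) (-‿cong (sym (lower c<p)))))))

      N-row : ∀ v → N c v ≈ M c v
      N-row v with <-cmp v c
      ... | tri< v<c _ _ = trans (*-congʳ (*-congˡ (trans (pivot-above {c} {M} {c} {v} ≤-refl) (lower v<c))))
        (trans (*-congʳ (zeroʳ _)) (trans (zeroˡ _) (sym (lower v<c))))
      ... | tri≈ _ ≡.refl _ = trans (*-cong (*-cong (sg-above ≤-refl) (pivot-above {c} {M} {c} {v} ≤-refl)) (sg-above ≤-refl))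
        (trans (*-identityʳ _) (*-identityˡ _))
      ... | tri> _ _ c<v = trans (*-cong (*-cong (sg-above ≤-refl) (pivot-above {c} {M} {c} {v} ≤-refl)) (sg-above (<⇒≤ c<v)))
        (trans (*-identityʳ _) (*-identityˡ _))

      N-corner : N c c ≈ 1#
      N-corner = trans (N-row c) (proj₂ M-upper c)

      unsign : ∀ {k} as bs → prod sg as * prod sg bs ≈ k → Det M' as bs ≈ k * Det N as bs
      unsign {k} as bs e = sym (begin
        k * Det N as bs ≈⟨ *-cong (sym e) (Det-scale M' sg sg as bs) ⟩
        (prod sg as * prod sg bs) * (prod sg as * (prod sg bs * Det M' as bs))
          ≈⟨ solve 3 (λ u v x → (u :* v) :* (u :* (v :* x)) := (u :* u) :* ((v :* v) :* x)) refl _ _ _ ⟩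
        (prod sg as * prod sg as) * ((prod sg bs * prod sg bs) * Det M' as bs)
          ≈⟨ *-cong (prod-sg-square as) (*-congʳ (prod-sg-square bs)) ⟩
        1# * (1# * Det M' as bs) ≈⟨ trans (*-identityˡ _) (*-identityˡ _) ⟩
        Det M' as bs ∎)

    module _ (H T : List ℕ) (O : List (ℕ × ℕ)) (H<c : All (_< c) H) (T>c : All (c <_) T) (O-sides : All (SameSide c) O) where
      private
        P = map proj₁ O
        Q = map proj₂ O
        G = H ++ P
        W = T ++ Q

        P≢c : ∀ {x} → x ∈ P → x ≢ c
        P≢c x∈ = All.lookup (AllP.map⁺ (All.map (λ { (inj₁ (p<c , _)) → <⇒≢ p<c ; (inj₂ (c<p , _)) → ℕP.>⇒≢ c<p }) O-sides)) x∈
        Q≢c : ∀ {x} → x ∈ Q → x ≢ c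
        Q≢c x∈ = All.lookup (AllP.map⁺ (All.map (λ { (inj₁ (_ , v<c)) → <⇒≢ v<c ; (inj₂ (_ , c<v)) → ℕP.>⇒≢ c<v }) O-sides)) x∈
        G≢c : ∀ {x} → x ∈ G → x ≢ c
        G≢c x∈ with ∈-++⁻ H x∈
        ... | inj₁ x∈H = <⇒≢ (All.lookup H<c x∈H)
        ... | inj₂ x∈P = P≢c x∈P
        W≢c : ∀ {x} → x ∈ W → x ≢ c
        W≢c x∈ with ∈-++⁻ T x∈
        ... | inj₁ x∈T = ℕP.>⇒≢ (All.lookup T>c x∈T)
        ... | inj₂ x∈Q = Q≢c x∈Q

        prod-H : ∀ {H} → All (_< c) H → prod sg H ≈ sign (length H)
        prod-H []       = refl
        prod-H (q ∷ qs) = trans (*-cong (sg-below q) (prod-H qs)) (-1*x≈-x _)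

        prod-T : prod sg T ≈ 1#
        prod-T = prod-one sg T (All.map (λ c<v → sg-above (<⇒≤ c<v)) T>c)

        prod-O : ∀ {O} → All (SameSide c) O → prod sg (map proj₁ O) * prod sg (map proj₂ O) ≈ 1#
        prod-O []       = *-identityˡ 1#
        prod-O {(p , v) ∷ O} (q ∷ qs) = trans
          (solve 4 (λ a b x y → (a :* x) :* (b :* y) := (a :* b) :* (x :* y)) refl _ _ _ _)
          (trans (*-cong (pair q) (prod-O qs)) (*-identityˡ 1#))
          where
            pair : SameSide c (p , v) → sg p * sg v ≈ 1#
            pair (inj₁ (p<c , v<c)) = trans (*-cong (sg-below p<c) (sg-below v<c)) minus-one-square
            pair (inj₂ (c<p , c<v)) = trans (*-cong (sg-above (<⇒≤ c<p)) (sg-above (<⇒≤ c<v))) (*-identityˡ 1#)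

        -- Rows in `H` contribute -1 each, columns in `T` lie above `c`, and each pair of `O`
        -- contributes two equal signs.
        prod-GW : prod sg G * prod sg W ≈ sign (length H)
        prod-GW = begin
          prod sg G * prod sg W ≈⟨ *-cong (prod-++ sg H P) (prod-++ sg T Q) ⟩
          (prod sg H * prod sg P) * (prod sg T * prod sg Q)
            ≈⟨ solve 4 (λ a b x y → (a :* x) :* (b :* y) := (a :* b) :* (x :* y)) refl _ _ _ _ ⟩
          (prod sg H * prod sg T) * (prod sg P * prod sg Q) ≈⟨ *-cong (*-cong (prod-H H<c) prod-T) (prod-O O-sides) ⟩
          (sign (length H) * 1#) * 1# ≈⟨ trans (*-identityʳ _) (*-identityʳ _) ⟩
          sign (length H) ∎

        prod-c∷ : ∀ xs → prod sg (c ∷ xs) ≈ prod sg xs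
        prod-c∷ xs = trans (*-congʳ (sg-above ≤-refl)) (*-identityˡ _)

        prod-T++c∷Q : prod sg (T ++ c ∷ Q) ≈ prod sg W
        prod-T++c∷Q = trans (prod-++ sg T (c ∷ Q)) (trans (*-congˡ (prod-c∷ Q)) (sym (prod-++ sg T Q)))

        N-condensed : ∀ {g w} → g ∈ G → w ∈ W → N g w - N g c * N c w ≈ M g w
        N-condensed {g} {w} g∈ w∈ = begin
          N g w - N g c * N c w ≈⟨ +-cong (N-generic (G≢c g∈) (W≢c w∈)) (-‿cong (*-cong (N-col (G≢c g∈)) (N-row w))) ⟩
          (M g w - M g c * M c w) - (- M g c) * M c w
            ≈⟨ solve 3 (λ x y z → (x :- y :* z) :- (:- y) :* z := x) refl _ _ _ ⟩
          M g w ∎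

        -- The suffix gives the values of `e` and `s` in `Det-pivot`. Here `c` is absent before and
        -- appears on both sides after; condensing `N` at its unit corner undoes the pivot. The sign
        -- of moving column `c` past `T` cancels the sign of the rows `H`.
        step-ff : length H ≡ length T → Det M G W ≈ Det M' (c ∷ G) (T ++ c ∷ Q)
        step-ff len = sym (begin
          Det M' (c ∷ G) (T ++ c ∷ Q)
            ≈⟨ unsign (c ∷ G) (T ++ c ∷ Q) (trans (*-cong (prod-c∷ G) prod-T++c∷Q) prod-GW) ⟩
          sign (length H) * Det N (c ∷ G) (T ++ c ∷ Q) ≈⟨ *-congˡ (Det-col-to-front N (c ∷ G) T c Q) ⟩
          sign (length H) * (sign (length T) * Det N (c ∷ G) (c ∷ W)) ≡⟨ ≡.cong
              (λ n → sign (length H) * (sign n * Det N (c ∷ G) (c ∷ W))) (≡.sym len) ⟩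
          sign (length H) * (sign (length H) * Det N (c ∷ G) (c ∷ W)) ≈⟨ cancel-sign (length H) _ ⟩
          Det N (c ∷ G) (c ∷ W) ≈⟨ Det-condense N c c N-corner G W ⟩
          Det (λ g w → N g w - N g c * N c w) G W ≈⟨ Det-cong _ M G W N-condensed ⟩
          Det M G W ∎)

        -- Here it is `M` itself that is condensed at `c`. Moving row `c` past `H` costs precisely
        -- the sign by which minors of `N` and `M'` differ.
        step-tt : Det M (H ++ c ∷ P) (c ∷ W) ≈ Det M' G W
        step-tt = begin
          Det M (H ++ c ∷ P) (c ∷ W) ≈⟨ Det-row-to-front M H c P (c ∷ W) ⟩
          sign (length H) * Det M (c ∷ G) (c ∷ W) ≈⟨ *-congˡ (Det-condense M c c (proj₂ M-upper c) G W) ⟩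
          sign (length H) * Det (λ g w → M g w - M g c * M c w) G W
            ≈⟨ *-congˡ (Det-cong N _ G W (λ g∈ w∈ → N-generic (G≢c g∈) (W≢c w∈))) ⟨
          sign (length H) * Det N G W ≈⟨ unsign G W prod-GW ⟨
          Det M' G W ∎

        -- Row `c` stays a row and merely moves to the front; subtracting multiples of it from the
        -- other rows turns `M` into `N`.
        step-ft : Det M (H ++ c ∷ P) W ≈ Det M' (c ∷ G) W
        step-ft = begin
          Det M (H ++ c ∷ P) W ≈⟨ Det-row-to-front M H c P W ⟩
          sign (length H) * ι (M c) (Det M G) W
            ≈⟨ *-congˡ (Det-row-op M (λ g w → M g w - M g c * M c w) (M c) (λ g → - M g c) G
                (λ _ w → +-congˡ (-‿distribˡ-* _ _)) W) ⟨
          sign (length H) * ι (M c) (Det (λ g w → M g w - M g c * M c w) G) W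
            ≈⟨ *-congˡ (Det-cong-first N _ (N c) (M c) G W (λ {w} _ → N-row w) (λ g∈ w∈ → N-generic (G≢c g∈) (W≢c w∈))) ⟨
          sign (length H) * Det N (c ∷ G) W ≈⟨ unsign (c ∷ G) W (trans (*-congʳ (prod-c∷ G)) prod-GW) ⟨
          Det M' (c ∷ G) W ∎

        -- Column `c` stays a column, and column operations turn `M` into `N` except that column `c`
        -- itself is negated. That sign is compensated by the one row by which `H` exceeds `T`.
        step-tf : length H ≡ suc (length T) → Det M G (c ∷ W) ≈ Det M' G (T ++ c ∷ Q)
        step-tf len = sym (begin
          Det M' G (T ++ c ∷ Q) ≈⟨ unsign G (T ++ c ∷ Q) (trans (*-congˡ prod-T++c∷Q) prod-GW) ⟩
          sign (length H) * Det N G (T ++ c ∷ Q) ≈⟨ *-congˡ (Det-col-to-front N G T c Q) ⟩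
          sign (length H) * (sign (length T) * Det N G (c ∷ W)) ≡⟨ ≡.cong
              (λ n → sign n * (sign (length T) * Det N G (c ∷ W))) len ⟩
          (- sign (length T)) * (sign (length T) * Det N G (c ∷ W))
            ≈⟨ trans (sym (-‿distribˡ-* _ _)) (-‿cong (cancel-sign (length T) _)) ⟩
          - Det N G (c ∷ W) ≈⟨ -‿cong (Det-cong N _ G (c ∷ W) N≈) ⟩
          - Det (λ g w → 1# * (M g w - M g c * t w) * flip w) G (c ∷ W)
            ≈⟨ -‿cong (Det-scale (λ g w → M g w - M g c * t w) (λ _ → 1#) flip G (c ∷ W)) ⟩
          - (prod (λ _ → 1#) G * (prod flip (c ∷ W) * Det (λ g w → M g w - M g c * t w) G (c ∷ W)))
            ≈⟨ -‿cong (trans (*-cong (prod-one (λ _ → 1#) G (All.universal (λ _ → refl) G))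
                (*-cong prod-flip (Det-col-op M c t t-c G W))) (*-identityˡ _)) ⟩
          - (- 1# * Det M G (c ∷ W)) ≈⟨ trans (-‿cong (-1*x≈-x _)) (-‿involutive _) ⟩
          Det M G (c ∷ W) ∎)
          where
            -- `t` is row `c` with its entry at `c` replaced by 0, so that the column operation
            -- leaves column `c` alone; `flip` then negates that column.
            t flip : ℕ → Carrier
            t w with w ℕ.≟ c
            ... | yes _ = 0#
            ... | no _  = M c w
            flip w with w ℕ.≟ c
            ... | yes _ = - 1#
            ... | no _  = 1#
            t-c : t c ≈ 0#
            t-c with c ℕ.≟ c
            ... | yes _ = refl
            ... | no ¬q = contradiction ≡.refl ¬q
            prod-flip : prod flip (c ∷ W) ≈ - 1#
            prod-flip with c ℕ.≟ c
            ... | no ¬q = contradiction ≡.refl ¬q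
            ... | yes _ = trans (*-congˡ (prod-one flip W (All.tabulate one))) (*-identityʳ _)
              where
                one : ∀ {w} → w ∈ W → flip w ≈ 1#
                one {w} w∈ with w ℕ.≟ c
                ... | yes e = contradiction e (W≢c w∈)
                ... | no _  = refl
            N≈ : ∀ {g w} → g ∈ G → w ∈ c ∷ W → N g w ≈ 1# * (M g w - M g c * t w) * flip w
            N≈ {g} {w} g∈ w∈ with w ℕ.≟ c
            ... | yes ≡.refl = trans (N-col (G≢c g∈)) (sym (begin
              1# * (M g c - M g c * 0#) * - 1# ≈⟨ solve 3 (λ o x z → o :* (x :- x :* z) :* (:- o) :=
                  :- (o :* (o :* (x :- x :* z)))) refl _ _ _ ⟩
              - (1# * (1# * (M g c - M g c * 0#))) ≈⟨ -‿cong (trans (*-identityˡ _) (*-identityˡ _)) ⟩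
              - (M g c - M g c * 0#) ≈⟨ -‿cong (trans (+-congˡ (trans (-‿cong (zeroʳ _)) -0#≈0#)) (+-identityʳ _)) ⟩
              - M g c ∎))
            ... | no w≢c = trans (N-generic (G≢c g∈) w≢c) (sym (trans (*-identityʳ _) (*-identityˡ _)))

      -- Exchanging the pivot c: rows and columns labelled c trade places.
      Det-pivot : ∀ e s → length (H ++ opt s c) ≡ length (opt e c ++ T)
                → Det M ((H ++ opt s c) ++ P) ((opt e c ++ T) ++ Q)
                ≈ Det M' ((opt (not e) c ++ H) ++ P) ((T ++ opt (not s) c) ++ Q)
      Det-pivot false false len rewrite ++-identityʳ H | ++-assoc T (c ∷ []) Q = step-ff len
      Det-pivot true  true  len rewrite ++-identityʳ T | ++-assoc H (c ∷ []) P = step-tt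
      Det-pivot false true  len rewrite ++-identityʳ T | ++-assoc H (c ∷ []) P = step-ft
      Det-pivot true  false len rewrite ++-identityʳ H | ++-assoc T (c ∷ []) Q = step-tf len

    -- When no piece crosses the diagonal, the minor is block triangular around `c`. The pair
    -- `(c , c)` can therefore be inserted for free, and the pivot with empty `H` and `T` removes it
    -- again.
    DetPairs-pivot-split : (below above : List (ℕ × ℕ)) → All (λ (p , v) → p < c × v < c) below → All
        (λ (p , v) → c < p × c < v) above
                         → DetPairs M (below ++ above) ≈ DetPairs (pivot c M) (below ++ above)
    DetPairs-pivot-split below above b< a> = begin
      DetPairs M (below ++ above)
        ≡⟨ ≡.cong₂ (Det M) (map-++ proj₁ below above) (map-++ proj₂ below above) ⟩
      Det M (map proj₁ below ++ map proj₁ above) (map proj₂ below ++ map proj₂ above)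
        ≈⟨ Det-trim M (map proj₁ below) (map proj₁ above) c (map proj₂ below) (map proj₂ above) c
             (≤-reflexive (≡.trans (length-map proj₁ below) (≡.sym (length-map proj₂ below)))) (proj₂ M-upper c)
             (λ x∈ → lower (All.lookup rows> x∈))
             (λ { (here ≡.refl) y∈ → lower (All.lookup cols< y∈) ; (there x∈) y∈ → lower (<-trans (All.lookup cols< y∈) (All.lookup rows> x∈)) }) ⟨
      Det M (map proj₁ below ++ c ∷ map proj₁ above) (map proj₂ below ++ c ∷ map proj₂ above)
        ≡⟨ ≡.cong₂ (Det M) (map-++ proj₁ below ((c , c) ∷ above)) (map-++ proj₂ below ((c , c) ∷ above)) ⟨
      DetPairs M (below ++ (c , c) ∷ above) ≈⟨ DetPairs-↭ M (PermP.shift (c , c) below above) ⟩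
      DetPairs M ((c , c) ∷ below ++ above)
        ≈⟨ Det-pivot [] [] (below ++ above) [] [] (AllP.++⁺ (All.map inj₁ b<) (All.map inj₂ a>)) true true ≡.refl ⟩
      DetPairs (pivot c M) (below ++ above) ∎
      where
        rows> : All (c <_) (map proj₁ above)
        rows> = AllP.map⁺ (All.map proj₁ a>)
        cols< : All (_< c) (map proj₂ below)
        cols< = AllP.map⁺ (All.map proj₂ b<)

-- Ribbon determinants

-- For the strip of contents `p` to `e`, these are the contents at which a new column begins, that
-- is, the bottoms of all its columns but the leftmost. A cut `c` records that content `c - 1` goes
-- right.
cuts : (ℕ → Bool) → ℕ → ℕ → List ℕ
cuts d p zero    = []
cuts d p (suc e) with p ≤? e | d e
... | yes _ | false = cuts d p e ++ suc e ∷ []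
... | _     | _     = cuts d p e

cuts-empty : ∀ d {p} e → e ≤ p → cuts d p e ≡ []
cuts-empty d {p} zero    e≤p = ≡.refl
cuts-empty d {p} (suc e) e<p with p ≤? e | d e
... | yes p≤e | _     = contradiction e<p (≤⇒≯ p≤e)
... | no _    | true  = cuts-empty d e (<⇒≤ e<p)
... | no _    | false = cuts-empty d e (<⇒≤ e<p)

cuts-≤ : ∀ d p e → All (_≤ e) (cuts d p e)
cuts-≤ d p zero    = []
cuts-≤ d p (suc e) with p ≤? e | d e
... | yes _ | false = AllP.++⁺ (All.map m≤n⇒m≤1+n (cuts-≤ d p e)) (≤-refl ∷ [])
... | yes _ | true  = All.map m≤n⇒m≤1+n (cuts-≤ d p e)
... | no _  | true  = All.map m≤n⇒m≤1+n (cuts-≤ d p e)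
... | no _  | false = All.map m≤n⇒m≤1+n (cuts-≤ d p e)

cuts-sorted : ∀ d p e → AllPairs _<_ (cuts d p e)
cuts-sorted d p zero    = []
cuts-sorted d p (suc e) with p ≤? e | d e
... | yes _ | false = AllPairsP.++⁺ (cuts-sorted d p e) ([] ∷ []) (All.map (λ x≤e → s≤s x≤e ∷ []) (cuts-≤ d p e))
... | yes _ | true  = cuts-sorted d p e
... | no _  | true  = cuts-sorted d p e
... | no _  | false = cuts-sorted d p e

module RibbonMatrix {c ℓ} (R : CommutativeRing c ℓ) where
  open CommutativeRing R hiding (zero)
  open RingSolver R
  open Determinant R
  open Pivot R
  open Algebra.Properties.Ring ring
  open Relation.Binary.Reasoning.Setoid setoid

  -- The alternating sum over all subsets of the cuts of the products of `X` along the chosen cuts;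
  -- the full subset has sign plus.
  ribbon : (ℕ → ℕ → Carrier) → ℕ → List ℕ → ℕ → Carrier
  ribbon X p []       v = X p v
  ribbon X p (c ∷ cs) v = X p c * ribbon X c cs v - ribbon X p cs v

  -- The recursion at the other end of the strip. It is the form that `pivot` reproduces when the
  -- strip acquires its next cut.
  ribbon-snoc : ∀ X p cs c v → ribbon X p (cs ++ c ∷ []) v ≈ ribbon X p cs c * X c v - ribbon X p cs v
  ribbon-snoc X p []       c v = refl
  ribbon-snoc X p (b ∷ cs) c v = trans (+-cong (*-congˡ (ribbon-snoc X b cs c v)) (-‿cong (ribbon-snoc X p cs c v)))
    (solve 6 (λ x r y s t u → x :* (r :* y :- s) :- (t :* y :- u) := (x :* r :- t) :* y :- (x :* s :- u)) refl _ _ _ _ _ _)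

  -- The cuts increase, so by triangularity the leading column `c` has only the entries `X p c` and,
  -- in row `c`, 1. Taking row `p` there leaves the strip from `c`; otherwise row and column `c`
  -- drop out and the two columns at the cut `c` merge.
  Det-ribbon : ∀ {X} → UpperUnitriangular X → ∀ p cs v → AllPairs _<_ cs
             → Det X (p ∷ cs) (cs ++ v ∷ []) ≈ ribbon X p cs v
  Det-ribbon {X} upper p []       v [] = trans (+-cong (*-identityʳ _) -0#≈0#) (+-identityʳ _)
  Det-ribbon {X} upper p (c ∷ cs) v (c< ∷ sorted) =
    +-cong (*-congˡ (Det-ribbon upper c cs v sorted))
      (-‿cong (trans (ι-cong (Det-unit-col X c cs c (proj₂ upper c) (λ a∈ → proj₁ upper (All.lookup c< a∈))) (cs ++ v ∷ []))
                     (Det-ribbon upper p cs v sorted)))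

  stage : (ℕ → ℕ → Carrier) → (ℕ → Bool) → ℕ → ℕ → ℕ → Carrier
  stage X d zero    = X
  stage X d (suc s) = if d s then stage X d s else pivot (suc s) (stage X d s)

  stage-up : ∀ X d s → d s ≡ true → stage X d (suc s) ≡ stage X d s
  stage-up X d s e rewrite e = ≡.refl

  stage-right : ∀ X d s → d s ≡ false → stage X d (suc s) ≡ pivot (suc s) (stage X d s)
  stage-right X d s e rewrite e = ≡.refl

  stage-unitriangular : ∀ {X} d → UpperUnitriangular X → ∀ s → UpperUnitriangular (stage X d s)
  stage-unitriangular d upper zero    = upper
  stage-unitriangular d upper (suc s) with d s
  ... | true  = stage-unitriangular d upper s
  ... | false = pivot-unitriangular (suc s) (stage-unitriangular d upper s)

  private
    -- For a column label beyond `s` the entry belongs to the strip that obeys the directions below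
    -- content `s` and from there on goes straight up to content `v - 1`.
    stage-before : ∀ X d s {p v} → p < v → s < v → stage X d s p v ≈ ribbon X p (cuts d p s) v
    stage-before X d zero    p<v s<v = refl
    stage-before X d (suc s) {p} {v} p<v s<v with p ≤? s | d s
    ... | yes _   | true  = stage-before X d s p<v (<⇒≤ s<v)
    ... | no _    | true  = stage-before X d s p<v (<⇒≤ s<v)
    ... | no p≰s  | false = trans (pivot-above {suc s} {stage X d s} (≰⇒> p≰s)) (stage-before X d s p<v (<⇒≤ s<v))
    ... | yes p≤s | false = begin
      pivot (suc s) (stage X d s) p v ≈⟨ pivot-between {suc s} {stage X d s} (s≤s p≤s) s<v ⟩
      stage X d s p (suc s) * stage X d s (suc s) v - stage X d s p v
        ≈⟨ +-cong (*-cong (stage-before X d s (s≤s p≤s) ≤-refl)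
                          -- Row `s + 1` is still the original one, since a strip starting at
                          -- `s + 1` has no cut up to `s`.
                          (trans (stage-before X d s s<v (<⇒≤ s<v))
                                 (reflexive (≡.cong (λ cs → ribbon X (suc s) cs v) (cuts-empty d s (n≤1+n s))))))
                  (-‿cong (stage-before X d s p<v (<⇒≤ s<v))) ⟩
      ribbon X p (cuts d p s) (suc s) * X (suc s) v - ribbon X p (cuts d p s) v ≈⟨ ribbon-snoc X p (cuts d p s) (suc s) v ⟨
      ribbon X p (cuts d p s ++ suc s ∷ []) v ∎

    -- A pivot at `c` alters only columns after `c`, and all pivots from stage `e` on take place at
    -- `e + 1` or later.
    stage-after : ∀ X d k e {p} → stage X d (k ℕ.+ e) p (suc e) ≈ stage X d e p (suc e)
    stage-after X d zero    e = refl
    stage-after X d (suc k) e {p} with d (k ℕ.+ e)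
    ... | true  = stage-after X d k e
    ... | false = trans (pivot-below {suc (k ℕ.+ e)} {stage X d (k ℕ.+ e)} (s≤s (ℕP.m≤n+m e k))) (stage-after X d k e)

  stage-ribbon : ∀ X d {s p e} → p ≤ e → e ≤ s → stage X d s p (suc e) ≈ ribbon X p (cuts d p e) (suc e)
  stage-ribbon X d {s} {p} {e} p≤e e≤s = begin
    stage X d s p (suc e) ≡⟨ ≡.cong (λ s → stage X d s p (suc e)) (m∸n+n≡m e≤s) ⟨
    stage X d (s ℕ.∸ e ℕ.+ e) p (suc e) ≈⟨ stage-after X d (s ℕ.∸ e) e ⟩
    stage X d e p (suc e) ≈⟨ stage-before X d e (s≤s p≤e) ≤-refl ⟩
    ribbon X p (cuts d p e) (suc e) ∎

open ≡ using (refl; sym; trans; cong; cong₂; subst)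
open import Data.Nat using (_+_)
open import Data.Integer using (+_; _-_)

-- Strips of the cutting strip

maxL-≡ : ∀ {x} l → x ∈ l → (∀ {y} → y ∈ l → y ≤ x) → maxL l ≡ x
maxL-≡ {x} l x∈l l≤x = ≤-antisym (bound l l≤x) (above l x∈l)
  where
    bound : ∀ l → (∀ {y} → y ∈ l → y ≤ x) → maxL l ≤ x
    bound []      _   = z≤n
    bound (y ∷ l) l≤x = ℕP.⊔-lub (l≤x (here refl)) (bound l (l≤x ∘ there))
    above : ∀ l → x ∈ l → x ≤ maxL l
    above (y ∷ l) (here refl) = ℕP.m≤m⊔n y (maxL l)
    above (y ∷ l) (there x∈)  = ≤-trans (above l x∈) (ℕP.m≤n⊔m y (maxL l))

minL-≡ : ∀ {x} l → x ∈ l → (∀ {y} → y ∈ l → x ≤ y) → minL l ≡ x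
minL-≡ {x} (z ∷ l) x∈l x≤l = ≤-antisym (below x∈l) (bound z l x≤l)
  where
    bound : ∀ z l → (∀ {y} → y ∈ z ∷ l → x ≤ y) → x ≤ minL (z ∷ l)
    bound z []      x≤ = x≤ (here refl)
    bound z (y ∷ l) x≤ = ℕP.⊓-glb (x≤ (there (here refl)))
      (bound z l (λ { (here refl) → x≤ (here refl) ; (there y∈) → x≤ (there (there y∈)) }))
    below-seed : ∀ z l → minL (z ∷ l) ≤ z
    below-seed z []      = ≤-refl
    below-seed z (y ∷ l) = ≤-trans (ℕP.m⊓n≤n y _) (below-seed z l)
    below-rest : ∀ z l → x ∈ l → minL (z ∷ l) ≤ x
    below-rest z (y ∷ l) (here refl) = ℕP.m⊓n≤m y _
    below-rest z (y ∷ l) (there x∈)  = ≤-trans (ℕP.m⊓n≤n y _) (below-rest z l x∈)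
    below : x ∈ z ∷ l → minL (z ∷ l) ≤ x
    below (here refl) = below-seed z l
    below (there x∈)  = below-rest z l x∈

monotone : (f : ℕ → ℕ) → (∀ t → f t ≤ f (suc t)) → ∀ {s t} → s ≤ t → f s ≤ f t
monotone f f≤ {s} s≤t = go (ℕP.≤⇒≤′ s≤t)
  where
    go : ∀ {t} → s ℕ.≤′ t → f s ≤ f t
    go ℕ.≤′-refl       = ≤-refl
    go (ℕ.≤′-step s≤t) = ≤-trans (go s≤t) (f≤ _)

tabulate-toℕ : ∀ {a} {A : Set a} n (g : ℕ → A) → tabulate {n = n} (g ∘ toℕ) ≡ applyUpTo g n
tabulate-toℕ zero    g = refl
tabulate-toℕ (suc n) g = cong (g 0 ∷_) (tabulate-toℕ n (g ∘ suc))

module Strip (d : ℤ → Bool) (p : ℤ) where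
  ups rights : ℕ → ℕ
  ups = upsFrom d p
  rights t = t ∸ ups t

  ups≤ : ∀ t → ups t ≤ t
  ups≤ zero    = z≤n
  ups≤ (suc t) with d (p ℤ.+ + t)
  ... | true  = subst (_≤ suc t) (ℕP.+-comm 1 (ups t)) (s≤s (ups≤ t))
  ... | false = subst (_≤ suc t) (sym (ℕP.+-identityʳ (ups t))) (m≤n⇒m≤1+n (ups≤ t))

  rights-up : ∀ t → d (p ℤ.+ + t) ≡ true → rights (suc t) ≡ rights t
  rights-up t e rewrite e | ℕP.+-comm (ups t) 1 = refl

  rights-right : ∀ t → d (p ℤ.+ + t) ≡ false → rights (suc t) ≡ suc (rights t)
  rights-right t e rewrite e | ℕP.+-identityʳ (ups t) = ℕP.+-∸-assoc 1 (ups≤ t)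

  rights-step : ∀ t → rights t ≤ rights (suc t)
  rights-step t with d (p ℤ.+ + t) in e
  ... | true  = ≤-reflexive (sym (trans (cong (λ b → suc t ∸ (ups t ℕ.+ (if b then 1 else 0))) (sym e)) (rights-up t e)))
  ... | false = ≤-trans (n≤1+n _) (≤-reflexive (sym (trans (cong (λ b → suc t ∸ (ups t ℕ.+ (if b then 1 else 0))) (sym e)) (rights-right t e))))

  ups-mono : ∀ {s t} → s ≤ t → ups s ≤ ups t
  ups-mono = monotone ups (λ t → m≤m+n (ups t) _)

  rights-mono : ∀ {s t} → s ≤ t → rights s ≤ rights t
  rights-mono = monotone rights rights-step

  rights+ups : ∀ t → rights t ℕ.+ ups t ≡ t
  rights+ups t = m∸n+n≡m (ups≤ t)

  module _ (m : ℕ) where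
    cells = stripCells d p (suc m)
    κc νc : ℕ → ℕ
    κc = conjOuter cells
    νc = conjInner cells

    cellAt : ℕ → Cell
    cellAt t = suc (ups m ∸ ups t) , suc (rights t)

    private
      row∈ : ∀ {t i} → t ≤ m → rights t ≡ i → suc (ups m ∸ ups t) ∈ rowsInCol cells (suc i)
      row∈ {t} {i} t≤m e = ∈-map⁺ row (∈-filter⁺ (λ x → col x ℕ.≟ suc i) (∈-map⁺ cellAt (∈-upTo⁺ (s≤s t≤m))) (cong suc e))

      row∈⁻ : ∀ {y i} → y ∈ rowsInCol cells (suc i) → Σ ℕ λ t → t ≤ m × rights t ≡ i × y ≡ suc (ups m ∸ ups t)
      row∈⁻ {y} {i} y∈ with ∈-map⁻ row y∈
      ... | x , x∈ , refl with ∈-filter⁻ (λ x → col x ℕ.≟ suc i) {xs = cells} x∈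
      ... | x∈cells , col≡ with ∈-map⁻ cellAt {xs = upTo (suc m)} x∈cells
      ... | t , t∈ , refl = t , ≤-pred (∈-upTo⁻ t∈) , suc-injective col≡ , refl

    -- Rows do not increase in number along the strip, so the earliest position within a column is
    -- its bottom cell; dually, the latest one is its top.
    κc-≡ : ∀ {t i} → t ≤ m → rights t ≡ i → (∀ s → rights s ≡ i → t ≤ s) → κc (suc i) ≡ suc (ups m ∸ ups t)
    κc-≡ {t} {i} t≤m e first = maxL-≡ _ (row∈ t≤m e) λ y∈ → bound (row∈⁻ {i = i} y∈)
      where
        bound : ∀ {y} → Σ ℕ (λ s → s ≤ m × rights s ≡ i × y ≡ suc (ups m ∸ ups s)) → y ≤ suc (ups m ∸ ups t)
        bound (s , _ , e' , refl) = s≤s (ℕP.∸-monoʳ-≤ (ups m) (ups-mono (first s e')))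

    νc-≡ : ∀ {t i} → t ≤ m → rights t ≡ i → (∀ s → s ≤ m → rights s ≡ i → s ≤ t) → νc (suc i) ≡ ups m ∸ ups t
    νc-≡ {t} {i} t≤m e last = cong (_∸ 1) (minL-≡ _ (row∈ t≤m e) λ y∈ → bound (row∈⁻ {i = i} y∈))
      where
        bound : ∀ {y} → Σ ℕ (λ s → s ≤ m × rights s ≡ i × y ≡ suc (ups m ∸ ups s)) → suc (ups m ∸ ups t) ≤ y
        bound (s , s≤m , e' , refl) = s≤s (ℕP.∸-monoʳ-≤ (ups m) (ups-mono (last s s≤m e')))

    private
      rearrange : ∀ a k u q → (+ 1 ℤ.+ a) - (+ 1 ℤ.+ k) ℤ.+ q - + 1 ℤ.+ (+ 1 ℤ.+ (k ℤ.+ u)) ≡ q ℤ.+ (a ℤ.+ u)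
      rearrange = ℤ-Solver.solve-∀

    -- The term `κc 1` of `content` cancels the row of the starting cell, so the parameter `p` is
    -- the content of that cell and contents grow by one per step.
    content-cellAt : ∀ {t i} → t ≤ m → rights t ≡ i → content κc p (suc (ups m ∸ ups t)) (suc i) ≡ p ℤ.+ + t
    content-cellAt {t} {i} t≤m refl = begin
      content κc p (suc k) (suc (rights t))
        ≡⟨ cong (λ n → + suc (rights t) - + suc k ℤ.+ p - + 1 ℤ.+ + n)
            (trans (κc-≡ z≤n refl (λ _ _ → z≤n)) (cong suc (sym (m∸n+n≡m (ups-mono t≤m))))) ⟩
      + suc (rights t) - + suc k ℤ.+ p - + 1 ℤ.+ + suc (k ℕ.+ ups t)
        ≡⟨ rearrange (+ rights t) (+ k) (+ ups t) p ⟩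
      p ℤ.+ + (rights t ℕ.+ ups t) ≡⟨ cong (λ n → p ℤ.+ + n) (rights+ups t) ⟩
      p ℤ.+ + t ∎
      where
        open ≡.≡-Reasoning
        k = ups m ∸ ups t

    bot top : ℕ → ℤ
    bot s = content κc p (κc s) s
    top s = content κc p (suc (νc s)) s

    bot-≡ : ∀ {t i} → t ≤ m → rights t ≡ i → (∀ s → rights s ≡ i → t ≤ s) → bot (suc i) ≡ p ℤ.+ + t
    bot-≡ {t} {i} t≤m e first = trans (cong (λ k → content κc p k (suc i)) (κc-≡ t≤m e first)) (content-cellAt t≤m e)

    top-≡ : ∀ {t i} → t ≤ m → rights t ≡ i → (∀ s → s ≤ m → rights s ≡ i → s ≤ t) → top (suc i) ≡ p ℤ.+ + t
    top-≡ {t} {i} t≤m e last = trans (cong (λ k → content κc p (suc k) (suc i)) (νc-≡ {t} {i} t≤m e last))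
        (content-cellAt t≤m e)

  relCuts : ℕ → List ℕ
  relCuts zero    = []
  relCuts (suc e) with d (p ℤ.+ + e)
  ... | true  = relCuts e
  ... | false = relCuts e ++ suc e ∷ []

  -- One step from a column to the next, described from both sides: `t` is the position of the
  -- bottom of the column numbered `i + 2` and `t - 1` that of the top of the column numbered
  -- `i + 1`. Rows and columns of the minor are both read off from it.
  CutAt : ℕ → ℕ → ℕ → Set
  CutAt e i t = Σ ℕ λ t' → t ≡ suc t' × suc t' ≤ e × rights t' ≡ i × rights (suc t') ≡ suc i

  relCuts-CutAt : ∀ e → Pointwise (CutAt e) (upTo (rights e)) (relCuts e)
  relCuts-CutAt zero = []
  relCuts-CutAt (suc e) with d (p ℤ.+ + e) in eq
  ... | true  = subst (λ n → Pointwise (CutAt (suc e)) (upTo n) (relCuts e)) (sym rights≡) weakened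
    where
      rights≡ = trans (cong (λ b → suc e ∸ (ups e ℕ.+ (if b then 1 else 0))) (sym eq)) (rights-up e eq)
      weakened = Pointwise.map (λ (t' , q , t'<e , r) → t' , q , m≤n⇒m≤1+n t'<e , r) (relCuts-CutAt e)
  ... | false = subst (λ l → Pointwise (CutAt (suc e)) l (relCuts e ++ suc e ∷ []))
      (trans (ListP.applyUpTo-∷ʳ (λ i → i) (rights e)) (cong upTo (sym rights≡)))
      (Pointwise.++⁺ weakened ((e , refl , ≤-refl , refl , rights-right e eq) ∷ []))
    where
      rights≡ = trans (cong (λ b → suc e ∸ (ups e ℕ.+ (if b then 1 else 0))) (sym eq)) (rights-right e eq)
      weakened = Pointwise.map (λ (t' , q , t'<e , r) → t' , q , m≤n⇒m≤1+n t'<e , r) (relCuts-CutAt e)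

  private
    pointwise-map : ∀ {A : Set} {R : ℕ → ℕ → Set} (f : ℕ → A) (g : ℕ → A) → (∀ {i t} → R i t → f i ≡ g t)
                  → ∀ {is ts} → Pointwise R is ts → map f is ≡ map g ts
    pointwise-map f g fg []       = refl
    pointwise-map f g fg (r ∷ rs) = cong₂ _∷_ (fg r) (pointwise-map f g fg rs)

  module _ (m : ℕ) where
    bots-≡ : tabulate {n = suc (rights m)} (λ i → bot m (suc (toℕ i))) ≡ map (λ t → p ℤ.+ + t) (0 ∷ relCuts m)
    bots-≡ = cong₂ _∷_ (bot-≡ m z≤n refl (λ _ _ → z≤n))
      (trans (tabulate-toℕ (rights m) (λ i → bot m (suc (suc i))))
        (trans (sym (map-upTo (λ i → bot m (suc (suc i))) (rights m)))
          (pointwise-map (λ i → bot m (suc (suc i))) (λ t → p ℤ.+ + t) cut (relCuts-CutAt m))))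
      where
        cut : ∀ {i t} → CutAt m i t → bot m (suc (suc i)) ≡ p ℤ.+ + t
        cut {i} (t' , refl , t≤m , e , e') = bot-≡ m t≤m e' λ s es → ≮⇒≥ λ s<t →
          <⇒≱ (≤-reflexive (sym es)) (≤-trans (rights-mono (≤-pred s<t)) (≤-reflexive e))

    -- The top of a column is followed immediately by the bottom of the next, so the tops plus one
    -- are again the cuts, closed off by the end `suc m` of the strip.
    tops-≡ : tabulate {n = suc (rights m)} (λ i → top m (suc (toℕ i))) ≡ map (λ t → p ℤ.+ + t - + 1)
        (relCuts m ++ suc m ∷ [])
    tops-≡ = begin
      tabulate {n = suc (rights m)} (λ i → top m (suc (toℕ i))) ≡⟨ tabulate-toℕ (suc (rights m)) (λ i → top m (suc i)) ⟩
      applyUpTo (λ i → top m (suc i)) (suc (rights m)) ≡⟨ ListP.applyUpTo-∷ʳ (λ i → top m (suc i)) (rights m) ⟨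
      applyUpTo (λ i → top m (suc i)) (rights m) ++ top m (suc (rights m)) ∷ []
        ≡⟨ cong₂ (λ l x → l ++ x ∷ []) (trans (sym (map-upTo (λ i → top m (suc i)) (rights m)))
             (pointwise-map (λ i → top m (suc i)) (λ t → p ℤ.+ + t - + 1) cut (relCuts-CutAt m)))
             (trans (top-≡ m ≤-refl refl (λ s s≤m _ → s≤m)) (shift m)) ⟩
      map (λ t → p ℤ.+ + t - + 1) (relCuts m) ++ (p ℤ.+ + suc m - + 1) ∷ []
        ≡⟨ map-++ (λ t → p ℤ.+ + t - + 1) (relCuts m) (suc m ∷ []) ⟨
      map (λ t → p ℤ.+ + t - + 1) (relCuts m ++ suc m ∷ []) ∎
      where
        open ≡.≡-Reasoning
        shift' : ∀ q t → q ℤ.+ t ≡ q ℤ.+ (+ 1 ℤ.+ t) - + 1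
        shift' = ℤ-Solver.solve-∀
        shift : ∀ t → p ℤ.+ + t ≡ p ℤ.+ + suc t - + 1
        shift t = shift' p (+ t)
        cut : ∀ {i t} → CutAt m i t → top m (suc i) ≡ p ℤ.+ + t - + 1
        cut {i} (t' , refl , t≤m , e , e') = trans (top-≡ m (<⇒≤ t≤m) e λ s _ es → ≮⇒≥ λ t<s →
          <⇒≱ (≤-reflexive (cong suc es)) (≤-trans (≤-reflexive (sym e')) (rights-mono t<s))) (shift t')

relCuts-cuts : ∀ (d : ℤ → Bool) base p₀ m
             → cuts (λ s → d (base ℤ.+ + s)) p₀ (p₀ ℕ.+ m) ≡ map (p₀ ℕ.+_) (Strip.relCuts d (base ℤ.+ + p₀) m)
relCuts-cuts d base p₀ zero    = cuts-empty _ (p₀ ℕ.+ 0) (≤-reflexive (ℕP.+-identityʳ p₀))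
relCuts-cuts d base p₀ (suc m) = trans (cong (cuts d₀ p₀) (ℕP.+-suc p₀ m)) body
  where
    d₀ = λ s → d (base ℤ.+ + s)
    same : d₀ (p₀ ℕ.+ m) ≡ d (base ℤ.+ + p₀ ℤ.+ + m)
    same = cong d (sym (ℤP.+-assoc base (+ p₀) (+ m)))
    body : cuts d₀ p₀ (suc (p₀ ℕ.+ m)) ≡ map (p₀ ℕ.+_) (Strip.relCuts d (base ℤ.+ + p₀) (suc m))
    body with p₀ ≤? p₀ ℕ.+ m | d (base ℤ.+ + (p₀ ℕ.+ m)) | d (base ℤ.+ + p₀ ℤ.+ + m) | same
    ... | no ¬q | _     | _     | _    = contradiction (m≤m+n p₀ m) ¬q
    ... | yes _ | true  | .true | refl = relCuts-cuts d base p₀ m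
    ... | yes _ | false | .false | refl = trans (cong₂ (λ l x → l ++ x ∷ []) (relCuts-cuts d base p₀ m) (sym (ℕP.+-suc p₀ m)))
      (sym (map-++ (p₀ ℕ.+_) (Strip.relCuts d (base ℤ.+ + p₀) m) (suc m ∷ [])))

-- Flagged determinants as minors of one matrix

degree≡contents : ∀ ki i nj j r k → ki - i - nj ℤ.+ j ≡ (j - (+ 1 ℤ.+ nj) ℤ.+ r - + 1 ℤ.+ k) -
    (i - ki ℤ.+ r - + 1 ℤ.+ k) ℤ.+ + 1
degree≡contents = ℤ-Solver.solve-∀

module FlaggedMinors {c ℓ} (R : CommutativeRing c ℓ) (y z : ℤ → CommutativeRing.Carrier R) where
  open CommutativeRing R using (Carrier; _≈_; 0#; 1#; reflexive; setoid; *-identityˡ; +-identityʳ)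
    renaming (refl to ≈-refl; sym to ≈-sym; trans to ≈-trans)
  open RingDefs R
  open Determinant R
  open Pivot R
  open RibbonMatrix R

  -- The degree of an entry is the top content of its column minus the bottom content of its row,
  -- plus one. Together with the flags this removes every other trace of the shape from the entries.
  SS-contents : ∀ κc νc r n (a b : ℕ → ℤ) →
    let bot = λ s → content κc r (κc s) s ; top = λ s → content κc r (suc (νc s)) s in
    SS κc νc r n a b y z ≈ det n λ i j → let i' = suc (toℕ i) ; j' = suc (toℕ j) in
      eRel (top j' - bot i' ℤ.+ + 1) (seg y (a j') (b i')) (seg z (a j' ℤ.+ top j') (b i' ℤ.+ bot i'))
  SS-contents κc νc r n a b = det-cong n λ i j → let i' = suc (toℕ i) ; j' = suc (toℕ j) in
    reflexive (cong (λ k → eRel k (seg y (a j') (b i'))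
        (seg z (a j' ℤ.+ content κc r (suc (νc j')) j') (b i' ℤ.+ content κc r (κc i') i')))
      (degree≡contents (+ κc i') (+ i') (+ νc j') (+ j') r (+ κc 1)))

  module _ (A B : ℤ → ℤ) where
    -- The degree is a separate argument so that it can be evaluated while the flag segments stay as
    -- they are.
    flaggedAt : ℤ → ℤ → ℤ → Carrier
    flaggedAt k u t = eRel k (seg y (A t) (B u)) (seg z (A t ℤ.+ t) (B u ℤ.+ u))

    flagged : ℤ → ℤ → Carrier
    flagged u t = flaggedAt (t - u ℤ.+ + 1) u t

    module _ (base : ℤ) where
      -- Rows are indexed by bottom contents, columns by top contents plus one.
      flaggedMatrix : ℕ → ℕ → Carrier
      flaggedMatrix u v = flagged (base ℤ.+ + u) (base ℤ.+ + v - + 1)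

      private
        index : ∀ b u v → (b ℤ.+ v - + 1) - (b ℤ.+ u) ℤ.+ + 1 ≡ v - u
        index = ℤ-Solver.solve-∀

      -- With tops shifted by one the degree at `(u , v)` is `v - u`: it is negative below the
      -- diagonal, and on the diagonal the entry is the supersymmetric function of degree 0.
      flaggedMatrix-unitriangular : UpperUnitriangular flaggedMatrix
      flaggedMatrix-unitriangular = lower , diag
        where
          lower : ∀ {u v} → v < u → flaggedMatrix u v ≈ 0#
          lower {u} {v} v<u with trans (index base (+ u) (+ v)) (trans (ℤP.m-n≡m⊖n v u) (ℤP.⊖-< v<u)) | ℕP.m<n⇒0<n∸m v<u
          ... | e | pos with u ∸ v
          ... | suc k = reflexive (cong (λ k → flaggedAt k (base ℤ.+ + u) (base ℤ.+ + v - + 1)) e)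
          diag : ∀ u → flaggedMatrix u u ≈ 1#
          diag u = ≈-trans (reflexive (cong (λ k → flaggedAt k (base ℤ.+ + u) (base ℤ.+ + u - + 1))
              (trans (index base (+ u) (+ u)) (ℤP.+-inverseʳ (+ u)))))
            (≈-trans (+-identityʳ _) (≈-trans (*-identityˡ _) (*-identityˡ _)))

      SS-strip : ∀ (d : ℤ → Bool) p₀ m → let p = base ℤ.+ + p₀ in
        SS (Strip.κc d p m) (Strip.νc d p m) p (stripWidth d p (suc m)) (λ s → A (Strip.top d p m s))
            (λ s → B (Strip.bot d p m s)) y z
        ≈ ribbon flaggedMatrix p₀ (cuts (λ s → d (base ℤ.+ + s)) p₀ (p₀ ℕ.+ m)) (suc (p₀ ℕ.+ m))
      SS-strip d p₀ m = begin
        SS (κc m) (νc m) p K (λ s → A (top m s)) (λ s → B (bot m s)) y z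
          ≈⟨ SS-contents (κc m) (νc m) p K (λ s → A (top m s)) (λ s → B (bot m s)) ⟩
        det K (λ i j → flagged (bot m (suc (toℕ i))) (top m (suc (toℕ j))))
          ≈⟨ det≈Det K flagged (λ i → bot m (suc (toℕ i))) (λ j → top m (suc (toℕ j))) ⟩
        Det flagged (tabulate {n = K} (λ i → bot m (suc (toℕ i)))) (tabulate {n = K} (λ i → top m (suc (toℕ i))))
          ≡⟨ cong₂ (Det flagged) (trans (bots-≡ m) rows) (trans (tops-≡ m) cols) ⟩
        Det flagged (map (λ u → base ℤ.+ + u) (p₀ ∷ cs)) (map (λ v → base ℤ.+ + v - + 1) (cs ++ suc (p₀ ℕ.+ m) ∷ []))
          ≈⟨ Det-map flaggedMatrix flagged (λ u → base ℤ.+ + u) (λ v → base ℤ.+ + v - + 1) (p₀ ∷ cs)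
              (cs ++ suc (p₀ ℕ.+ m) ∷ []) (λ _ _ → ≈-refl) ⟨
        Det flaggedMatrix (p₀ ∷ cs) (cs ++ suc (p₀ ℕ.+ m) ∷ [])
          ≈⟨ Det-ribbon flaggedMatrix-unitriangular p₀ cs (suc (p₀ ℕ.+ m)) (cuts-sorted d₀ p₀ (p₀ ℕ.+ m)) ⟩
        ribbon flaggedMatrix p₀ cs (suc (p₀ ℕ.+ m)) ∎
        where
          open import Relation.Binary.Reasoning.Setoid setoid
          p = base ℤ.+ + p₀
          open Strip d p
          K = stripWidth d p (suc m)
          d₀ = λ s → d (base ℤ.+ + s)
          cs = cuts d₀ p₀ (p₀ ℕ.+ m)
          assoc : ∀ t → p ℤ.+ + t ≡ base ℤ.+ + (p₀ ℕ.+ t)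
          assoc t = ℤP.+-assoc base (+ p₀) (+ t)
          rows : map (λ t → p ℤ.+ + t) (0 ∷ relCuts m) ≡ map (λ u → base ℤ.+ + u) (p₀ ∷ cs)
          rows = cong₂ _∷_ (trans (assoc 0) (cong (λ n → base ℤ.+ + n) (ℕP.+-identityʳ p₀)))
            (trans (trans (ListP.map-cong assoc (relCuts m)) (map-∘ (relCuts m)))
                (cong (map (λ u → base ℤ.+ + u)) (sym (relCuts-cuts d base p₀ m))))
          cols : map (λ t → p ℤ.+ + t - + 1) (relCuts m ++ suc m ∷ []) ≡ map (λ v → base ℤ.+ + v - + 1)
              (cs ++ suc (p₀ ℕ.+ m) ∷ [])
          cols = trans (ListP.map-cong (λ t → cong (_- + 1) (assoc t)) (relCuts m ++ suc m ∷ []))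
            (trans (map-∘ (relCuts m ++ suc m ∷ []))
              (cong (map (λ v → base ℤ.+ + v - + 1))
                (trans (map-++ (p₀ ℕ.+_) (relCuts m) (suc m ∷ []))
                  (cong₂ (λ l x → l ++ x ∷ []) (sym (relCuts-cuts d base p₀ m)) (ℕP.+-suc p₀ m)))))

-- Boolean comparison of naturals

<ᵇ-true : ∀ m n → (m ℕ.<ᵇ n) ≡ true → m < n
<ᵇ-true m n e = ℕP.<ᵇ⇒< m n (subst T (sym e) tt)

<ᵇ-false : ∀ m n → (m ℕ.<ᵇ n) ≡ false → n ≤ m
<ᵇ-false m n e = ≮⇒≥ (λ m<n → subst T e (ℕP.<⇒<ᵇ m<n))

≡ᵇ-true : ∀ m n → (m ℕ.≡ᵇ n) ≡ true → m ≡ n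
≡ᵇ-true m n e = ℕP.≡ᵇ⇒≡ m n (subst T (sym e) tt)

≡ᵇ-false : ∀ m n → (m ℕ.≡ᵇ n) ≡ false → m ≢ n
≡ᵇ-false m n e m≡n = subst T e (ℕP.≡⇒≡ᵇ m n m≡n)

-- Partitions

at-anti : ∀ p → IsPartition p → ∀ {i j} → 1 ≤ i → i ≤ j → at p j ≤ at p i
at-anti p part {suc i} {j} _ i≤j = go (ℕP.≤⇒≤′ i≤j)
  where
    go : ∀ {j} → suc i ℕ.≤′ j → at p j ≤ at p (suc i)
    go ℕ.≤′-refl = ≤-refl
    go (ℕ.≤′-step {suc j} q) = ≤-trans (part j) (go q)
    go (ℕ.≤′-step {zero} q) = contradiction (ℕP.≤′⇒≤ q) λ ()

at-pos⇒≤length : ∀ p i → 1 ≤ at p i → i ≤ length p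
at-pos⇒≤length (x ∷ p) (suc zero)    _ = s≤s z≤n
at-pos⇒≤length (x ∷ p) (suc (suc i)) q = s≤s (at-pos⇒≤length p (suc i) q)

-- The parts decrease weakly, so those of size at least `j` form an initial segment, and counting
-- them locates its end.
≤at⇔≤conj : ∀ {p} → IsPartition p → ∀ {i j} → 1 ≤ i → 1 ≤ j
          → (j ≤ at p i → i ≤ conj p j) × (i ≤ conj p j → j ≤ at p i)
≤at⇔≤conj {[]}    part {suc i} {suc j} _ _ = (λ ()) , (λ ())
≤at⇔≤conj {x ∷ p} part {suc i} {j} 1≤i 1≤j with j ≤? x
... | yes j≤x rewrite filter-accept (j ≤?_) {x} {p} j≤x = to i , from i
  where
    to : ∀ i → j ≤ at (x ∷ p) (suc i) → suc i ≤ suc (conj p j)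
    to zero    _ = s≤s z≤n
    to (suc i) q = s≤s (proj₁ (≤at⇔≤conj {p} (part ∘ suc) (s≤s z≤n) 1≤j) q)
    from : ∀ i → suc i ≤ suc (conj p j) → j ≤ at (x ∷ p) (suc i)
    from zero    _       = j≤x
    from (suc i) (s≤s q) = proj₂ (≤at⇔≤conj {p} (part ∘ suc) (s≤s z≤n) 1≤j) q
... | no j≰x rewrite filter-reject (j ≤?_) {x} {p} j≰x = (λ q → contradiction (≤-trans q (at-anti (x ∷ p) part (s≤s z≤n) 1≤i)) j≰x)
             , (λ q → contradiction (≤-trans (proj₂ (≤at⇔≤conj {p} (part ∘ suc) ≤-refl 1≤j) (≤-trans 1≤i q)) (part 0)) j≰x)

rectangle : ∀ κ ν → IsPartition κ → IsPartition ν → ∀ {i j i' j' k l} → InSkew κ ν (i , j) → InSkew κ ν (i' , j')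
          → i ≤ k → k ≤ i' → j ≤ l → l ≤ j' → InSkew κ ν (k , l)
rectangle κ ν κp νp (1≤i , ν<j , _) (_ , _ , j'≤κ) i≤k k≤i' j≤l l≤j' =
  ≤-trans 1≤i i≤k ,
  ≤-trans (s≤s (at-anti ν νp 1≤i i≤k)) (≤-trans ν<j j≤l) ,
  ≤-trans l≤j' (≤-trans j'≤κ (at-anti κ κp (≤-trans 1≤i i≤k) k≤i'))

module _ (la mu : List ℕ) where
  ∈skewCells⁻ : ∀ {x} → x ∈ skewCells la mu → InSkew la mu x
  ∈skewCells⁻ {x} x∈ with find (∈-concatMap⁻ _ {xs = upTo (length la)} x∈)
  ... | i , i∈ , x∈row with ∈-map⁻ (λ t → (suc i , suc (at mu (suc i) ℕ.+ t))) {xs = upTo (at la (suc i) ∸ at mu (suc i))} x∈row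
  ... | t , t∈ , refl = s≤s z≤n , s≤s (m≤m+n _ t) ,
    ≤-trans (≤-reflexive (sym (ℕP.+-suc _ t))) (≤-trans (ℕP.+-monoʳ-≤ (at mu (suc i)) (∈-upTo⁻ t∈))
      (≤-reflexive (ℕP.m+[n∸m]≡n (<⇒≤
          (ℕP.m∸n≢0⇒n<m {at la (suc i)} {at mu (suc i)} (λ e → contradiction (subst (t <_) e (∈-upTo⁻ t∈)) λ ()))))))

  ∈skewCells⁺ : ∀ {x} → InSkew la mu x → x ∈ skewCells la mu
  ∈skewCells⁺ {suc i , j} (_ , μ<j , j≤λ) =
      ∈-concatMap⁺ _ (lose (∈-upTo⁺ (at-pos⇒≤length la (suc i) (≤-trans (≤-trans (s≤s z≤n) μ<j) j≤λ)))
    (subst (λ k → (suc i , k) ∈ _) (ℕP.m+[n∸m]≡n μ<j)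
      (∈-map⁺ (λ t → (suc i , suc (at mu (suc i) ℕ.+ t))) (∈-upTo⁺ {n = at la (suc i) ∸ at mu (suc i)}
        (ℕP.∸-monoˡ-< (s≤s j≤λ) μ<j)))))

-- Extremal cells selected by folds

module _ {A : Set} (pick : A → A → A) (_≼_ : A → A → Set) (≼-refl : ∀ {a} → a ≼ a)
         (≼-trans : ∀ {a b c} → a ≼ b → b ≼ c → a ≼ c)
         (pick-spec : ∀ a b → (pick a b ≡ a × a ≼ b) ⊎ (pick a b ≡ b × b ≼ a)) where
  foldr-pick : ∀ x xs → foldr pick x xs ∈ x ∷ xs × (∀ {y} → y ∈ x ∷ xs → foldr pick x xs ≼ y)
  foldr-pick x [] = here refl , λ { (here refl) → ≼-refl }
  foldr-pick x (a ∷ xs) with foldr pick x xs | foldr-pick x xs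
  ... | m | m∈ , m≼ with pick a m | pick-spec a m
  ... | _ | inj₁ (refl , a≼m) = there (here refl) ,
        λ { (here refl) → ≼-trans a≼m (m≼ (here refl)) ; (there (here refl)) → ≼-refl ; (there (there y∈)) → ≼-trans a≼m (m≼ (there y∈)) }
  ... | _ | inj₂ (refl , m≼a) = weaken m∈ ,
        λ { (here refl) → m≼ (here refl) ; (there (here refl)) → m≼a ; (there (there y∈)) → m≼ (there y∈) }
    where
      weaken : m ∈ x ∷ xs → m ∈ x ∷ a ∷ xs
      weaken (here e)   = here e
      weaken (there m∈) = there (there m∈)

NorthEastOf SouthWestOf : Cell → Cell → Set
NorthEastOf t y = row t < row y ⊎ (row t ≡ row y × col y ≤ col t)
SouthWestOf h y = NorthEastOf y h

private
  ne-refl : ∀ {a} → NorthEastOf a a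
  ne-refl = inj₂ (refl , ≤-refl)

  ne-trans : ∀ {a b c} → NorthEastOf a b → NorthEastOf b c → NorthEastOf a c
  ne-trans (inj₁ p)          (inj₁ q)          = inj₁ (<-trans p q)
  ne-trans (inj₁ p)          (inj₂ (refl , _)) = inj₁ p
  ne-trans (inj₂ (refl , _)) (inj₁ q)          = inj₁ q
  ne-trans (inj₂ (refl , p)) (inj₂ (refl , q)) = inj₂ (refl , ≤-trans q p)

  pickTail-spec : ∀ a b → (pickTail a b ≡ a × NorthEastOf a b) ⊎ (pickTail a b ≡ b × NorthEastOf b a)
  pickTail-spec (i , j) (i' , j') with i ℕ.<ᵇ i' in e₁
  ... | true = inj₁ (refl , inj₁ (<ᵇ-true i i' e₁))
  ... | false with i ℕ.≡ᵇ i' in e₂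
  ...   | false = inj₂ (refl , inj₁ (≤∧≢⇒< (<ᵇ-false i i' e₁) (≡ᵇ-false i i' e₂ ∘ sym)))
  ...   | true with j' ℕ.<ᵇ j in e₃
  ...     | true  = inj₁ (refl , inj₂ (≡ᵇ-true i i' e₂ , <⇒≤ (<ᵇ-true j' j e₃)))
  ...     | false = inj₂ (refl , inj₂ (sym (≡ᵇ-true i i' e₂) , <ᵇ-false j' j e₃))

  pickHead-spec : ∀ a b → (pickHead a b ≡ a × SouthWestOf a b) ⊎ (pickHead a b ≡ b × SouthWestOf b a)
  pickHead-spec (i , j) (i' , j') with i' ℕ.<ᵇ i in e₁
  ... | true = inj₁ (refl , inj₁ (<ᵇ-true i' i e₁))
  ... | false with i ℕ.≡ᵇ i' in e₂
  ...   | false = inj₂ (refl , inj₁ (≤∧≢⇒< (<ᵇ-false i' i e₁) (≡ᵇ-false i i' e₂)))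
  ...   | true with j ℕ.<ᵇ j' in e₃
  ...     | true  = inj₁ (refl , inj₂ (sym (≡ᵇ-true i i' e₂) , <⇒≤ (<ᵇ-true j j' e₃)))
  ...     | false = inj₂ (refl , inj₂ (≡ᵇ-true i i' e₂ , <ᵇ-false j j' e₃))

tailC-spec : ∀ {w θ} → w ∈ θ → tailC θ ∈ θ × (∀ {y} → y ∈ θ → NorthEastOf (tailC θ) y)
tailC-spec {θ = x ∷ xs} _ = foldr-pick pickTail NorthEastOf ne-refl ne-trans pickTail-spec x xs

headC-spec : ∀ {w θ} → w ∈ θ → headC θ ∈ θ × (∀ {y} → y ∈ θ → SouthWestOf (headC θ) y)
headC-spec {θ = x ∷ xs} _ = foldr-pick pickHead SouthWestOf ne-refl (λ p q → ne-trans q p) pickHead-spec x xs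

module _ (better : Cell → Cell → Bool) (_≼_ : Cell → Cell → Set) (≼-refl : ∀ {a} → a ≼ a)
         (≼-trans : ∀ {a b c} → a ≼ b → b ≼ c → a ≼ c)
         (better-true : ∀ a b → better a b ≡ true → a ≼ b) (better-false : ∀ a b → better a b ≡ false → b ≼ a) where
  private
    best : List Cell → Cell
    best = foldr (λ x m → if (row m ℕ.≡ᵇ 0) ∨ better x m then x else m) (0 , 0)

    best-spec : ∀ x xs → (∀ {y} → y ∈ x ∷ xs → 1 ≤ row y) → best (x ∷ xs) ∈ x ∷ xs × (∀ {y} → y ∈ x ∷ xs → best (x ∷ xs) ≼ y)
    best-spec x []       _   = here refl , λ { (here refl) → ≼-refl }
    best-spec x (a ∷ xs) pos with best (a ∷ xs) | best-spec a xs (pos ∘ there)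
    ... | m | m∈ , m≼ with row m ℕ.≡ᵇ 0 in e
    -- Row 0 marks the default `(0 , 0)`, and no cell of the list lies in row 0.
    ... | true  = contradiction (subst (1 ≤_) (≡ᵇ-true (row m) 0 e) (pos (there m∈))) λ ()
    ... | false with better x m in e'
    ... | true  = here refl , λ { (here refl) → ≼-refl ; (there y∈) → ≼-trans (better-true x m e') (m≼ y∈) }
    ... | false = there m∈ , λ { (here refl) → better-false x m e' ; (there y∈) → m≼ y∈ }

  best-≡ : ∀ {w} xs → (∀ {y} → y ∈ xs → 1 ≤ row y) → w ∈ xs → (∀ {y} → y ∈ xs → y ≼ w → y ≡ w) → best xs ≡ w
  best-≡ (x ∷ xs) pos w∈ least with best-spec x xs pos
  ... | b∈ , b≼ = least b∈ (b≼ w∈)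

leftmost-≡ : ∀ {w} xs → (∀ {y} → y ∈ xs → 1 ≤ row y) → w ∈ xs → (∀ {y} → y ∈ xs → col y ≤ col w → y ≡ w)
           → foldr (λ x m → if (row m ℕ.≡ᵇ 0) ∨ (col x ℕ.<ᵇ col m) then x else m) (0 , 0) xs ≡ w
leftmost-≡ = best-≡ (λ x m → col x ℕ.<ᵇ col m) (λ x y → col x ≤ col y) ≤-refl ≤-trans
  (λ a b e → <⇒≤ (<ᵇ-true (col a) (col b) e)) (λ a b e → <ᵇ-false (col a) (col b) e)

rightmost-≡ : ∀ {w} xs → (∀ {y} → y ∈ xs → 1 ≤ row y) → w ∈ xs → (∀ {y} → y ∈ xs → col w ≤ col y → y ≡ w)
            → foldr (λ x m → if (row m ℕ.≡ᵇ 0) ∨ (col m ℕ.<ᵇ col x) then x else m) (0 , 0) xs ≡ w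
rightmost-≡ = best-≡ (λ x m → col m ℕ.<ᵇ col x) (λ x y → col y ≤ col x) ≤-refl (λ p q → ≤-trans q p)
  (λ a b e → <⇒≤ (<ᵇ-true (col b) (col a) e)) (λ a b e → <ᵇ-false (col b) (col a) e)

-- Ribbons

module Ribbon {θ : List Cell} (ribbon : IsRibbon θ) where
  private
    skew = proj₁ (proj₂ ribbon)
    κ = proj₁ skew
    ν = proj₁ (proj₂ skew)
    κ-part = proj₁ (proj₂ (proj₂ skew))
    ν-part = proj₁ (proj₂ (proj₂ (proj₂ skew)))
    cell⇔ = proj₂ (proj₂ (proj₂ (proj₂ (proj₂ skew))))
    connected = proj₁ (proj₂ (proj₂ ribbon))
    no-square = proj₂ (proj₂ (proj₂ ribbon))

    fill : ∀ {i j i' j' k l} → (i , j) ∈ θ → (i' , j') ∈ θ → i ≤ k → k ≤ i' → j ≤ l → l ≤ j' → (k , l) ∈ θ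
    fill x∈ y∈ p q r s = proj₂ (cell⇔ _) (rectangle κ ν κ-part ν-part (proj₁ (cell⇔ _) x∈) (proj₁ (cell⇔ _) y∈) p q r s)

  -- By convexity the two cells would be completed to a 2 by 2 block.
  no-diagonal : ∀ {i j} → (i , j) ∈ θ → (suc i , suc j) ∈ θ → ⊥
  no-diagonal {i} {j} x∈ y∈ = no-square i j
    (x∈ , fill x∈ y∈ (n≤1+n i) ≤-refl ≤-refl (n≤1+n j) , fill x∈ y∈ ≤-refl (n≤1+n i) (n≤1+n j) ≤-refl , y∈)

  private
    1≤row : ∀ {i j} → (i , j) ∈ θ → 1 ≤ i
    1≤row x∈ = proj₁ (proj₁ (cell⇔ _) x∈)

  -- Follow a path in the ribbon starting at the given cell. A step leaving the south-west quadrant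
  -- goes right from its last column or up from its top row; convexity would then put the right or
  -- the upper neighbour of the given cell into the ribbon.
  southWest-of-end : ∀ {i j} → (i , j) ∈ θ → up (i , j) ∉ θ → right (i , j) ∉ θ → ∀ {k l} → (k , l) ∈ θ → i ≤ k × l ≤ j
  southWest-of-end {zero} x∈ = contradiction (1≤row x∈) λ ()
  southWest-of-end {suc i} {j} x∈ up∉ right∉ {k} {l} y∈ = go (connected _ _ x∈ y∈) ≤-refl ≤-refl
    where
      go : ∀ {k' l'} → Reach (_∈ θ) (k' , l') (k , l) → suc i ≤ k' → l' ≤ j → suc i ≤ k × l ≤ j
      go here i≤k' l'≤j = i≤k' , l'≤j
      go (step (inj₂ (inj₁ (refl , refl))) w∈ rest) i≤k' l'≤j = go rest i≤k' (≤-trans (n≤1+n _) l'≤j)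
      go (step (inj₂ (inj₂ (inj₁ (refl , refl)))) w∈ rest) i≤k' l'≤j = go rest (m≤n⇒m≤1+n i≤k') l'≤j
      go {k'} {l'} (step (inj₁ (refl , refl)) w∈ rest) i≤k' l'≤j with l' ℕ.≟ j
      ... | yes refl = contradiction (fill x∈ w∈ ≤-refl i≤k' (n≤1+n l') ≤-refl) right∉
      ... | no l'≢j  = go rest i≤k' (≤∧≢⇒< l'≤j l'≢j)
      go (step {y = (k₁ , _)} (inj₂ (inj₂ (inj₂ (refl , refl)))) w∈ rest) i≤k' l'≤j with k₁ ℕ.≟ i
      ... | yes refl = contradiction (fill w∈ x∈ ≤-refl (n≤1+n i) l'≤j ≤-refl) up∉
      ... | no k₁≢i  = go rest (≤∧≢⇒< (≤-pred i≤k') (k₁≢i ∘ sym)) l'≤j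

  northEast-of-start : ∀ {i j} → (i , j) ∈ θ → left (i , j) ∉ θ → down (i , j) ∉ θ → ∀ {k l} → (k , l) ∈ θ → k ≤ i × j ≤ l
  northEast-of-start {j = zero} x∈ = contradiction (proj₁ (proj₂ (proj₁ (cell⇔ _) x∈))) λ ()
  northEast-of-start {i} {suc j} x∈ left∉ down∉ {k} {l} y∈ = go (connected _ _ x∈ y∈) ≤-refl ≤-refl
    where
      go : ∀ {k' l'} → Reach (_∈ θ) (k' , l') (k , l) → k' ≤ i → suc j ≤ l' → k ≤ i × suc j ≤ l
      go here k'≤i j≤l' = k'≤i , j≤l'
      go (step (inj₁ (refl , refl)) w∈ rest) k'≤i j≤l' = go rest k'≤i (m≤n⇒m≤1+n j≤l')
      go (step (inj₂ (inj₂ (inj₂ (refl , refl)))) w∈ rest) k'≤i j≤l' = go rest (≤-trans (n≤1+n _) k'≤i) j≤l'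
      go (step {y = (_ , l₁)} (inj₂ (inj₁ (refl , refl))) w∈ rest) k'≤i j≤l' with l₁ ℕ.≟ j
      ... | yes refl = contradiction (fill w∈ x∈ k'≤i ≤-refl ≤-refl (n≤1+n j)) left∉
      ... | no l₁≢j  = go rest k'≤i (≤∧≢⇒< (≤-pred j≤l') (l₁≢j ∘ sym))
      go {k'} (step (inj₂ (inj₂ (inj₁ (refl , refl)))) w∈ rest) k'≤i j≤l' with k' ℕ.≟ i
      ... | yes refl = contradiction (fill x∈ w∈ (n≤1+n i) ≤-refl ≤-refl j≤l') down∉
      ... | no k'≢i  = go rest (≤∧≢⇒< k'≤i k'≢i) j≤l'

  tail-≡ : ∀ {x} → x ∈ θ → up x ∉ θ → right x ∉ θ → tailC θ ≡ x
  tail-≡ {i , j} x∈ up∉ right∉ with tailC θ | tailC-spec x∈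
  ... | (k , l) | t∈ , t-ne with southWest-of-end x∈ up∉ right∉ t∈ | t-ne x∈
  ... | i≤k , l≤j | inj₁ k<i          = contradiction k<i (≤⇒≯ i≤k)
  ... | i≤k , l≤j | inj₂ (refl , j≤l) = cong (_ ,_) (≤-antisym l≤j j≤l)

  head-≡ : ∀ {x} → x ∈ θ → left x ∉ θ → down x ∉ θ → headC θ ≡ x
  head-≡ {i , j} x∈ left∉ down∉ with headC θ | headC-spec x∈
  ... | (k , l) | h∈ , h-sw with northEast-of-start x∈ left∉ down∉ h∈ | h-sw x∈
  ... | k≤i , j≤l | inj₁ i<k          = contradiction i<k (≤⇒≯ k≤i)
  ... | k≤i , j≤l | inj₂ (refl , l≤j) = cong (_ ,_) (≤-antisym l≤j j≤l)

tail-up : ∀ {θ t} → tailC θ ≡ t → 1 ≤ row t → up t ∉ θ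
tail-up {θ} {suc i , j} e _ u∈ with subst (λ t → NorthEastOf t (i , j)) e (proj₂ (tailC-spec u∈) u∈)
... | inj₁ i<      = 1+n≰n (≤-trans (n≤1+n _) i<)
... | inj₂ (e' , _) = 1+n≢n e'

tail-right : ∀ {θ t} → tailC θ ≡ t → right t ∉ θ
tail-right {θ} {i , j} e u∈ with subst (λ t → NorthEastOf t (i , suc j)) e (proj₂ (tailC-spec u∈) u∈)
... | inj₁ i<       = 1+n≰n i<
... | inj₂ (_ , j<) = 1+n≰n j<

head-down : ∀ {θ h} → headC θ ≡ h → down h ∉ θ
head-down {θ} {i , j} e d∈ with subst (λ h → SouthWestOf h (suc i , j)) e (proj₂ (headC-spec d∈) d∈)
... | inj₁ i<      = 1+n≰n (≤-trans (n≤1+n _) i<)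
... | inj₂ (e' , _) = 1+n≢n e'

head-left : ∀ {θ h} → headC θ ≡ h → 1 ≤ col h → left h ∉ θ
head-left {θ} {i , suc j} e _ l∈ with subst (λ h → SouthWestOf h (i , j)) e (proj₂ (headC-spec l∈) l∈)
... | inj₁ i<       = 1+n≰n i<
... | inj₂ (_ , j<) = 1+n≰n j<

least : {P : ℕ → Set} → (∀ n → Dec (P n)) → ∀ n → P n → Σ ℕ λ m → P m × m ≤ n × (∀ {k} → k < m → ¬ P k)
least P? zero    p = 0 , p , z≤n , λ ()
least P? (suc n) p with P? 0
... | yes p₀ = 0 , p₀ , z≤n , λ ()
... | no ¬p₀ with least (P? ∘ suc) n p
...   | m , pm , m≤n , below = suc m , pm , s≤s m≤n , λ { {zero} _ → ¬p₀ ; {suc k} (s≤s k<m) → below k<m }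

-- Intervals of naturals as lists

countFrom : ℕ → ℕ → List ℕ
countFrom a zero    = []
countFrom a (suc n) = a ∷ countFrom (suc a) n

interval : ℕ → ℕ → List ℕ
interval a b = countFrom a (b ∸ a)

interval-empty : ∀ a → interval a a ≡ []
interval-empty a rewrite ℕP.n∸n≡0 a = refl

interval-cons : ∀ {a b} → a ≤ b → interval a (suc b) ≡ a ∷ interval (suc a) (suc b)
interval-cons {a} {b} a≤b rewrite ℕP.+-∸-assoc 1 a≤b = refl

interval-snoc : ∀ {a b} → a ≤ b → interval a (suc b) ≡ interval a b ++ b ∷ []
interval-snoc {a} {b} a≤b rewrite ℕP.+-∸-assoc 1 a≤b =
  trans (go a (b ∸ a)) (cong (λ k → countFrom a (b ∸ a) ++ k ∷ []) (m∸n+n≡m a≤b))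
  where
    go : ∀ a n → countFrom a (suc n) ≡ countFrom a n ++ (n + a) ∷ []
    go a zero    = refl
    go a (suc n) = cong (a ∷_) (trans (go (suc a) n) (cong (λ k → countFrom (suc a) n ++ k ∷ []) (ℕP.+-suc n a)))

interval-suc : ∀ a b → interval (suc a) (suc b) ≡ map suc (interval a b)
interval-suc a b = go a (b ∸ a)
  where
    go : ∀ a n → countFrom (suc a) n ≡ map suc (countFrom a n)
    go a zero    = refl
    go a (suc n) = cong (suc a ∷_) (go (suc a) n)

∈-interval⁻ : ∀ {i a b} → i ∈ interval a b → a ≤ i × i < b
∈-interval⁻ {i} {a} {b} i∈ = proj₁ (go a (b ∸ a) i∈) , bound
  where
    go : ∀ a n → i ∈ countFrom a n → a ≤ i × i < n + a
    go a (suc n) (here refl) = ≤-refl , s≤s (ℕP.m≤n+m a n)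
    go a (suc n) (there i∈)  with go (suc a) n i∈
    ... | a<i , i< = <⇒≤ a<i , subst (i <_) (ℕP.+-suc n a) i<
    bound : i < b
    bound with ℕP.≤-total a b
    ... | inj₁ a≤b = subst (i <_) (m∸n+n≡m a≤b) (proj₂ (go a (b ∸ a) i∈))
    ... | inj₂ b≤a with b ∸ a | ℕP.m≤n⇒m∸n≡0 b≤a
    ...   | _ | refl = contradiction i∈ λ ()

map-interval-cong : ∀ {A : Set} {f g : ℕ → A} a b → (∀ {i} → a ≤ i → i < b → f i ≡ g i) → map f (interval a b) ≡ map g
    (interval a b)
map-interval-cong a b f≡g = go (interval a b) λ i∈ → f≡g (proj₁ (∈-interval⁻ i∈)) (proj₂ (∈-interval⁻ i∈))
  where
    go : ∀ l → (∀ {i} → i ∈ l → _ ≡ _) → map _ l ≡ map _ l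
    go []      _ = refl
    go (x ∷ l) e = cong₂ _∷_ (e (here refl)) (go l (e ∘ there))

map-interval-suc : ∀ {A : Set} {f g : ℕ → A} a b → (∀ {i} → a ≤ i → i < b → f (suc i) ≡ g i)
                 → map f (interval (suc a) (suc b)) ≡ map g (interval a b)
map-interval-suc {f = f} a b f≡g = trans (cong (map f) (interval-suc a b))
  (trans (sym (map-∘ (interval a b))) (map-interval-cong a b f≡g))

-- Diagonals of a skew shape

module Threshold (ℓ : ℕ) (p : List ℕ) (p-part : IsPartition p) (p-short : at p (suc ℓ) ≡ 0) where
  private
    past : ∀ s → at p (suc ℓ) + ℓ < s + suc ℓ
    past s = subst (λ k → k + ℓ < s + suc ℓ) (sym p-short) (ℕP.m≤n+m (suc ℓ) s)

    search : ∀ s → Σ ℕ λ m → at p (suc m) + ℓ < s + suc m × m ≤ ℓ × (∀ {k} → k < m → ¬ (at p (suc k) + ℓ < s + suc k))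
    search s = least (λ m → at p (suc m) + ℓ <? s + suc m) ℓ (past s)

  abstract
    -- Diagonal `s` meets row `i` in column `s + i - ℓ`, and `threshold s` is the earliest row in
    -- which that column exceeds the part of `p`. For `mu` the diagonal enters the shape there, for
    -- `la` it has just left it. Row `ℓ + 1`, where the part is 0, bounds the search.
    threshold : ℕ → ℕ
    threshold s = suc (proj₁ (search s))

    threshold≡suc : ∀ s → threshold s ≡ suc (threshold s ∸ 1)
    threshold≡suc s = refl

    threshold-reached : ∀ {s i} → threshold s ≤ i → at p i + ℓ < s + i
    threshold-reached {s} {suc i} t≤i = ≤-trans (s≤s (ℕP.+-monoˡ-≤ ℓ (at-anti p p-part (s≤s z≤n) t≤i)))
      (≤-trans (proj₁ (proj₂ (search s))) (ℕP.+-monoʳ-≤ s t≤i))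

    threshold-least : ∀ {s i} → 1 ≤ i → at p i + ℓ < s + i → threshold s ≤ i
    threshold-least {s} {suc i} _ q = ≮⇒≥ λ i<t → proj₂ (proj₂ (proj₂ (search s))) (≤-pred i<t) q

  1≤threshold : ∀ s → 1 ≤ threshold s
  1≤threshold s = subst (1 ≤_) (sym (threshold≡suc s)) (s≤s z≤n)

  threshold-suc≤ : ∀ s → threshold (suc s) ≤ threshold s
  threshold-suc≤ s = threshold-least {suc s} (1≤threshold s) (m≤n⇒m≤1+n (threshold-reached {s} ≤-refl))

  threshold≤suc : ∀ s → threshold s ≤ suc (threshold (suc s))
  threshold≤suc s = threshold-least {s} (s≤s z≤n) (subst (at p (suc t) + ℓ <_) (sym (ℕP.+-suc s t))
    (≤-trans (s≤s (ℕP.+-monoˡ-≤ ℓ (at-anti p p-part (1≤threshold (suc s)) (n≤1+n t)))) (threshold-reached {suc s} ≤-refl)))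
    where t = threshold (suc s)

  -- Applied to both `lo` and `hi`, this dichotomy yields the four forms of the induction step.
  threshold-step : ∀ s → threshold s ≡ threshold (suc s) ⊎ threshold s ≡ suc (threshold (suc s))
  threshold-step s with threshold s ℕ.≟ threshold (suc s)
  ... | yes e = inj₁ e
  ... | no ¬e = inj₂ (≤-antisym (threshold≤suc s) (≤∧≢⇒< (threshold-suc≤ s) (¬e ∘ sym)))

module Diagonals (la mu : List ℕ) (r : ℤ) (la-part : IsPartition la) (mu-part : IsPartition mu) (mu⊆la : mu ⊆ₚ la) where
  open Shape la mu r
  open Algebra.Properties.AbelianGroup ℤP.+-0-abelianGroup using (∙-cancelˡ)

  ℓ : ℕ
  ℓ = length la

  In : Cell → Set
  In = InSkew la mu

  In-fill : ∀ {i j i' j' k l} → In (i , j) → In (i' , j') → i ≤ k → k ≤ i' → j ≤ l → l ≤ j' → In (k , l)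
  In-fill = rectangle la mu la-part mu-part

  la-short : at la (suc ℓ) ≡ 0
  la-short with at la (suc ℓ) in e
  ... | zero  = refl
  ... | suc _ = contradiction (at-pos⇒≤length la (suc ℓ) (subst (1 ≤_) (sym e) (s≤s z≤n))) 1+n≰n

  mu-short : at mu (suc ℓ) ≡ 0
  mu-short = ℕP.n≤0⇒n≡0 (subst (at mu (suc ℓ) ≤_) la-short (mu⊆la (suc ℓ)))

  module Lo = Threshold ℓ mu mu-part mu-short
  module Hi = Threshold ℓ la la-part la-short

  lo hi : ℕ → ℕ
  lo = Lo.threshold
  hi = Hi.threshold

  lo≤hi : ∀ s → lo s ≤ hi s
  lo≤hi s = Lo.threshold-least {s} (Hi.1≤threshold s)
      (≤-trans (s≤s (ℕP.+-monoˡ-≤ ℓ (mu⊆la (hi s)))) (Hi.threshold-reached {s} ≤-refl))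

  -- The content, shifted to be a natural number; meaningful only for rows up to ℓ.
  off : Cell → ℕ
  off (i , j) = j + (ℓ ∸ i)

  abstract
    base : ℤ
    base = r - + 1 ℤ.+ + conj la 1 - + ℓ

    cont-off : ∀ {x} → row x ≤ ℓ → cont x ≡ base ℤ.+ + off x
    cont-off {i , j} i≤ℓ = trans (rearrange (+ j) (+ i) r (+ conj la 1) (+ ℓ))
      (cong (λ k → base ℤ.+ (+ j ℤ.+ k)) (trans (ℤP.m-n≡m⊖n ℓ i) (ℤP.⊖-≥ i≤ℓ)))
      where
        rearrange : ∀ j i r k l → j - i ℤ.+ r - + 1 ℤ.+ k ≡ (r - + 1 ℤ.+ k - l) ℤ.+ (j ℤ.+ (l - i))
        rearrange = ℤ-Solver.solve-∀

  In⇒row≤ℓ : ∀ {x} → In x → row x ≤ ℓ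
  In⇒row≤ℓ {i , j} (_ , μ<j , j≤λ) = at-pos⇒≤length la i (≤-trans (≤-trans (s≤s z≤n) μ<j) j≤λ)

  -- Where the diagonal lies left of the diagram the subtraction truncates to column 0, which
  -- contains no cell of the shape, so membership remains meaningful.
  cell : ℕ → ℕ → Cell
  cell s i = i , (s + i) ∸ ℓ

  In-cell⁺ : ∀ {s i} → lo s ≤ i → i < hi s → In (cell s i)
  In-cell⁺ {s} {i} lo≤i i<hi = 1≤i , μ< , ℕP.m≤n+o⇒m∸n≤o (s + i) ℓ
      (subst (s + i ≤_) (ℕP.+-comm (at la i) ℓ) (≮⇒≥ λ q → <⇒≱ i<hi (Hi.threshold-least {s} 1≤i q)))
    where
      1≤i = ≤-trans (Lo.1≤threshold s) lo≤i
      μ< : at mu i < (s + i) ∸ ℓ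
      μ< = ℕP.m+n≤o⇒m≤o∸n (suc (at mu i)) (Lo.threshold-reached {s} lo≤i)

  In-cell⁻ : ∀ {s i} → In (cell s i) → lo s ≤ i × i < hi s
  In-cell⁻ {s} {i} (1≤i , μ< , ≤λ) = Lo.threshold-least {s} 1≤i μ+ℓ< , ≰⇒> λ hi≤i →
      <⇒≱ (Hi.threshold-reached {s} hi≤i)
          (subst (s + i ≤_) (ℕP.+-comm ℓ (at la i)) (≤-trans (ℕP.m≤n+m∸n (s + i) ℓ) (ℕP.+-monoʳ-≤ ℓ ≤λ)))
    where
      μ+ℓ< : at mu i + ℓ < s + i
      μ+ℓ< = subst (at mu i + ℓ <_) (m∸n+n≡m
          (<⇒≤ (ℕP.m∸n≢0⇒n<m {s + i} {ℓ} λ e → contradiction (subst (at mu i <_) e μ<) λ ()))) (ℕP.+-monoˡ-< ℓ μ<)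

  ℓ≤s+i : ∀ {s i} → In (cell s i) → ℓ ≤ s + i
  ℓ≤s+i {s} {i} (_ , μ< , _) = <⇒≤ (ℕP.m∸n≢0⇒n<m {s + i} {ℓ} λ e → contradiction (subst (at mu i <_) e μ<) λ ())

  off-cell : ∀ {s i} → In (cell s i) → off (cell s i) ≡ s
  off-cell {s} {i} q = ℕP.+-cancelʳ-≡ i _ _ (begin
    (s + i) ∸ ℓ + (ℓ ∸ i) + i ≡⟨ ℕP.+-assoc ((s + i) ∸ ℓ) (ℓ ∸ i) i ⟩
    (s + i) ∸ ℓ + (ℓ ∸ i + i) ≡⟨ cong (_+_ ((s + i) ∸ ℓ)) (m∸n+n≡m (In⇒row≤ℓ q)) ⟩
    (s + i) ∸ ℓ + ℓ ≡⟨ m∸n+n≡m (ℓ≤s+i q) ⟩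
    s + i ∎)
    where open ≡.≡-Reasoning

  cell-off : ∀ {x} → row x ≤ ℓ → x ≡ cell (off x) (row x)
  cell-off {i , j} i≤ℓ = cong (i ,_) (sym (begin
    (j + (ℓ ∸ i) + i) ∸ ℓ ≡⟨ cong (_∸ ℓ) (ℕP.+-assoc j (ℓ ∸ i) i) ⟩
    (j + (ℓ ∸ i + i)) ∸ ℓ ≡⟨ cong (λ k → (j + k) ∸ ℓ) (m∸n+n≡m i≤ℓ) ⟩
    (j + ℓ) ∸ ℓ ≡⟨ ℕP.m+n∸n≡m j ℓ ⟩
    j ∎))
    where open ≡.≡-Reasoning

  In⇒cell : ∀ {x} → In x → Σ ℕ λ i → x ≡ cell (off x) i × lo (off x) ≤ i × i < hi (off x)
  In⇒cell {x} q = row x , e , In-cell⁻ (subst In e q)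
    where e = cell-off (In⇒row≤ℓ q)

  down-cell : ∀ s i → down (cell (suc s) i) ≡ cell s (suc i)
  down-cell s i = cong (λ k → suc i , k ∸ ℓ) (sym (ℕP.+-suc s i))

  up-cell : ∀ s i → up (cell s (suc i)) ≡ cell (suc s) i
  up-cell s i = cong (λ k → i , k ∸ ℓ) (ℕP.+-suc s i)

  left-cell : ∀ s i → left (cell (suc s) i) ≡ cell s i
  left-cell s i = cong (i ,_) (trans (ℕP.∸-+-assoc (suc s + i) ℓ 1) (cong (suc (s + i) ∸_) (ℕP.+-comm ℓ 1)))

  right-cell : ∀ {s i} → In (cell s i) → right (cell s i) ≡ cell (suc s) i
  right-cell {s} {i} q = cong (i ,_) (sym (ℕP.+-∸-assoc 1 (ℓ≤s+i q)))

  -- The offsets are shifted contents, so the leftmost cell is the one without a diagonal predecessor.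
  private
    In-filter : ∀ {w c} → w ∈ filter (λ x → cont x ℤ.≟ c) (skewCells la mu) → In w × cont w ≡ c
    In-filter {c = c} w∈ with ∈-filter⁻ (λ x → cont x ℤ.≟ c) {xs = skewCells la mu} w∈
    ... | w∈cells , e = ∈skewCells⁻ la mu w∈cells , e

    same-off : ∀ {x y} → In x → In y → cont x ≡ cont y → off x ≡ off y
    same-off qx qy e = ℤP.+-injective
        (∙-cancelˡ base _ _ (trans (sym (cont-off (In⇒row≤ℓ qx))) (trans e (cont-off (In⇒row≤ℓ qy)))))

    compare : ∀ {x y} → In x → In y → off x ≡ off y → row x < row y → col x < col y
    compare {i , j} {i' , j'} qx qy e i<i' = ≰⇒> λ j'≤j → <⇒≢ (ℕP.+-mono-≤-< j'≤j (ℕP.∸-monoʳ-< i<i' (In⇒row≤ℓ qy))) (sym e)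

    same-row : ∀ {x y} → off x ≡ off y → row x ≡ row y → x ≡ y
    same-row {i , j} {.i , j'} e refl = cong (i ,_) (ℕP.+-cancelʳ-≡ (ℓ ∸ i) _ _ e)

  leftmostOf-≡ : ∀ {i j} → In (suc i , suc j) → ¬ In (i , j) → leftmostOf (cont (suc i , suc j)) ≡ (suc i , suc j)
  leftmostOf-≡ {i} {j} q ¬q = leftmost-≡ (filter (λ x → cont x ℤ.≟ cont (suc i , suc j)) (skewCells la mu))
    (λ w∈ → proj₁ (proj₁ (In-filter w∈)))
    (∈-filter⁺ (λ x → cont x ℤ.≟ cont (suc i , suc j)) (∈skewCells⁺ la mu q) refl)
    λ w∈ → unique (proj₁ (In-filter w∈)) (proj₂ (In-filter w∈))
    where
      unique : ∀ {w} → In w → cont w ≡ cont (suc i , suc j) → col w ≤ suc j → w ≡ (suc i , suc j)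
      unique {k , l} qw e l≤ with same-off qw q e | <-cmp k (suc i)
      -- A cell of the same content in a higher row would, by convexity, bring the diagonal
      -- predecessor `(i , j)` into the shape.
      ... | o | tri< k<i _ _ = contradiction (In-fill qw q (≤-pred k<i) (n≤1+n i) (≤-pred (compare qw q o k<i)) (n≤1+n j)) ¬q
      ... | o | tri≈ _ k≡i _ = same-row o k≡i
      ... | o | tri> _ _ i<k = contradiction l≤ (<⇒≱ (compare q qw (sym o) i<k))

  rightmostOf-≡ : ∀ {i j} → In (i , j) → ¬ In (suc i , suc j) → rightmostOf (cont (i , j)) ≡ (i , j)
  rightmostOf-≡ {i} {j} q ¬q = rightmost-≡ (filter (λ x → cont x ℤ.≟ cont (i , j)) (skewCells la mu))
    (λ w∈ → proj₁ (proj₁ (In-filter w∈)))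
    (∈-filter⁺ (λ x → cont x ℤ.≟ cont (i , j)) (∈skewCells⁺ la mu q) refl)
    λ w∈ → unique (proj₁ (In-filter w∈)) (proj₂ (In-filter w∈))
    where
      unique : ∀ {w} → In w → cont w ≡ cont (i , j) → j ≤ col w → w ≡ (i , j)
      unique {k , l} qw e ≤l with same-off qw q e | <-cmp k i
      ... | o | tri> _ _ i<k = contradiction (In-fill q qw (n≤1+n i) i<k (n≤1+n j) (compare q qw (sym o) i<k)) ¬q
      ... | o | tri≈ _ k≡i _ = same-row o k≡i
      ... | o | tri< k<i _ _ = contradiction ≤l (<⇒≱ (compare qw q o k<i))

  topOff botOff : ℕ → ℕ
  topOff j = suc (off (suc (conj mu j) , j))
  botOff j = off (conj la j , j)

  In⇒1≤col : ∀ {i j} → In (i , j) → 1 ≤ j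
  In⇒1≤col (_ , μ<j , _) = ≤-trans (s≤s z≤n) μ<j

  In⇒conj : ∀ {i j} → In (i , j) → conj mu j < i × i ≤ conj la j
  In⇒conj q@(1≤i , μ<j , j≤λ) =
    ≰⇒> (λ i≤ → <⇒≱ μ<j (proj₂ (≤at⇔≤conj {mu} mu-part 1≤i (In⇒1≤col q)) i≤)) ,
    proj₁ (≤at⇔≤conj {la} la-part 1≤i (In⇒1≤col q)) j≤λ

  conj⇒In : ∀ {i j} → 1 ≤ j → conj mu j < i → i ≤ conj la j → In (i , j)
  conj⇒In 1≤j μ'<i i≤λ' = 1≤i , ≰⇒> (λ j≤ → <⇒≱ μ'<i (proj₁ (≤at⇔≤conj {mu} mu-part 1≤i 1≤j) j≤)) , proj₂
      (≤at⇔≤conj {la} la-part 1≤i 1≤j) i≤λ'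
    where 1≤i = ≤-trans (s≤s z≤n) μ'<i

  -- The upper neighbour of the opening cell of diagonal `s` would lie on diagonal `s + 1` in a row
  -- before `lo (suc s)`, so this cell is the top of its column.
  topOff-cell : ∀ {s} → lo s ≡ lo (suc s) → lo s < hi s → topOff (col (cell s (lo s))) ≡ suc s
  topOff-cell {s} e lo<hi = cong suc
      (trans (cong (λ i → off (i , col x)) (≤-antisym (proj₁ (In⇒conj q)) (above (lo s) refl))) (off-cell q))
    where
      x = cell s (lo s)
      q = In-cell⁺ {s} ≤-refl lo<hi
      above : ∀ k → lo s ≡ k → k ≤ suc (conj mu (col x))
      above zero          _  = z≤n
      above (suc zero)    _  = s≤s z≤n
      above (suc (suc k)) e' = s≤s (proj₁ (≤at⇔≤conj {mu} mu-part (s≤s z≤n) (In⇒1≤col q))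
        (ℕP.m≤n+o⇒m∸n≤o (s + lo s) ℓ (subst (λ i → s + i ≤ ℓ + at mu (suc k)) (sym e')
          (subst (_≤ ℓ + at mu (suc k)) (sym (ℕP.+-suc s (suc k))) (subst (suc s + suc k ≤_) (ℕP.+-comm (at mu (suc k)) ℓ)
            (≮⇒≥ λ q' → <⇒≱ (subst (suc k <_) (trans (sym e') e) ≤-refl) (Lo.threshold-least {suc s} (s≤s z≤n) q')))))))

  -- The lower neighbour of the closing cell of diagonal `s + 1` would lie on diagonal `s` in row
  -- `hi s`, outside the shape, so this cell is the bottom of its column.
  botOff-cell : ∀ {s k} → hi s ≡ suc k → hi (suc s) ≡ suc k → lo (suc s) ≤ k → botOff (col (cell (suc s) k)) ≡ suc s
  botOff-cell {s} {k} e e' lo≤k = trans (cong (λ i → off (i , col y)) (≤-antisym below (proj₂ (In⇒conj q)))) (off-cell q)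
    where
      y = cell (suc s) k
      q = In-cell⁺ {suc s} lo≤k (subst (k <_) (sym e') ≤-refl)
      below : conj la (col y) ≤ k
      below = ≮⇒≥ λ k< → <⇒≱ (ℕP.m+n≤o⇒m≤o∸n (suc (at la (suc k)))
          (subst (at la (suc k) + ℓ <_) (ℕP.+-suc s k) (Hi.threshold-reached {s} (≤-reflexive e))))
        (proj₂ (≤at⇔≤conj {la} la-part (s≤s z≤n) (In⇒1≤col q)) k<)

  NonEmpty : ℕ → Set
  NonEmpty j = 1 ≤ j × conj mu j < conj la j

  bottom-In : ∀ {j} → NonEmpty j → In (conj la j , j)
  bottom-In (1≤j , lt) = conj⇒In 1≤j lt ≤-refl

  top-In : ∀ {j} → NonEmpty j → In (suc (conj mu j) , j)
  top-In (1≤j , lt) = conj⇒In 1≤j ≤-refl lt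

  botOff-suc : ∀ {s j} → NonEmpty j → botOff j ≡ suc s
             → Σ ℕ λ k → hi s ≡ suc k × hi (suc s) ≡ suc k × lo (suc s) ≤ k × j ≡ col (cell (suc s) k)
  botOff-suc {s} {j} ne e = i , ≤-antisym hi≤ i< , ≤-antisym (≤-trans (Hi.threshold-suc≤ s) hi≤) i<hi' , lo'≤i , cong col b≡
    where
      i = conj la j
      q = bottom-In ne
      b≡ : (i , j) ≡ cell (suc s) i
      b≡ = trans (cell-off (In⇒row≤ℓ q)) (cong (λ k → cell k i) e)
      lo'≤i = proj₁ (In-cell⁻ {suc s} (subst In b≡ q))
      i<hi' = proj₂ (In-cell⁻ {suc s} (subst In b≡ q))
      i< = ≤-trans i<hi' (Hi.threshold-suc≤ s)
      hi≤ : hi s ≤ suc i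
      hi≤ = ≮⇒≥ λ i+1<hi → 1+n≰n (proj₂ (In⇒conj (subst In (sym (trans (cong down b≡) (down-cell s i)))
        (In-cell⁺ {s} (≤-trans (Lo.threshold≤suc s) (s≤s lo'≤i)) i+1<hi))))

  off-mono : ∀ {i j i' j'} → i' ≤ i → j ≤ j' → off (i , j) ≤ off (i' , j')
  off-mono i'≤i j≤j' = ℕP.+-mono-≤ j≤j' (ℕP.∸-monoʳ-≤ ℓ i'≤i)

  off<topOff : ∀ {i j} → In (i , j) → off (i , j) < topOff j
  off<topOff q = s≤s (off-mono (proj₁ (In⇒conj q)) ≤-refl)

-- Outer ribbon decompositions

open DecMem _≟c_ using (_∈?_)

any-true : ∀ {A : Set} (f : A → Bool) xs → any f xs ≡ true → Σ (Fin (length xs)) λ k → f (lookup xs k) ≡ true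
any-true f (x ∷ xs) e with f x in fx
... | true  = fzero , fx
... | false with any-true f xs e
...   | k , fk = fsuc k , fk

any-false : ∀ {A : Set} (f : A → Bool) xs → any f xs ≡ false → ∀ k → f (lookup xs k) ≡ false
any-false f (x ∷ xs) e k with f x in fx
any-false f (x ∷ xs) e fzero    | false = fx
any-false f (x ∷ xs) e (fsuc k) | false = any-false f xs e k

module Decomposition (la mu : List ℕ) (r : ℤ)
    (la-part : IsPartition la) (mu-part : IsPartition mu) (mu⊆la : mu ⊆ₚ la)
    (Θ : List (List Cell)) (dec : Shape.OuterRibbonDecomp la mu r Θ) where
  open Shape la mu r
  open Diagonals la mu r la-part mu-part mu⊆la

  Idx : Set
  Idx = Fin (length Θ)

  θ : Idx → List Cell
  θ = lookup Θ

  θ-In : ∀ {k x} → x ∈ θ k → In x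
  θ-In {k} x∈ = proj₁ (proj₂ (proj₁ dec k)) _ x∈

  same-ribbon : ∀ {k k' x} → x ∈ θ k → x ∈ θ k' → k ≡ k'
  same-ribbon {k} {k'} x∈ x∈' = trans (unique k x∈) (sym (unique k' x∈'))
    where unique = proj₂ (proj₂ (proj₂ dec _ (θ-In {k} x∈)))

  cover : ∀ {x} → In x → Σ Idx λ k → x ∈ θ k
  cover q = proj₁ (proj₂ dec _ q) , proj₁ (proj₂ (proj₂ dec _ q))

  private
    module Rib (k : Idx) = Ribbon (proj₁ (proj₁ dec k))

  IsTail : Idx → Cell → Set
  IsTail k x = tailC (θ k) ≡ x

  private
    tail∈ : ∀ k → tailC (θ k) ∈ θ k
    tail∈ k with θ k | proj₁ (proj₁ (proj₁ dec k))
    ... | []     | ne = contradiction refl ne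
    ... | x ∷ xs | _  = proj₁ (tailC-spec {θ = x ∷ xs} (here refl))

    head∈ : ∀ k → headC (θ k) ∈ θ k
    head∈ k with θ k | proj₁ (proj₁ (proj₁ dec k))
    ... | []     | ne = contradiction refl ne
    ... | x ∷ xs | _  = proj₁ (headC-spec {θ = x ∷ xs} (here refl))

  tail-injective : ∀ {k k' x} → IsTail k x → IsTail k' x → k ≡ k'
  tail-injective {k} {k'} t t' = same-ribbon (subst (_∈ θ k) t (tail∈ k)) (subst (_∈ θ k') t' (tail∈ k'))

  tail-In : ∀ k → In (tailC (θ k))
  tail-In k = θ-In {k} (tail∈ k)

  head-In : ∀ k → In (headC (θ k))
  head-In k = θ-In {k} (head∈ k)

  headOff tailOff : Idx → ℕ
  headOff k = off (headC (θ k))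
  tailOff k = off (tailC (θ k))

  headOff≤ : ∀ {k x} → x ∈ θ k → headOff k ≤ off x
  headOff≤ {k} x∈ with Rib.northEast-of-start k (head∈ k) (head-left refl (In⇒1≤col (head-In k))) (head-down refl) x∈
  ... | p , q = off-mono p q

  headOff≤tailOff : ∀ k → headOff k ≤ tailOff k
  headOff≤tailOff k = headOff≤ (tail∈ k)

  -- Directions in the form in which the induction uses them: the ribbon through `x` continues in
  -- that direction as long as the shape does, and otherwise ends at `x`.
  GoesUp GoesRight : Cell → Set
  GoesUp x    = (In (up x) → ∀ {k} → x ∈ θ k → up x ∈ θ k) × (¬ In (up x) → ∀ {k} → x ∈ θ k → IsTail k x)
  GoesRight x = (In (right x) → ∀ {k} → x ∈ θ k → right x ∈ θ k) × (¬ In (right x) → ∀ {k} → x ∈ θ k → IsTail k x)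

  private
    up-not-right : ∀ {x k} → GoesUp x → x ∈ θ k → right x ∉ θ k
    up-not-right {zero , j} {k} goes x∈ _ = contradiction (proj₁ (θ-In {k} x∈)) λ ()
    up-not-right {suc i , j} {k} goes x∈ right∈ with inSkew? la mu (i , j)
    ... | no ¬q = tail-right (proj₂ goes ¬q x∈) right∈
    ... | yes q = Rib.no-diagonal k (proj₁ goes q x∈) right∈

    right-not-up : ∀ {x k} → GoesRight x → x ∈ θ k → up x ∉ θ k
    right-not-up {zero , j} {k} goes x∈ _ = contradiction (proj₁ (θ-In {k} x∈)) λ ()
    right-not-up {suc i , j} {k} goes x∈ up∈ with inSkew? la mu (suc i , suc j)
    ... | no ¬q = tail-up (proj₂ goes ¬q x∈) (s≤s z≤n) up∈
    ... | yes q = Rib.no-diagonal k up∈ (proj₁ goes q x∈)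

    -- This rests on the perimeter condition for tails: a ribbon that stopped at `x` although both
    -- the upper and the right neighbour are in the shape would have its tail on neither the top nor
    -- the right perimeter.
    not-up⇒right : ∀ {x} → In x → (∀ {k} → x ∈ θ k → up x ∉ θ k) → (∀ {k} → x ∈ θ k → IsTail k x → In (up x)) → GoesRight x
    not-up⇒right {x} q up∉ tail⇒ = inside , outside
      where
        outside : ¬ In (right x) → ∀ {k} → x ∈ θ k → IsTail k x
        outside ¬q {k} x∈ = Rib.tail-≡ k x∈ (up∉ x∈) (¬q ∘ θ-In {k})
        inside : In (right x) → ∀ {k} → x ∈ θ k → right x ∈ θ k
        inside qr {k} x∈ with right x ∈? θ k
        ... | yes right∈ = right∈
        ... | no right∉ with Rib.tail-≡ k x∈ (up∉ x∈) right∉ | proj₂ (proj₂ (proj₂ (proj₁ dec k)))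
        ...   | e | inj₁ onTop   = contradiction (tail⇒ x∈ e) (subst OnTop e onTop)
        ...   | e | inj₂ onRight = contradiction qr (subst OnRight e onRight)

    module _ {i j} (q : In (i , j)) (q' : In (suc i , suc j)) where
      private
        y = (i , suc j)
        qy : In y
        qy = In-fill q q' ≤-refl (n≤1+n i) (n≤1+n j) ≤-refl

      -- The cell `y` joins the two diagonal neighbours. Its ribbon avoids `(i , j)`, which goes up.
      -- If it also avoided `(suc i , suc j)`, then `y` would be a head with both its left and its
      -- lower neighbour in the shape, against the perimeter condition for heads.
      up-propagates : GoesUp (i , j) → GoesUp (suc i , suc j)
      up-propagates goes = inside , λ ¬q → contradiction qy ¬q
        where
          inside : In y → ∀ {k} → (suc i , suc j) ∈ θ k → y ∈ θ k
          inside _ {k} x'∈ with cover qy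
          ... | k' , y∈ with (suc i , suc j) ∈? θ k' | (i , j) ∈? θ k'
          ...   | yes x'∈' | _      = subst (λ k → y ∈ θ k) (same-ribbon x'∈' x'∈) y∈
          ...   | no _     | yes x∈ = contradiction y∈ (up-not-right goes x∈)
          ...   | no down∉ | no left∉ with Rib.head-≡ k' y∈ left∉ down∉ | proj₁ (proj₂ (proj₂ (proj₁ dec k')))
          ...     | e | inj₁ onLeft   = contradiction q (subst OnLeft e onLeft)
          ...     | e | inj₂ onBottom = contradiction q' (subst OnBottom e onBottom)

      -- The ribbon of `(i , j)` contains `y`. If it also contained `(suc i , suc j)`, it would have
      -- two diagonally adjacent cells.
      right-propagates : GoesRight (i , j) → GoesRight (suc i , suc j)
      right-propagates goes = not-up⇒right q' up∉ (λ _ _ → qy)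
        where
          up∉ : ∀ {k} → (suc i , suc j) ∈ θ k → y ∉ θ k
          up∉ {k} x'∈ y∈ with cover q
          ... | k' , x∈ = Rib.no-diagonal k (subst (λ k → (i , j) ∈ θ k) (same-ribbon (proj₁ goes qy x∈) y∈) x∈) x'∈

    does-∈ : ∀ {x : Cell} {t} → does (x ∈? t) ≡ true → x ∈ t
    does-∈ {x} {t} e with x ∈? t
    ... | yes x∈ = x∈

    ∈-does : ∀ {x : Cell} {t} → x ∈ t → does (x ∈? t) ≡ true
    ∈-does {x} {t} x∈ with x ∈? t
    ... | yes _ = refl
    ... | no x∉ = contradiction x∈ x∉

    not-does : ∀ {P : Set} (P? : Dec P) → not (does P?) ≡ true → ¬ P
    not-does (no ¬p) _ = ¬p

    not-does-not : ∀ {P : Set} (P? : Dec P) → not (does P?) ≡ false → P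
    not-does-not (yes p) _ = p

    ∧-true : ∀ a b → a ∧ b ≡ true → a ≡ true × b ≡ true
    ∧-true true true _ = refl , refl

    sameRibbon⁻ : ∀ {x y} → sameRibbon Θ x y ≡ true → Σ Idx λ k → x ∈ θ k × y ∈ θ k
    sameRibbon⁻ {x} {y} e with any-true (λ t → does (x ∈? t) ∧ does (y ∈? t)) Θ e
    ... | k , ek with ∧-true (does (x ∈? θ k)) _ ek
    ...   | e₁ , e₂ = k , does-∈ e₁ , does-∈ e₂

    sameRibbon-false : ∀ {x y} → sameRibbon Θ x y ≡ false → ∀ {k} → x ∈ θ k → y ∉ θ k
    sameRibbon-false {x} {y} e {k} x∈ y∈ with trans (sym (any-false (λ t → does (x ∈? t) ∧ does (y ∈? t)) Θ e k))
        (cong₂ _∧_ (∈-does x∈) (∈-does y∈))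
    ... | ()

    isTail⁻ : ∀ {x} → isTail Θ x ≡ true → Σ Idx λ k → x ∈ θ k × IsTail k x
    isTail⁻ {x} e with any-true (λ t → does (x ∈? t) ∧ does (tailC t ≟c x)) Θ e
    ... | k , ek with ∧-true (does (x ∈? θ k)) _ ek
    ...   | e₁ , e₂ with tailC (θ k) ≟c x
    ...     | yes t≡ = k , does-∈ e₁ , t≡

    isTail⁺ : ∀ {x k} → x ∈ θ k → IsTail k x → isTail Θ x ≡ false → ⊥
    isTail⁺ {x} {k} x∈ t≡ e with any-false (λ t → does (x ∈? t) ∧ does (tailC t ≟c x)) Θ e k
    ... | ek rewrite ∈-does x∈ with tailC (θ k) ≟c x
    ...   | no t≢ = t≢ t≡

    topRight-corner : ∀ {x} → In x → x ≡ topRight → ¬ In (up x) × ¬ In (right x)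
    topRight-corner q refl = (λ qu → tail-up refl (proj₁ q) (∈skewCells⁺ la mu qu)) ,
        (λ qr → tail-right refl (∈skewCells⁺ la mu qr))

    -- Applied to the top-right cell: with no neighbour above or to the right it satisfies both
    -- `GoesUp` and `GoesRight`, whichever of the two `goesUp` reports there.
    corner-tail : ∀ {x} → ¬ In (up x) × ¬ In (right x) → ∀ {k} → x ∈ θ k → IsTail k x
    corner-tail (¬u , ¬r) {k} x∈ = Rib.tail-≡ k x∈ (¬u ∘ θ-In {k}) (¬r ∘ θ-In {k})

    goesUp-true : ∀ {x} → In x → goesUp Θ x ≡ true → GoesUp x
    goesUp-true {x} q e with x ≟c topRight
    ... | yes x≡ = (λ qu → contradiction qu (proj₁ (topRight-corner q x≡))) , λ _ → corner-tail (topRight-corner q x≡)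
    ... | no _ with sameRibbon Θ x (up x) in same
    ...   | true with sameRibbon⁻ same
    ...     | k , x∈ , up∈ = (λ _ x∈' → subst (λ k → up x ∈ θ k) (same-ribbon x∈ x∈') up∈) , λ ¬q → contradiction
        (θ-In {k} up∈) ¬q
    goesUp-true {x} q e | no _ | false with isTail Θ x in tl
    ...   | true with isTail⁻ tl
    ...     | k , x∈ , t≡ = (λ qu → contradiction qu (not-does (inSkew? la mu (up x)) e)) , λ _ x∈' → subst
        (λ k → IsTail k x) (same-ribbon x∈ x∈') t≡

    goesUp-false : ∀ {x} → In x → goesUp Θ x ≡ false → GoesRight x
    goesUp-false {x} q e with x ≟c topRight
    ... | yes x≡ = (λ qr → contradiction qr (proj₂ (topRight-corner q x≡))) , λ _ → corner-tail (topRight-corner q x≡)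
    ... | no _ with sameRibbon Θ x (up x) in same
    ...   | false with isTail Θ x in tl
    ...     | false = not-up⇒right q (sameRibbon-false same) (λ x∈ t≡ → ⊥-elim (isTail⁺ x∈ t≡ tl))
    ...     | true  = not-up⇒right q (sameRibbon-false same) (λ _ _ → not-does-not (inSkew? la mu (up x)) e)

  direction : ℕ → Bool
  direction s = dirUp Θ (base ℤ.+ + s)

  private
    -- `direction` is read off at the leftmost cell of a diagonal. The recursion climbs to that cell
    -- and carries the property back down the diagonal.
    along-diagonal : (P : Cell → Set) (b : Bool) → (∀ {x} → In x → goesUp Θ x ≡ b → P x)
                   → (∀ {i j} → In (i , j) → In (suc i , suc j) → P (i , j) → P (suc i , suc j))
                   → ∀ {i j} → In (i , j) → direction (off (i , j)) ≡ b → P (i , j)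
    along-diagonal P b start next {zero}  {j}     (() , _)
    along-diagonal P b start next {suc i} {zero}  (_ , () , _)
    along-diagonal P b start next {suc i} {suc j} q e with inSkew? la mu (i , j)
    ... | yes q' = next q' q (along-diagonal P b start next q' (trans (cong direction same) e))
      where
        same : off (i , j) ≡ off (suc i , suc j)
        same = trans (cong (_+_ j) (ℕP.+-∸-assoc 1 (In⇒row≤ℓ q))) (ℕP.+-suc j _)
    ... | no ¬q' = start q (trans (cong (goesUp Θ) (sym (trans (cong leftmostOf (sym (cont-off (In⇒row≤ℓ q)))) (leftmostOf-≡ q ¬q')))) e)

  all-up : ∀ {x} → In x → direction (off x) ≡ true → GoesUp x
  all-up = along-diagonal GoesUp true goesUp-true up-propagates

  all-right : ∀ {x} → In x → direction (off x) ≡ false → GoesRight x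
  all-right = along-diagonal GoesRight false goesUp-false right-propagates

  headOf : Cell → ℕ
  headOf x with inSkew? la mu x
  ... | yes q = headOff (proj₁ (cover q))
  ... | no _  = 0

  headOf-∈ : ∀ {k x} → x ∈ θ k → headOf x ≡ headOff k
  headOf-∈ {k} {x} x∈ with inSkew? la mu x
  ... | yes q = cong headOff (same-ribbon (proj₂ (cover q)) x∈)
  ... | no ¬q = contradiction (θ-In {k} x∈) ¬q

  headOf≤ : ∀ {x} → In x → headOf x ≤ off x
  headOf≤ q with cover q
  ... | k , x∈ = subst (_≤ _) (sym (headOf-∈ x∈)) (headOff≤ x∈)

  private
    headOf-linked : ∀ {x y} → In x → (∀ {k} → x ∈ θ k → y ∈ θ k) → headOf y ≡ headOf x
    headOf-linked q link with cover q
    ... | k , x∈ = trans (headOf-∈ (link x∈)) (sym (headOf-∈ x∈))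

    headOf-start : ∀ {y} → In y → (∀ {k} → y ∈ θ k → left y ∉ θ k) → (∀ {k} → y ∈ θ k → down y ∉ θ k) → headOf y ≡ off y
    headOf-start q left∉ down∉ with cover q
    ... | k , y∈ = trans (headOf-∈ y∈) (cong off (Rib.head-≡ k y∈ (left∉ y∈) (down∉ y∈)))

    right-left : ∀ {y} → In y → right (left y) ≡ y
    right-left {i , suc j} q = refl
    right-left {i , zero} (_ , () , _)

    In-off : ∀ {s i} → In (cell s i) → direction s ≡ direction (off (cell s i))
    In-off q = cong direction (sym (off-cell q))

  -- The two labels of the piece crossing diagonal `s` in row `i`: it follows a ribbon from its head
  -- to this cell, and from there the column up to its top.
  h v : ℕ → ℕ → ℕ
  h s i = headOf (cell s i)
  v s i = topOff (col (cell s i))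

  v-up : ∀ s i → v s (suc i) ≡ v (suc s) i
  v-up s i = cong (λ k → topOff (k ∸ ℓ)) (ℕP.+-suc s i)

  module _ {s : ℕ} (goesUp : direction s ≡ true) where
    private
      cell-up : ∀ {i} → In (cell s i) → GoesUp (cell s i)
      cell-up q = all-up q (trans (sym (In-off q)) goesUp)

    h-up : ∀ {i} → lo (suc s) ≤ i → suc i < hi s → h (suc s) i ≡ h s (suc i)
    h-up {i} lo≤i i<hi = headOf-linked q λ {k} x∈ → subst (_∈ θ k) (up-cell s i)
        (proj₁ (cell-up q) (subst In (sym (up-cell s i)) qy) x∈)
      where
        q = In-cell⁺ {s} (≤-trans (Lo.threshold≤suc s) (s≤s lo≤i)) i<hi
        qy : In (cell (suc s) i)
        qy = In-cell⁺ {suc s} lo≤i (≤-pred (≤-trans i<hi (Hi.threshold≤suc s)))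

    -- The cell has no lower neighbour in the shape, and its left neighbour, being of content `s`,
    -- goes up instead of entering it; so a ribbon starts here.
    h-up-start : ∀ {i} → lo (suc s) ≤ i → i < hi (suc s) → hi s ≤ suc i → h (suc s) i ≡ suc s
    h-up-start {i} lo≤i i<hi' hi≤ = trans (headOf-start q left∉ down∉) (off-cell q)
      where
        q = In-cell⁺ {suc s} lo≤i i<hi'
        left∉ : ∀ {k} → cell (suc s) i ∈ θ k → left (cell (suc s) i) ∉ θ k
        left∉ {k} y∈ l∈ = up-not-right (cell-up (θ-In {k} l∈')) l∈'
            (subst (_∈ θ k) (sym (trans (cong right (sym (left-cell s i))) (right-left q))) y∈)
          where l∈' = subst (_∈ θ k) (left-cell s i) l∈
        down∉ : ∀ {k} → cell (suc s) i ∈ θ k → down (cell (suc s) i) ∉ θ k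
        down∉ {k} _ d∈ = <⇒≱ (proj₂ (In-cell⁻ {s} (θ-In {k} (subst (_∈ θ k) (down-cell s i) d∈)))) hi≤

    up-tail : lo s ≡ lo (suc s) → lo s < hi s → Σ Idx λ k → IsTail k (cell s (lo s)) × h s (lo s) ≡ headOff k
    up-tail e lo<hi with cover (In-cell⁺ {s} ≤-refl lo<hi)
    ... | k , x∈ = k , proj₂ (cell-up q) ¬up x∈ , headOf-∈ x∈
      where
        q = In-cell⁺ {s} ≤-refl lo<hi
        ¬up : ¬ In (up (cell s (lo s)))
        ¬up qu = <⇒≱ (≤-reflexive (sym lo≡))
            (subst (_≤ lo s ∸ 1) (sym e) (proj₁
            (In-cell⁻ {suc s} (subst In (up-cell s (lo s ∸ 1)) (subst (λ i → In (up (cell s i))) lo≡ qu)))))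
          where lo≡ = Lo.threshold≡suc s

    up-tail⁻ : ∀ {k} → tailOff k ≡ s → lo s ≡ lo (suc s) × lo s < hi s × IsTail k (cell s (lo s))
    up-tail⁻ {k} refl with In⇒cell (tail-In k)
    ... | zero  , _ , lo≤0 , _ = contradiction (≤-trans (Lo.1≤threshold s) lo≤0) λ ()
    ... | suc m , t≡ , lo≤i , i<hi = ≤-antisym (≤-trans lo≤i i≤lo') (Lo.threshold-suc≤ s)
                                   , ≤-trans (s≤s lo≤i) i<hi
                                   , trans t≡ (cong (cell s) (≤-antisym (≤-trans i≤lo' (Lo.threshold-suc≤ s)) lo≤i))
      where
        ¬In-up : ¬ In (up (tailC (θ k)))
        ¬In-up qu = tail-up refl (proj₁ (tail-In k)) (proj₁ (all-up (tail-In k) goesUp) qu (tail∈ k))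
        i≤lo' : suc m ≤ lo (suc s)
        i≤lo' = ≰⇒> λ lo'≤m → ¬In-up (subst In (sym (trans (cong up t≡) (up-cell s m)))
          (In-cell⁺ {suc s} lo'≤m (≤-pred (≤-trans i<hi (Hi.threshold≤suc s)))))

  module _ {s : ℕ} (goesRight : direction s ≡ false) where
    private
      cell-right : ∀ {i} → In (cell s i) → GoesRight (cell s i)
      cell-right q = all-right q (trans (sym (In-off q)) goesRight)

    h-right : ∀ {i} → lo s ≤ i → i < hi (suc s) → h (suc s) i ≡ h s i
    h-right {i} lo≤i i<hi' = headOf-linked q λ {k} x∈ → subst (_∈ θ k) (right-cell q)
        (proj₁ (cell-right q) (subst In (sym (right-cell q)) qy) x∈)
      where
        q = In-cell⁺ {s} lo≤i (≤-trans i<hi' (Hi.threshold-suc≤ s))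
        qy : In (cell (suc s) i)
        qy = In-cell⁺ {suc s} (≤-trans (Lo.threshold-suc≤ s) lo≤i) i<hi'

    -- The cell has no left neighbour in the shape, and its lower neighbour, being of content `s`,
    -- goes right instead of entering it; so a ribbon starts here.
    h-right-start : ∀ {i} → lo (suc s) ≤ i → i < hi (suc s) → i < lo s → h (suc s) i ≡ suc s
    h-right-start {i} lo≤i i<hi' i<lo = trans (headOf-start q left∉ down∉) (off-cell q)
      where
        q = In-cell⁺ {suc s} lo≤i i<hi'
        left∉ : ∀ {k} → cell (suc s) i ∈ θ k → left (cell (suc s) i) ∉ θ k
        left∉ {k} _ l∈ = <⇒≱ i<lo (proj₁ (In-cell⁻ {s} (θ-In {k} (subst (_∈ θ k) (left-cell s i) l∈))))
        down∉ : ∀ {k} → cell (suc s) i ∈ θ k → down (cell (suc s) i) ∉ θ k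
        down∉ {k} y∈ d∈ = right-not-up (cell-right (θ-In {k} d∈')) d∈' (subst (_∈ θ k) (sym (up-cell s i)) y∈)
          where d∈' = subst (_∈ θ k) (down-cell s i) d∈

    right-tail : hi s ≡ suc (hi (suc s)) → lo s < hi s → Σ Idx λ k → IsTail k (cell s (hi (suc s))) × h s (hi (suc s))
        ≡ headOff k
    right-tail e lo<hi with cover (In-cell⁺ {s} (≤-pred (subst (lo s <_) e lo<hi)) (subst (hi (suc s) <_) (sym e) ≤-refl))
    ... | k , x∈ = k , proj₂ (cell-right q) ¬right x∈ , headOf-∈ x∈
      where
        q = θ-In {k} x∈
        ¬right : ¬ In (right (cell s (hi (suc s))))
        ¬right qr = 1+n≰n (proj₂ (In-cell⁻ {suc s} (subst In (right-cell q) qr)))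

    right-tail⁻ : ∀ {k} → tailOff k ≡ s → hi s ≡ suc (hi (suc s)) × lo s < hi s × IsTail k (cell s (hi (suc s)))
    right-tail⁻ {k} refl with In⇒cell (tail-In k)
    ... | i , t≡ , lo≤i , i<hi = ≤-antisym (Hi.threshold≤suc s) (≤-trans (s≤s hi'≤i) i<hi)
                               , ≤-trans (s≤s lo≤i) i<hi
                               , trans t≡ (cong (cell s) (≤-antisym (≤-pred (≤-trans i<hi (Hi.threshold≤suc s))) hi'≤i))
      where
        ¬In-right : ¬ In (right (tailC (θ k)))
        ¬In-right qr = tail-right refl (proj₁ (all-right (tail-In k) goesRight) qr (tail∈ k))
        hi'≤i : hi (suc s) ≤ i
        hi'≤i = ≮⇒≥ λ i<hi' → ¬In-right (subst In (sym (trans (cong right t≡) (right-cell (subst In t≡ (tail-In k)))))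
          (In-cell⁺ {suc s} (≤-trans (Lo.threshold-suc≤ s) lo≤i) i<hi'))

-- The induction along the diagonals

-- In the suffixes of the lemmas below, the first letter tells whether the upper neighbour of the first cell of
-- diagonal s is missing, the second whether the lower neighbour of the last cell of diagonal s + 1 is missing.

module _ {A : Set} {f f' : ℕ → A} where
  private
    snoc : ∀ {g : ℕ → A} {a k} → a ≤ k → map g (interval a k) ++ g k ∷ [] ≡ map g (interval a (suc k))
    snoc {g} {a} {k} a≤k = trans (sym (map-++ g (interval a k) (k ∷ []))) (cong (map g) (sym (interval-snoc a≤k)))

    cons : ∀ {g : ℕ → A} {a k} → a ≤ k → g a ∷ map g (interval (suc a) (suc k)) ≡ map g (interval a (suc k))
    cons {g} a≤k = cong (map g) (sym (interval-cons a≤k))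

  -- Vertical neighbours on consecutive diagonals differ by one row and horizontal ones by none. The
  -- `shifted` family serves the tops in every step and the heads in steps up; the `aligned` family
  -- serves the heads in steps right.
  shifted-ff : ∀ {a' b'} → (∀ {i} → a' ≤ i → suc i < suc b' → f' i ≡ f (suc i))
             → map f (interval (suc a') (suc b')) ≡ map f' (interval a' b')
  shifted-ff {a'} {b'} e = map-interval-suc a' b' (λ a'≤i i<b' → sym (e a'≤i (s≤s i<b')))

  shifted-ft : ∀ {a' k} → a' ≤ k → (∀ {i} → a' ≤ i → suc i < suc k → f' i ≡ f (suc i))
             → map f (interval (suc a') (suc k)) ++ f' k ∷ [] ≡ map f' (interval a' (suc k))
  shifted-ft a'≤k e = trans (cong (_++ _) (shifted-ff e)) (snoc a'≤k)

  shifted-tf : ∀ {a b'} → a ≤ b' → (∀ {i} → a ≤ i → suc i < suc b' → f' i ≡ f (suc i))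
             → map f (interval a (suc b')) ≡ f a ∷ map f' (interval a b')
  shifted-tf a≤b' e = trans (sym (cons a≤b')) (cong (_ ∷_) (shifted-ff e))

  shifted-tt : ∀ {a k} → a ≤ k → (∀ {i} → a ≤ i → suc i < suc k → f' i ≡ f (suc i))
             → map f (interval a (suc k)) ++ f' k ∷ [] ≡ f a ∷ map f' (interval a (suc k))
  shifted-tt a≤k e = trans (cong (_++ _) (shifted-tf a≤k e)) (cong (_ ∷_) (snoc a≤k))

  aligned-tt : ∀ {a b} → (∀ {i} → a ≤ i → i < b → f' i ≡ f i) → map f (interval a b) ≡ map f' (interval a b)
  aligned-tt {a} {b} e = map-interval-cong a b (λ a≤i i<b → sym (e a≤i i<b))

  aligned-tf : ∀ {a b'} → a ≤ b' → (∀ {i} → a ≤ i → i < b' → f' i ≡ f i)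
             → map f (interval a (suc b')) ≡ map f' (interval a b') ++ f b' ∷ []
  aligned-tf a≤b' e = trans (sym (snoc a≤b')) (cong (_++ _) (aligned-tt e))

  aligned-ft : ∀ {a' k} → a' ≤ k → (∀ {i} → suc a' ≤ i → i < suc k → f' i ≡ f i)
             → f' a' ∷ map f (interval (suc a') (suc k)) ≡ map f' (interval a' (suc k))
  aligned-ft a'≤k e = trans (cong (_ ∷_) (aligned-tt e)) (cons a'≤k)

  aligned-ff : ∀ {a' k} → a' ≤ k → (∀ {i} → suc a' ≤ i → i < suc k → f' i ≡ f i)
             → f' a' ∷ map f (interval (suc a') (suc (suc k))) ≡ map f' (interval a' (suc k)) ++ f (suc k) ∷ []
  aligned-ff a'≤k e = trans (cong (_ ∷_) (aligned-tf (s≤s a'≤k) e)) (cong (_++ _) (cons a'≤k))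

zip-snoc : ∀ {A B : Set} (as : List A) (bs : List B) {a b} → length as ≡ length bs
         → zip (as ++ a ∷ []) (bs ++ b ∷ []) ≡ zip as bs ++ (a , b) ∷ []
zip-snoc []       []       _ = refl
zip-snoc (a ∷ as) (b ∷ bs) e = cong (_ ∷_) (zip-snoc as bs (suc-injective e))

map-proj-zip : ∀ {A B : Set} (as : List A) (bs : List B) → length as ≡ length bs
             → map proj₁ (zip as bs) ≡ as × map proj₂ (zip as bs) ≡ bs
map-proj-zip []       []       _ = refl , refl
map-proj-zip (a ∷ as) (b ∷ bs) e with map-proj-zip as bs (suc-injective e)
... | p , q = cong (a ∷_) p , cong (b ∷_) q

module _ {A : Set} (key : A → ℕ) where
  filter-above : ∀ s L → filter (λ a → s <? key a) L ↭ filter (λ a → key a ℕ.≟ suc s) L ++ filter (λ a → suc s <? key a) L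
  filter-above s [] = ↭-refl
  filter-above s (x ∷ L) with <-cmp (key x) (suc s)
  ... | tri< x<  x≢ _
    rewrite filter-reject (λ a → s <? key a) {x} {L} (≤⇒≯ (≤-pred x<))
          | filter-reject (λ a → key a ℕ.≟ suc s) {x} {L} x≢
          | filter-reject (λ a → suc s <? key a) {x} {L} (ℕP.<-asym x<) = filter-above s L
  ... | tri≈ x≮ x≡ _
    rewrite filter-accept (λ a → s <? key a) {x} {L} (≤-reflexive (sym x≡))
          | filter-accept (λ a → key a ℕ.≟ suc s) {x} {L} x≡
          | filter-reject (λ a → suc s <? key a) {x} {L} (λ lt → <⇒≢ lt (sym x≡)) = prep x (filter-above s L)
  ... | tri> _ x≢ >x
    rewrite filter-accept (λ a → s <? key a) {x} {L} (<-trans (ℕP.n<1+n s) >x)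
          | filter-reject (λ a → key a ℕ.≟ suc s) {x} {L} x≢
          | filter-accept (λ a → suc s <? key a) {x} {L} >x
          = ↭-trans (prep x (filter-above s L)) (↭-sym (PermP.shift x (filter (λ a → key a ℕ.≟ suc s) L) _))

  filter-below : ∀ s L → filter (λ a → key a <? suc s) L ↭ filter (λ a → key a <? s) L ++ filter (λ a → key a ℕ.≟ s) L
  filter-below s [] = ↭-refl
  filter-below s (x ∷ L) with <-cmp (key x) s
  ... | tri< x< x≢ _
    rewrite filter-accept (λ a → key a <? suc s) {x} {L} (m≤n⇒m≤1+n x<)
          | filter-accept (λ a → key a <? s) {x} {L} x<
          | filter-reject (λ a → key a ℕ.≟ s) {x} {L} x≢ = prep x (filter-below s L)
  ... | tri≈ x≮ x≡ _
    rewrite filter-accept (λ a → key a <? suc s) {x} {L} (s≤s (≤-reflexive x≡))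
          | filter-reject (λ a → key a <? s) {x} {L} x≮
          | filter-accept (λ a → key a ℕ.≟ s) {x} {L} x≡
          = ↭-trans (prep x (filter-below s L)) (↭-sym (PermP.shift x (filter (λ a → key a <? s) L) _))
  ... | tri> x≮ x≢ >x
    rewrite filter-reject (λ a → key a <? suc s) {x} {L} (λ lt → <⇒≱ >x (≤-pred lt))
          | filter-reject (λ a → key a <? s) {x} {L} x≮
          | filter-reject (λ a → key a ℕ.≟ s) {x} {L} x≢ = filter-below s L

  filter-none : ∀ s L → (∀ {b} → b ∈ L → key b ≢ s) → filter (λ a → key a ℕ.≟ s) L ≡ []
  filter-none s L none = ListP.filter-none (λ a → key a ℕ.≟ s) (All.tabulate none)

  filter-single : ∀ {s a} L → Unique L → a ∈ L → key a ≡ s → (∀ {b} → b ∈ L → key b ≡ s → b ≡ a)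
                → filter (λ a → key a ℕ.≟ s) L ≡ a ∷ []
  filter-single {s} {a} (x ∷ L) (x∉ ∷ uniq) (here refl) ka only =
    trans (filter-accept (λ a → key a ℕ.≟ s) ka)
      (cong (x ∷_) (filter-none s L (λ b∈ kb → All.lookup x∉ b∈ (sym (only (there b∈) kb)))))
  filter-single {s} {a} (x ∷ L) (x∉ ∷ uniq) (there a∈) ka only =
    trans (filter-reject (λ a → key a ℕ.≟ s) (λ kx → All.lookup x∉ a∈ (only (here refl) kx)))
      (filter-single L uniq a∈ ka (only ∘ there))

module Stages {c ℓr} (R : CommutativeRing c ℓr) (la mu : List ℕ) (r : ℤ)
    (la-part : IsPartition la) (mu-part : IsPartition mu) (mu⊆la : mu ⊆ₚ la)
    (Θ : List (List Cell)) (dec : Shape.OuterRibbonDecomp la mu r Θ) (n : ℕ) (la₁≤n : at la 1 ≤ n) where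
  open CommutativeRing R using (Carrier; _≈_; setoid; reflexive) renaming (refl to ≈-refl; sym to ≈-sym; trans to ≈-trans)
  open Determinant R
  open Pivot R
  open RibbonMatrix R
  open Diagonals la mu r la-part mu-part mu⊆la
  open Decomposition la mu r la-part mu-part mu⊆la Θ dec

  nonEmpty? : ∀ j → Dec (NonEmpty j)
  nonEmpty? j = (1 ≤? j) ×-dec (conj mu j <? conj la j)

  columns : List ℕ
  columns = filter nonEmpty? (map suc (upTo n))

  private
    ribbons : List Idx
    ribbons = allFin (length Θ)

    columns-unique : Unique columns
    columns-unique = UniqueP.filter⁺ nonEmpty? (UniqueP.map⁺ suc-injective (UniqueP.upTo⁺ n))

    ∈columns⁻ : ∀ {j} → j ∈ columns → NonEmpty j
    ∈columns⁻ j∈ = proj₂ (∈-filter⁻ nonEmpty? {xs = map suc (upTo n)} j∈)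

    ∈columns⁺ : ∀ {i j} → In (i , j) → j ∈ columns
    ∈columns⁺ {i} {suc j} q@(1≤i , _ , j≤λ) = ∈-filter⁺ nonEmpty?
      (∈-map⁺ suc (∈-upTo⁺ (≤-trans j≤λ (≤-trans (at-anti la la-part ≤-refl 1≤i) la₁≤n))))
      (s≤s z≤n , ≤-trans (proj₁ (In⇒conj q)) (proj₂ (In⇒conj q)))
    ∈columns⁺ {i} {zero} (_ , () , _)

  ribbonPair : Idx → ℕ × ℕ
  ribbonPair k = headOff k , suc (tailOff k)

  columnPair : ℕ → ℕ × ℕ
  columnPair j = botOff j , topOff j

  closed : ℕ → List Idx
  closed s = filter (λ k → tailOff k <? s) ribbons

  later : ℕ → List ℕ
  later s = filter (λ j → s <? botOff j) columns

  heads tops : ℕ → List ℕ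
  heads s = map (h s) (interval (lo s) (hi s))
  tops s  = map (v s) (interval (lo s) (hi s))

  opened : ℕ → List (ℕ × ℕ)
  opened s = zip (heads s) (tops s)

  -- Ribbons followed up to the diagonal s, and columns above it.
  state : ℕ → List (ℕ × ℕ)
  state s = map ribbonPair (closed s) ++ opened s ++ map columnPair (later s)

  private
    ending : ℕ → List Idx
    ending s = filter (λ k → tailOff k ℕ.≟ s) ribbons

    starting : ℕ → List ℕ
    starting s = filter (λ j → botOff j ℕ.≟ suc s) columns

    -- The pieces that the step at content `s` does not involve: ribbons that ended before `s` and
    -- columns that begin after `s + 1`.
    others : ℕ → List (ℕ × ℕ)
    others s = map ribbonPair (closed s) ++ map columnPair (later (suc s))

    before-↭ : ∀ s → state s ↭ (opened s ++ map columnPair (starting s)) ++ others s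
    before-↭ s = ↭-trans (PermP.++⁺ˡ CL
        (PermP.++⁺ˡ Z (↭-trans (PermP.map⁺ columnPair (filter-above botOff s columns))
        (↭-reflexive (map-++ columnPair (starting s) (later (suc s)))))))
      (↭-trans (↭-reflexive (cong (CL ++_) (sym (++-assoc Z (map columnPair (starting s)) LA))))
          (PermP.shifts CL (Z ++ map columnPair (starting s))))
      where
        CL = map ribbonPair (closed s)
        Z = opened s
        LA = map columnPair (later (suc s))

    after-↭ : ∀ s → state (suc s) ↭ (opened (suc s) ++ map ribbonPair (ending s)) ++ others s
    after-↭ s = ↭-trans (PermP.++⁺ʳ (Z ++ LA)
        (↭-trans (PermP.map⁺ ribbonPair (filter-below tailOff s ribbons))
        (↭-reflexive (map-++ ribbonPair (closed s) (ending s)))))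
      (↭-trans (↭-reflexive (++-assoc CL E (Z ++ LA)))
        (↭-trans (PermP.++⁺ˡ CL (↭-trans (PermP.shifts E Z) (↭-reflexive (sym (++-assoc Z E LA)))))
          (PermP.shifts CL (Z ++ E))))
      where
        CL = map ribbonPair (closed s)
        E = map ribbonPair (ending s)
        Z = opened (suc s)
        LA = map columnPair (later (suc s))

    -- A column with its bottom on diagonal `s + 1` can only do so at the closing cell of that
    -- diagonal, so there is just one.
    starting-one : ∀ {s k} → hi s ≡ suc k → hi (suc s) ≡ suc k → lo (suc s) ≤ k
                 → map columnPair (starting s) ≡ (suc s , v (suc s) k) ∷ []
    starting-one {s} {k} e e' lo≤k = trans (cong (map columnPair)
        (filter-single botOff columns columns-unique
            (∈columns⁺ {k} (In-cell⁺ {suc s} lo≤k (subst (k <_) (sym e') ≤-refl))) (botOff-cell e e' lo≤k) only))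
      (cong (λ b → (b , v (suc s) k) ∷ []) (botOff-cell e e' lo≤k))
      where
        only : ∀ {j} → j ∈ columns → botOff j ≡ suc s → j ≡ col (cell (suc s) k)
        only j∈ eq with botOff-suc (∈columns⁻ j∈) eq
        ... | k' , e₁ , _ , _ , j≡ = trans j≡ (cong (λ k → col (cell (suc s) k)) (suc-injective (trans (sym e₁) e)))

    starting-none : ∀ {s} → (∀ {k} → hi s ≡ suc k → hi (suc s) ≡ suc k → lo (suc s) ≤ k → ⊥) → starting s ≡ []
    starting-none {s} no-k = filter-none botOff (suc s) columns λ j∈ eq →
      let k , e₁ , e₂ , lo≤k , _ = botOff-suc (∈columns⁻ j∈) eq in no-k e₁ e₂ lo≤k

    ending-one : ∀ {s x k} → In x → off x ≡ s → IsTail k x → (∀ {k'} → tailOff k' ≡ s → IsTail k' x)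
               → map ribbonPair (ending s) ≡ (headOff k , suc s) ∷ []
    ending-one {s} {x} {k} q e t only = trans (cong (map ribbonPair)
        (filter-single tailOff ribbons (UniqueP.allFin⁺ (length Θ)) (∈-allFin k) tk
            (λ {k'} _ tk' → tail-injective (only tk') t)))
      (cong (λ o → (headOff k , suc o) ∷ []) tk)
      where tk = trans (cong off t) e

    ending-none : ∀ {s} → (∀ {k} → tailOff k ≢ s) → ending s ≡ []
    ending-none none = filter-none tailOff _ ribbons (λ _ → none)

    -- With `c = s + 1`: `e` says that a column has its top on diagonal `s`, so `c` is a column
    -- label; `σ` says that a column has its bottom on diagonal `s + 1`, so `c` is a row label. In a
    -- step right their negations say that a ribbon starts on diagonal `s + 1` and that one ends on
    -- diagonal `s`. The tops occur only with index `suc s` because vertical neighbours share a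
    -- column.
    record Exchange (s : ℕ) : Set where
      field
        e σ        : Bool
        lengths    : length (heads s ++ opt σ (suc s)) ≡ length (opt e (suc s) ++ tops (suc s))
        before     : opened s ++ map columnPair (starting s) ≡ zip (heads s ++ opt σ (suc s)) (opt e (suc s) ++ tops (suc s))
        goes-up    : direction s ≡ true → zip (heads s ++ opt σ (suc s)) (opt e (suc s) ++ tops (suc s))
                       ≡ map ribbonPair (ending s) ++ opened (suc s)
        goes-right : direction s ≡ false → zip (opt (not e) (suc s) ++ heads s) (tops (suc s) ++ opt (not σ) (suc s))
                       ≡ opened (suc s) ++ map ribbonPair (ending s)

    heads-tops : ∀ s → length (heads s) ≡ length (tops s)
    heads-tops s = trans (length-map (h s) (interval (lo s) (hi s))) (sym (length-map (v s) (interval (lo s) (hi s))))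

    Before : ℕ → Bool → Bool → Set
    Before s e σ = length (heads s ++ opt σ (suc s)) ≡ length (opt e (suc s) ++ tops (suc s))
      × opened s ++ map columnPair (starting s) ≡ zip (heads s ++ opt σ (suc s)) (opt e (suc s) ++ tops (suc s))

    before-start : ∀ {s x} e → tops s ++ x ∷ [] ≡ opt e (suc s) ++ tops (suc s) → map columnPair (starting s) ≡
        (suc s , x) ∷ [] → Before s e true
    before-start {s} {x} e tops≡ start≡ =
      trans (length-++ (heads s)) (trans (cong (_+ 1) (heads-tops s))
          (trans (sym (length-++ (tops s))) (cong length tops≡))) ,
      trans (cong (opened s ++_) start≡)
          (trans (sym (zip-snoc (heads s) (tops s) (heads-tops s))) (cong (zip (heads s ++ suc s ∷ [])) tops≡))

    before-none : ∀ {s} e → tops s ≡ opt e (suc s) ++ tops (suc s) → starting s ≡ [] → Before s e false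
    before-none {s} e tops≡ start≡ =
      trans (cong length (++-identityʳ (heads s))) (trans (heads-tops s) (cong length tops≡)) ,
      trans (cong (λ l → opened s ++ map columnPair l) start≡)
        (trans (++-identityʳ _) (cong₂ zip (sym (++-identityʳ (heads s))) tops≡))

    ending-up : ∀ {s} → direction s ≡ true → lo s ≡ lo (suc s) → lo s < hi s → map ribbonPair (ending s) ≡
        (h s (lo s) , suc s) ∷ []
    ending-up {s} d el lo<hi with up-tail d el lo<hi
    ... | k , t , h≡ = trans (ending-one q (off-cell q) t (λ tk → proj₂ (proj₂ (up-tail⁻ d tk))))
        (cong (λ x → (x , suc s) ∷ []) (sym h≡))
      where q = In-cell⁺ {s} ≤-refl lo<hi

    ending-up-none : ∀ {s} → direction s ≡ true → lo s ≢ lo (suc s) → ending s ≡ []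
    ending-up-none d ¬el = ending-none (λ tk → ¬el (proj₁ (up-tail⁻ d tk)))

    ending-right : ∀ {s} → direction s ≡ false → hi s ≡ suc (hi (suc s)) → lo s < hi s → map ribbonPair (ending s) ≡
        (h s (hi (suc s)) , suc s) ∷ []
    ending-right {s} d eh lo<hi with right-tail d eh lo<hi
    ... | k , t , h≡ = trans (ending-one q (off-cell q) t (λ tk → proj₂ (proj₂ (right-tail⁻ d tk))))
        (cong (λ x → (x , suc s) ∷ []) (sym h≡))
      where q = In-cell⁺ {s} (≤-pred (subst (lo s <_) eh lo<hi)) (subst (hi (suc s) <_) (sym eh) ≤-refl)

    ending-right-none : ∀ {s} → direction s ≡ false → hi s ≢ suc (hi (suc s)) → ending s ≡ []
    ending-right-none d ¬eh = ending-none (λ tk → ¬eh (proj₁ (right-tail⁻ d tk)))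

    on-interval : (f : ℕ → ℕ) → ∀ {a b a' b'} → a ≡ a' → b ≡ b' → map f (interval a b) ≡ map f (interval a' b')
    on-interval f = cong₂ (λ a b → map f (interval a b))

    exchange-tt : ∀ s k → lo s ≡ lo (suc s) → hi s ≡ suc k → hi (suc s) ≡ suc k → lo s ≤ k → Exchange s
    exchange-tt s k el ek ek' lo≤k = record
      { e = true ; σ = true ; lengths = proj₁ bf ; before = proj₂ bf
      ; goes-up = λ d → trans (cong₂ (λ l l' → zip l (suc s ∷ l')) (heads-up d) refl)
          (cong (_++ opened (suc s)) (sym (ending-up d el lo<hi)))
      ; goes-right = λ d → trans (cong₂ zip (heads-right d) (++-identityʳ (tops (suc s))))
          (sym (trans (cong (λ l → opened (suc s) ++ map ribbonPair l)
              (ending-right-none d λ eh → 1+n≢n (sym (trans (trans ek' (sym ek)) eh)))) (++-identityʳ _)))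
      }
      where
        lo<hi = subst (lo s <_) (sym ek) (s≤s lo≤k)
        bf : Before s true true
        bf = before-start true (trans (cong (_++ v (suc s) k ∷ []) (on-interval (v s) {a = lo s} refl ek))
            (trans (shifted-tt {f = v s} {f' = v (suc s)} lo≤k (λ {i} _ _ → sym (v-up s i)))
                (cong₂ _∷_ (topOff-cell el lo<hi) (on-interval (v (suc s)) el (sym ek')))))
          (starting-one ek ek' (subst (_≤ k) el lo≤k))
        heads-up : direction s ≡ true → heads s ++ suc s ∷ [] ≡ h s (lo s) ∷ heads (suc s)
        heads-up d = trans (cong₂ (λ l x → l ++ x ∷ []) (on-interval (h s) refl ek)
            -- The cell where the new column begins is also the head of a ribbon, so the label
            -- `suc s` is already the next entry of `heads (suc s)`.
            (sym (h-up-start d (subst (_≤ k) el lo≤k) (≤-reflexive (sym ek')) (≤-reflexive ek))))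
          (trans (shifted-tt {f = h s} {f' =
              h (suc s)} lo≤k (λ {i} lo≤i i<k → h-up d (subst (_≤ i) el lo≤i) (subst (suc i <_) (sym ek) i<k)))
            (cong (_ ∷_) (on-interval (h (suc s)) el (sym ek'))))
        heads-right : direction s ≡ false → heads s ≡ heads (suc s)
        heads-right d = trans (aligned-tt {f = h s} {f' =
            h (suc s)} (λ {i} lo≤i i<hi → h-right d lo≤i (subst (i <_) (trans ek (sym ek')) i<hi)))
          (on-interval (h (suc s)) el (trans ek (sym ek')))

    exchange-tf : ∀ s → lo s ≡ lo (suc s) → hi s ≡ suc (hi (suc s)) → Exchange s
    exchange-tf s el eh = record
      { e = true ; σ = false ; lengths = proj₁ bf ; before = proj₂ bf
      ; goes-up = λ d → trans (cong (λ l → zip l (suc s ∷ tops (suc s)))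
          (trans (++-identityʳ (heads s)) (heads-up d))) (cong (_++ opened (suc s)) (sym (ending-up d el lo<hi)))
      ; goes-right = λ d → trans (cong (λ l → zip l (tops (suc s) ++ suc s ∷ [])) (heads-right d))
          (trans (zip-snoc (heads (suc s)) (tops (suc s)) (heads-tops (suc s)))
              (cong (opened (suc s) ++_) (sym (ending-right d eh lo<hi))))
      }
      where
        lo≤hi' : lo s ≤ hi (suc s)
        lo≤hi' = subst (_≤ hi (suc s)) (sym el) (lo≤hi (suc s))
        lo<hi = subst (lo s <_) (sym eh) (s≤s lo≤hi')
        bf : Before s true false
        bf = before-none true (trans (on-interval (v s) refl eh)
            (trans (shifted-tf {f = v s} {f' = v (suc s)} lo≤hi' (λ {i} _ _ → sym (v-up s i)))
                (cong₂ _∷_ (topOff-cell el lo<hi) (on-interval (v (suc s)) {b = hi (suc s)} el refl))))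
          (starting-none λ e₁ e₂ _ → 1+n≢n (trans (sym eh) (trans e₁ (sym e₂))))
        heads-up : direction s ≡ true → heads s ≡ h s (lo s) ∷ heads (suc s)
        heads-up d = trans (on-interval (h s) refl eh)
          (trans (shifted-tf {f = h s} {f' =
              h (suc s)} lo≤hi' (λ {i} lo≤i i<k → h-up d (subst (_≤ i) el lo≤i) (subst (suc i <_) (sym eh) i<k)))
            (cong (h s (lo s) ∷_) (on-interval (h (suc s)) {b = hi (suc s)} el refl)))
        heads-right : direction s ≡ false → heads s ≡ heads (suc s) ++ h s (hi (suc s)) ∷ []
        heads-right d = trans (on-interval (h s) refl eh)
          (trans (aligned-tf {f = h s} {f' = h (suc s)} lo≤hi' (λ lo≤i i<hi' → h-right d lo≤i i<hi'))
            (cong (_++ h s (hi (suc s)) ∷ []) (on-interval (h (suc s)) {b = hi (suc s)} el refl)))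

    exchange-ft : ∀ s k → lo s ≡ suc (lo (suc s)) → hi s ≡ suc k → hi (suc s) ≡ suc k → lo (suc s) ≤ k → Exchange s
    exchange-ft s k el ek ek' lo'≤k = record
      { e = false ; σ = true ; lengths = proj₁ bf ; before = proj₂ bf
      ; goes-up = λ d → trans (cong (λ l → zip l (tops (suc s))) (heads-up d))
          (cong (λ l → map ribbonPair l ++ opened (suc s)) (sym (ending-up-none d λ el' → 1+n≢n (trans (sym el) el'))))
      ; goes-right = λ d → trans (cong₂ zip (heads-right d) (++-identityʳ (tops (suc s))))
          (sym (trans (cong (λ l → opened (suc s) ++ map ribbonPair l)
              (ending-right-none d λ eh → 1+n≢n (sym (trans (trans ek' (sym ek)) eh)))) (++-identityʳ _)))
      }
      where
        bf : Before s false true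
        bf = before-start false (trans (cong (_++ v (suc s) k ∷ []) (on-interval (v s) el ek))
            (trans (shifted-ft {f = v s} {f' = v (suc s)} lo'≤k (λ {i} _ _ → sym (v-up s i)))
                (on-interval (v (suc s)) refl (sym ek'))))
          (starting-one ek ek' lo'≤k)
        heads-up : direction s ≡ true → heads s ++ suc s ∷ [] ≡ heads (suc s)
        heads-up d = trans (cong₂ (λ l x → l ++ x ∷ []) (on-interval (h s) el ek)
            (sym (h-up-start d lo'≤k (≤-reflexive (sym ek')) (≤-reflexive ek))))
          (trans (shifted-ft {f = h s} {f' = h (suc s)} lo'≤k (λ {i} lo≤i i<k → h-up d lo≤i (subst (suc i <_) (sym ek) i<k)))
            (on-interval (h (suc s)) refl (sym ek')))
        heads-right : direction s ≡ false → suc s ∷ heads s ≡ heads (suc s)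
        heads-right d = trans (cong₂ _∷_
            (sym (h-right-start d ≤-refl (subst (lo (suc s) <_) (sym ek') (s≤s lo'≤k)) (≤-reflexive (sym el))))
            (on-interval (h s) el ek))
          (trans (aligned-ft {f = h s} {f' =
              h (suc s)} lo'≤k (λ {i} lo≤i i<k → h-right d (subst (_≤ i) (sym el) lo≤i) (subst (i <_) (sym ek') i<k)))
            (on-interval (h (suc s)) refl (sym ek')))

    exchange-ff : ∀ s k → lo s ≡ suc (lo (suc s)) → hi s ≡ suc (hi (suc s)) → hi (suc s) ≡ suc k → lo (suc s) ≤ k →
        Exchange s
    exchange-ff s k el eh ek' lo'≤k = record
      { e = false ; σ = false ; lengths = proj₁ bf ; before = proj₂ bf
      ; goes-up = λ d → trans (cong (λ l → zip l (tops (suc s))) (trans (++-identityʳ (heads s)) (heads-up d)))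
          (cong (λ l → map ribbonPair l ++ opened (suc s)) (sym (ending-up-none d λ el' → 1+n≢n (trans (sym el) el'))))
      ; goes-right = λ d → trans (cong (λ l → zip l (tops (suc s) ++ suc s ∷ [])) (heads-right d))
          (trans (zip-snoc (heads (suc s)) (tops (suc s)) (heads-tops (suc s)))
              (cong (opened (suc s) ++_) (sym (ending-right d eh lo<hi))))
      }
      where
        lo<hi : lo s < hi s
        lo<hi = ≤-trans (s≤s (≤-reflexive el)) (≤-trans (s≤s (s≤s lo'≤k)) (≤-reflexive (sym (trans eh (cong suc ek')))))
        bf : Before s false false
        bf = before-none false (trans (on-interval (v s) el eh) (shifted-ff {f = v s} {f' =
            v (suc s)} {lo (suc s)} {hi (suc s)} (λ {i} _ _ → sym (v-up s i))))
          (starting-none λ e₁ e₂ _ → 1+n≢n (trans (sym eh) (trans e₁ (sym e₂))))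
        heads-up : direction s ≡ true → heads s ≡ heads (suc s)
        heads-up d = trans (on-interval (h s) el eh) (shifted-ff {f = h s} {f' =
            h (suc s)} (λ {i} lo≤i i<k → h-up d lo≤i (subst (suc i <_) (sym eh) i<k)))
        heads-right : direction s ≡ false → suc s ∷ heads s ≡ heads (suc s) ++ h s (hi (suc s)) ∷ []
        heads-right d = trans (cong₂ _∷_
            (sym (h-right-start d ≤-refl (subst (lo (suc s) <_) (sym ek') (s≤s lo'≤k)) (≤-reflexive (sym el))))
            (on-interval (h s) el (trans eh (cong suc ek'))))
          (trans (aligned-ff {f = h s} {f' =
              h (suc s)} lo'≤k (λ {i} lo≤i i<k → h-right d (subst (_≤ i) (sym el) lo≤i) (subst (i <_) (sym ek') i<k)))
            (cong₂ (λ l x → l ++ h s x ∷ []) (on-interval (h (suc s)) refl (sym ek')) (sym ek')))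

    -- Equal thresholds signal the end of a column only when there is a cell on the diagonal. A cell
    -- on either diagonal is enough to supply the cell that each of the four cases refers to.
    exchange : ∀ s → lo s < hi s ⊎ lo (suc s) < hi (suc s) → Exchange s
    exchange s ne with Lo.threshold-step s | Hi.threshold-step s
    ... | inj₁ el | inj₁ eh = exchange-tt s (hi s ∸ 1) el
        (Hi.threshold≡suc s) (trans (sym eh) (Hi.threshold≡suc s))
            (≤-pred (subst (lo s <_) (Hi.threshold≡suc s) (nonempty ne)))
      where
        nonempty : lo s < hi s ⊎ lo (suc s) < hi (suc s) → lo s < hi s
        nonempty (inj₁ q) = q
        nonempty (inj₂ q) = subst (_≤ hi s) (cong suc (sym el)) (subst (lo (suc s) <_) (sym eh) q)
    ... | inj₁ el | inj₂ eh = exchange-tf s el eh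
    ... | inj₂ el | inj₁ eh = exchange-ft s (hi s ∸ 1) el
        (Hi.threshold≡suc s) (trans (sym eh) (Hi.threshold≡suc s))
            (≤-pred (subst (lo (suc s) <_) (Hi.threshold≡suc s) (subst (_≤ hi s) el (lo≤hi s))))
    ... | inj₂ el | inj₂ eh = exchange-ff s (hi (suc s) ∸ 1) el eh
        (Hi.threshold≡suc (suc s)) (≤-pred (subst (lo (suc s) <_) (Hi.threshold≡suc (suc s)) (nonempty ne)))
      where
        nonempty : lo s < hi s ⊎ lo (suc s) < hi (suc s) → lo (suc s) < hi (suc s)
        nonempty (inj₂ q) = q
        nonempty (inj₁ q) = ≤-pred (subst (_≤ suc (hi (suc s))) (cong suc el) (subst (lo s <_) eh q))

    diagonals-empty : ∀ {s} → ¬ (lo s < hi s) → interval (lo s) (hi s) ≡ []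
    diagonals-empty {s} ¬lt = trans (cong (interval (lo s)) (≤-antisym (≮⇒≥ ¬lt) (lo≤hi s))) (interval-empty (lo s))

    heads-empty : ∀ {s} → ¬ (lo s < hi s) → opened s ≡ []
    heads-empty {s} ¬lt = cong (λ l → zip (map (h s) l) (map (v s) l)) (diagonals-empty ¬lt)

    -- Together with `later-above` this puts the remaining pieces on one side of the pivot `suc s`,
    -- as `SameSide` demands.
    closed-below : ∀ s → All (λ (p , v) → p < suc s × v < suc s) (map ribbonPair (closed s))
    closed-below s = AllP.map⁺ (All.map (λ {k} t<s → s≤s (≤-trans (headOff≤tailOff k) (<⇒≤ t<s)) , s≤s t<s)
        (AllP.all-filter (λ k → tailOff k <? s) ribbons))

    later-above : ∀ s → All (λ (p , v) → suc s < p × suc s < v) (map columnPair (later (suc s)))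
    later-above s = AllP.map⁺ (All.tabulate λ j∈ →
      let j∈columns , s<b = ∈-filter⁻ (λ j → suc s <? botOff j) {xs = columns} j∈ in
      s<b , <-trans s<b (off<topOff (bottom-In (∈columns⁻ j∈columns))))

    heads-below : ∀ s → All (_< suc s) (heads s)
    heads-below s = AllP.map⁺ (All.tabulate λ i∈ →
      let lo≤i , i<hi = ∈-interval⁻ i∈ ; q = In-cell⁺ {s} lo≤i i<hi in s≤s (≤-trans (headOf≤ q) (≤-reflexive (off-cell q))))

    tops-above : ∀ s → All (s <_) (tops s)
    tops-above s = AllP.map⁺ (All.tabulate λ i∈ →
      let lo≤i , i<hi = ∈-interval⁻ i∈ ; q = In-cell⁺ {s} lo≤i i<hi in ≤-trans (s≤s (≤-reflexive (sym (off-cell q)))) (off<topOff q))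

    swapped-lengths : ∀ e σ c (as bs : List ℕ) → length (as ++ opt σ c) ≡ length (opt e c ++ bs) → length
        (opt (not e) c ++ as) ≡ length (bs ++ opt (not σ) c)
    swapped-lengths false false c as bs eq =
        trans (cong suc (trans (cong length (sym (++-identityʳ as))) eq))
        (sym (trans (length-++ bs) (ℕP.+-comm (length bs) 1)))
    swapped-lengths false true  c as bs eq =
        trans (trans (ℕP.+-comm 1 (length as)) (sym (length-++ as))) (trans eq (cong length (sym (++-identityʳ bs))))
    swapped-lengths true  false c as bs eq =
        trans (trans (cong length (sym (++-identityʳ as))) eq) (sym (trans (length-++ bs) (ℕP.+-comm (length bs) 1)))
    swapped-lengths true  true  c as bs eq =
        trans (suc-injective (trans (trans (ℕP.+-comm 1 (length as)) (sym (length-++ as))) eq))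
        (cong length (sym (++-identityʳ bs)))

    DetPairs-zip : ∀ M (as bs : List ℕ) O → length as ≡ length bs → DetPairs M (zip as bs ++ O) ≡ Det M
        (as ++ map proj₁ O) (bs ++ map proj₂ O)
    DetPairs-zip M as bs O eq = cong₂ (Det M)
      (trans (map-++ proj₁ (zip as bs) O) (cong (_++ map proj₁ O) (proj₁ (map-proj-zip as bs eq))))
      (trans (map-++ proj₂ (zip as bs) O) (cong (_++ map proj₂ O) (proj₂ (map-proj-zip as bs eq))))

    true-or-false : ∀ b → b ≡ true ⊎ b ≡ false
    true-or-false true  = inj₁ refl
    true-or-false false = inj₂ refl

    module _ (M : ℕ → ℕ → Carrier) (upper : UpperUnitriangular M) (s : ℕ) where
      open Relation.Binary.Reasoning.Setoid setoid

      private
        O = others s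
        Z' = opened (suc s)
        E = map ribbonPair (ending s)

      exchange-up : Exchange s → direction s ≡ true → DetPairs M (state s) ≈ DetPairs M (state (suc s))
      exchange-up ex d = begin
        DetPairs M (state s) ≈⟨ DetPairs-↭ M (before-↭ s) ⟩
        DetPairs M ((opened s ++ map columnPair (starting s)) ++ O) ≡⟨ cong (λ l → DetPairs M (l ++ O))
            (trans (Exchange.before ex) (Exchange.goes-up ex d)) ⟩
        DetPairs M ((E ++ Z') ++ O) ≈⟨ DetPairs-↭ M (PermP.++⁺ʳ O (PermP.++-comm E Z')) ⟩
        DetPairs M ((Z' ++ E) ++ O) ≈⟨ DetPairs-↭ M (after-↭ s) ⟨
        DetPairs M (state (suc s)) ∎

      exchange-right : Exchange s → direction s ≡ false → DetPairs M (state s) ≈ DetPairs (pivot (suc s) M) (state (suc s))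
      exchange-right ex d = begin
        DetPairs M (state s) ≈⟨ DetPairs-↭ M (before-↭ s) ⟩
        DetPairs M ((opened s ++ map columnPair (starting s)) ++ O) ≡⟨ cong (λ l → DetPairs M (l ++ O))
            (Exchange.before ex) ⟩
        DetPairs M (zip (heads s ++ opt σ (suc s)) (opt e (suc s) ++ tops (suc s)) ++ O) ≡⟨ DetPairs-zip M
            (heads s ++ opt σ (suc s)) (opt e (suc s) ++ tops (suc s)) O (Exchange.lengths ex) ⟩
        Det M ((heads s ++ opt σ (suc s)) ++ map proj₁ O) ((opt e (suc s) ++ tops (suc s)) ++ map proj₂ O)
          ≈⟨ Det-pivot (suc s) M upper (heads s) (tops (suc s)) O (heads-below s) (tops-above (suc s))
               (AllP.++⁺ (All.map inj₁ (closed-below s)) (All.map inj₂ (later-above s))) e σ (Exchange.lengths ex) ⟩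
        Det M' ((opt (not e) (suc s) ++ heads s) ++ map proj₁ O) ((tops (suc s) ++ opt (not σ) (suc s)) ++ map proj₂ O)
          ≡⟨ DetPairs-zip M' (opt (not e) (suc s) ++ heads s) (tops (suc s) ++ opt (not σ) (suc s)) O
              (swapped-lengths e σ (suc s) (heads s) (tops (suc s)) (Exchange.lengths ex)) ⟨
        DetPairs M' (zip (opt (not e) (suc s) ++ heads s) (tops (suc s) ++ opt (not σ) (suc s)) ++ O) ≡⟨ cong
            (λ l → DetPairs M' (l ++ O)) (Exchange.goes-right ex d) ⟩
        DetPairs M' ((Z' ++ E) ++ O) ≈⟨ DetPairs-↭ M' (after-↭ s) ⟨
        DetPairs M' (state (suc s)) ∎
        where
          open Exchange ex using (e; σ)
          M' = pivot (suc s) M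

      module _ (¬lt : ¬ (lo s < hi s)) (¬lt' : ¬ (lo (suc s) < hi (suc s))) where
        private
          starting-empty : starting s ≡ []
          starting-empty = starting-none λ _ e₂ lo≤k → ¬lt' (subst (lo (suc s) <_) (sym e₂) (s≤s lo≤k))

          ending-empty : ending s ≡ []
          ending-empty with true-or-false (direction s)
          ... | inj₁ d = ending-none λ tk → ¬lt (proj₁ (proj₂ (up-tail⁻ d tk)))
          ... | inj₂ d = ending-none λ tk → ¬lt (proj₁ (proj₂ (right-tail⁻ d tk)))

        empty-before : ∀ M → DetPairs M (state s) ≈ DetPairs M O
        empty-before M = ≈-trans (DetPairs-↭ M (before-↭ s))
            (reflexive (cong₂ (λ z l → DetPairs M ((z ++ map columnPair l) ++ O)) (heads-empty ¬lt) starting-empty))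

        empty-after : ∀ M → DetPairs M (state (suc s)) ≈ DetPairs M O
        empty-after M = ≈-trans (DetPairs-↭ M (after-↭ s))
            (reflexive (cong₂ (λ z l → DetPairs M ((z ++ map ribbonPair l) ++ O)) (heads-empty ¬lt') ending-empty))

      state-step-up : direction s ≡ true → DetPairs M (state s) ≈ DetPairs M (state (suc s))
      state-step-up d with lo s <? hi s | lo (suc s) <? hi (suc s)
      ... | yes lt | _       = exchange-up (exchange s (inj₁ lt)) d
      ... | no _   | yes lt' = exchange-up (exchange s (inj₂ lt')) d
      ... | no ¬lt | no ¬lt' = ≈-trans (empty-before ¬lt ¬lt' M) (≈-sym (empty-after ¬lt ¬lt' M))

      state-step-right : direction s ≡ false → DetPairs M (state s) ≈ DetPairs (pivot (suc s) M) (state (suc s))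
      state-step-right d with lo s <? hi s | lo (suc s) <? hi (suc s)
      ... | yes lt | _       = exchange-right (exchange s (inj₁ lt)) d
      ... | no _   | yes lt' = exchange-right (exchange s (inj₂ lt')) d
      ... | no ¬lt | no ¬lt' = ≈-trans (empty-before ¬lt ¬lt' M)
        -- No piece crosses here, yet the matrix still changes; the block triangular form of the
        -- minor absorbs the pivot.
        (≈-trans (DetPairs-pivot-split (suc s) M upper (map ribbonPair (closed s)) (map columnPair (later (suc s)))
            (closed-below s) (later-above s))
                 (≈-sym (empty-after ¬lt ¬lt' (pivot (suc s) M))))

  module _ (X : ℕ → ℕ → Carrier) (X-upper : UpperUnitriangular X) where
    stages-agree : ∀ s → DetPairs X (state 0) ≈ DetPairs (stage X direction s) (state s)
    stages-agree zero    = ≈-refl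
    stages-agree (suc s) = ≈-trans (stages-agree s) next
      where
        upper = stage-unitriangular direction X-upper s
        next : DetPairs (stage X direction s) (state s) ≈ DetPairs (stage X direction (suc s)) (state (suc s))
        next with true-or-false (direction s)
        ... | inj₁ d = ≈-trans (state-step-up _ upper s d)
          (reflexive (cong (λ M → DetPairs M (state (suc s))) (sym (stage-up X direction s d))))
        ... | inj₂ d = ≈-trans (state-step-right _ upper s d)
          (reflexive (cong (λ M → DetPairs M (state (suc s))) (sym (stage-right X direction s d))))

    abstract
      -- A bound beyond all offsets: a column is at most `at la 1`, and `ℓ ∸ i` is at most `ℓ`.
      maxOff : ℕ
      maxOff = suc (at la 1 + ℓ)

      off<maxOff : ∀ {x} → In x → off x < maxOff
      off<maxOff {i , j} (1≤i , _ , j≤λ) = s≤s (ℕP.+-mono-≤ (≤-trans j≤λ (at-anti la la-part ≤-refl 1≤i)) (ℕP.m∸n≤m ℓ i))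

    private
      -- Columns are numbered from 1, so every offset in the shape is positive: nothing is closed or
      -- open at 0, and all columns are still to come.
      state-first : state 0 ≡ map columnPair columns
      state-first = trans (cong₂ _++_
          (cong (map ribbonPair) (ListP.filter-none (λ k → tailOff k <? 0) {ribbons} (All.tabulate (λ _ ()))))
          (cong₂ _++_ (heads-empty {0} ¬lt)
              (cong (map columnPair) (ListP.filter-all (λ j → 0 <? botOff j) (All.tabulate positive))))) refl
        where
          ¬lt : ¬ (lo 0 < hi 0)
          ¬lt lt = <⇒≱ (In⇒1≤col q) (≤-trans (m≤m+n _ _) (≤-reflexive (off-cell q)))
            where q = In-cell⁺ {0} ≤-refl lt
          positive : ∀ {j} → j ∈ columns → 0 < botOff j
          positive j∈ = ≤-trans (proj₁ (∈columns⁻ j∈)) (m≤m+n _ _)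

      state-last : state maxOff ≡ map ribbonPair (allFin (length Θ))
      state-last = trans (cong₂ _++_ (cong (map ribbonPair)
          (ListP.filter-all (λ k → tailOff k <? maxOff) (All.tabulate (λ {k} _ → off<maxOff (tail-In k)))))
          (cong₂ _++_ (heads-empty {maxOff} ¬lt)
              (cong (map columnPair) (ListP.filter-none (λ j → maxOff <? botOff j) {columns}
              (All.tabulate (λ j∈ → ℕP.<-asym (off<maxOff (bottom-In (∈columns⁻ j∈)))))))))
          (++-identityʳ _)
        where
          ¬lt : ¬ (lo maxOff < hi maxOff)
          ¬lt lt = <⇒≢ (off<maxOff q) (off-cell q)
            where q = In-cell⁺ {maxOff} ≤-refl lt

    columns≈ribbons : DetPairs X (map columnPair columns) ≈ DetPairs (stage X direction maxOff)
        (map ribbonPair (allFin (length Θ)))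
    columns≈ribbons = begin
      DetPairs X (map columnPair columns) ≡⟨ cong (DetPairs X) state-first ⟨
      DetPairs X (state 0) ≈⟨ stages-agree maxOff ⟩
      DetPairs (stage X direction maxOff) (state maxOff) ≡⟨ cong (DetPairs (stage X direction maxOff)) state-last ⟩
      DetPairs (stage X direction maxOff) (map ribbonPair (allFin (length Θ))) ∎
      where open Relation.Binary.Reasoning.Setoid setoid

-- Evaluation of the two sides

conj-anti : ∀ {p} → IsPartition p → ∀ {x y} → 1 ≤ y → y ≤ x → conj p x ≤ conj p y
conj-anti {p} part {x} {y} 1≤y y≤x with conj p x in e
... | zero  = z≤n
... | suc i = proj₁ (≤at⇔≤conj {p} part (s≤s z≤n) 1≤y)
  (≤-trans y≤x (proj₂ (≤at⇔≤conj {p} part {suc i} {x} (s≤s z≤n) (≤-trans 1≤y y≤x)) (≤-reflexive (sym e))))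

conj-⊆ : ∀ {la mu} → IsPartition la → IsPartition mu → mu ⊆ₚ la → ∀ {j} → 1 ≤ j → conj mu j ≤ conj la j
conj-⊆ {la} {mu} la-part mu-part mu⊆la {j} 1≤j with conj mu j in e
... | zero  = z≤n
... | suc i = proj₁ (≤at⇔≤conj {la} la-part (s≤s z≤n) 1≤j)
  (≤-trans (proj₂ (≤at⇔≤conj {mu} mu-part {suc i} {j} (s≤s z≤n) 1≤j) (≤-reflexive (sym e))) (mu⊆la (suc i)))

module Entries {c ℓr} (R : CommutativeRing c ℓr) (la mu : List ℕ) (r : ℤ) {n : ℕ} (a b : Vec ℤ n)
    (Θ : List (List Cell)) (y z : ℤ → CommutativeRing.Carrier R) where
  open CommutativeRing R using (Carrier; _≈_; 0#; 1#; reflexive) renaming (sym to ≈-sym; trans to ≈-trans)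
  open RingDefs R
  open Shape la mu r

  -- The induced ribbon flags as functions of a content alone. They do not involve the pair of
  -- ribbons, so one matrix serves all entries of the right side.
  flagA flagB : ℤ → ℤ
  flagA t = let m = leftmostOf t in vat a (col m) - (+ conj mu (col m) ℤ.+ + 1) ℤ.+ + row m
  flagB u = let m = rightmostOf u in vat b (col m) - + conj la (col m) ℤ.+ + row m

  stripValue : ℤ → ℕ → Carrier
  stripValue p m = SS (κc m) (νc m) p (stripWidth (dirUp Θ) p (suc m)) (λ s → flagA (top m s)) (λ s → flagB (bot m s)) y z
    where open Strip (dirUp Θ) p

  -- Opaque, since a with-abstraction would otherwise normalise ribbonS.
  abstract
    ribbonValue : ℤ → ℤ → Carrier
    ribbonValue = ribbonS la mu r a b Θ y z

    ribbonValue-≡ : ∀ p q → ribbonValue p q ≡ ribbonS la mu r a b Θ y z p q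
    ribbonValue-≡ p q = refl

    ribbonValue-strip : ∀ p q → ribbonValue p q ≡ stripValue p ℤ.∣ q - p ∣
    ribbonValue-strip p q = refl

  entry-cases : ∀ i j p q V → cont (headC (lookup Θ i)) ≡ p → cont (tailC (lookup Θ j)) ≡ q
              → (q ℤ.+ + 1 ℤ.< p → V ≈ 0#) → (p ≡ q ℤ.+ + 1 → V ≈ 1#)
              → (¬ (q ℤ.+ + 1 ℤ.< p) → p ≢ q ℤ.+ + 1 → V ≈ ribbonValue p q)
              → entry la mu r a b Θ y z i j ≈ V
  entry-cases i j p q V ep eq undefined empty nonempty with cont (headC (lookup Θ i)) | cont (tailC (lookup Θ j))
  entry-cases i j p q V refl refl undefined empty nonempty | .p | .q with q ℤ.+ + 1 ℤ.<? p
  ... | yes lt = ≈-sym (undefined lt)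
  ... | no ¬lt with p ℤ.≟ q ℤ.+ + 1
  ...   | yes e = ≈-sym (empty e)
  ...   | no ¬e = ≈-sym (≈-trans (nonempty ¬lt ¬e) (reflexive (ribbonValue-≡ p q)))

module Assembly {c ℓr} (R : CommutativeRing c ℓr) (la mu : List ℕ) (r : ℤ)
    (la-part : IsPartition la) (mu-part : IsPartition mu) (mu⊆la : mu ⊆ₚ la)
    (n : ℕ) (la₁≤n : at la 1 ≤ n) (a b : Vec ℤ n) (Θ : List (List Cell))
    (dec : Shape.OuterRibbonDecomp la mu r Θ)
    (y z : ℤ → CommutativeRing.Carrier R) where
  open CommutativeRing R using (Carrier; _≈_; 0#; 1#; setoid; reflexive; *-identityˡ; +-identityʳ)
    renaming (refl to ≈-refl; sym to ≈-sym; trans to ≈-trans)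
  open RingDefs R
  open Determinant R
  open Pivot R
  open RibbonMatrix R
  open FlaggedMinors R y z
  open Shape la mu r
  open Diagonals la mu r la-part mu-part mu⊆la
  open Decomposition la mu r la-part mu-part mu⊆la Θ dec
  open Entries R la mu r a b Θ y z
  open Stages R la mu r la-part mu-part mu⊆la Θ dec n la₁≤n
  open Relation.Binary.Reasoning.Setoid setoid
  open Algebra.Properties.AbelianGroup ℤP.+-0-abelianGroup using (∙-cancelˡ)

  X : ℕ → ℕ → Carrier
  X = flaggedMatrix flagA flagB base

  X-upper : UpperUnitriangular X
  X-upper = flaggedMatrix-unitriangular flagA flagB base

  -- The diagonal predecessor of a column's top cell lies in a row where `mu` still reaches column
  -- `j`, so the top cell is the leftmost of its content. The correction in the induced flag then
  -- cancels.
  flagA-top : ∀ {j} → NonEmpty j → flagA (cont (suc (conj mu j) , j)) ≡ vat a j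
  flagA-top {suc j} ne = trans (cong (λ m → vat a (col m) - (+ conj mu (col m) ℤ.+ + 1) ℤ.+ + row m)
      (leftmostOf-≡ (top-In ne) ¬q))
      (cancel (vat a (suc j)) (+ conj mu (suc j)))
    where
      cancel : ∀ x k → x - (k ℤ.+ + 1) ℤ.+ (+ 1 ℤ.+ k) ≡ x
      cancel = ℤ-Solver.solve-∀
      ¬q : ¬ In (conj mu (suc j) , j)
      ¬q (1≤i , μ<j , _) = <⇒≱ μ<j (≤-trans (n≤1+n j) (proj₂ (≤at⇔≤conj {mu} mu-part 1≤i (s≤s z≤n)) ≤-refl))

  flagB-bottom : ∀ {j} → NonEmpty j → flagB (cont (conj la j , j)) ≡ vat b j
  flagB-bottom {j} ne = trans (cong (λ m → vat b (col m) - + conj la (col m) ℤ.+ + row m) (rightmostOf-≡ (bottom-In ne) ¬q))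
      (cancel (vat b j) (+ conj la j))
    where
      cancel : ∀ x k → x - k ℤ.+ k ≡ x
      cancel = ℤ-Solver.solve-∀
      ¬q : ¬ In (suc (conj la j) , suc j)
      ¬q (1≤i , _ , j≤λ) = 1+n≰n (proj₁ (≤at⇔≤conj {la} la-part 1≤i (proj₁ ne)) (≤-trans (n≤1+n j) j≤λ))

  botC topC : ℕ → ℤ
  botC s = content (conj la) r (conj la s) s
  topC s = content (conj la) r (suc (conj mu s)) s

  columnMatrixAt : ℤ → ℕ → ℕ → Carrier
  columnMatrixAt k i j = eRel k (seg y (vat a j) (vat b i)) (seg z (vat a j ℤ.+ topC j) (vat b i ℤ.+ botC i))

  columnMatrix : ℕ → ℕ → Carrier
  columnMatrix i j = columnMatrixAt (+ conj la i - + i - + conj mu j ℤ.+ + j) i j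

  private
    index-⊖ : ∀ i j → + conj la i - + i - + conj mu j ℤ.+ + j ≡ (conj la i ℕ.+ j) ℤ.⊖ (conj mu j ℕ.+ i)
    index-⊖ i j = trans (rearrange (+ conj la i) (+ i) (+ conj mu j) (+ j)) (ℤP.m-n≡m⊖n (conj la i ℕ.+ j) (conj mu j ℕ.+ i))
      where
        rearrange : ∀ l i m j → l - i - m ℤ.+ j ≡ (l ℤ.+ j) - (m ℤ.+ i)
        rearrange = ℤ-Solver.solve-∀

    columnMatrix-zero : ∀ {i j} → conj la i ≤ conj mu j → j < i → columnMatrix i j ≈ 0#
    columnMatrix-zero {i} {j} l≤m j<i with trans (index-⊖ i j) (ℤP.⊖-< lt) | ℕP.m<n⇒0<n∸m lt
      where lt = ℕP.+-mono-≤-< l≤m j<i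
    ... | e | pos with conj mu j ℕ.+ i ∸ (conj la i ℕ.+ j)
    ... | suc k = reflexive (cong (λ k → columnMatrixAt k i j) e)

    columnMatrix-one : ∀ {j} → conj la j ≡ conj mu j → columnMatrix j j ≈ 1#
    columnMatrix-one {j} e = ≈-trans (reflexive (cong (λ k → columnMatrixAt k j j)
        (trans (index-⊖ j j) (trans (cong (λ k → (k ℕ.+ j) ℤ.⊖ (conj mu j ℕ.+ j)) e) (ℤP.n⊖n≡0 (conj mu j ℕ.+ j))))))
      (≈-trans (+-identityʳ _) (≈-trans (*-identityˡ _) (*-identityˡ _)))

    -- A column `j` without cells has a unit diagonal entry, and degrees are negative for rows from
    -- `j` on in the columns of `pre`, as well as below that entry; `Det-trim` then deletes it. The
    -- list `pre` holds the columns already kept.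
    trim : ∀ pre L → AllPairs _<_ (pre ++ L) → All (1 ≤_) (pre ++ L)
         → Det columnMatrix (pre ++ L) (pre ++ L) ≈ Det columnMatrix (pre ++ filter nonEmpty? L) (pre ++ filter nonEmpty? L)
    trim pre []      _      _   = ≈-refl
    trim pre (j ∷ L) sorted pos with nonEmpty? j
    ... | yes ne = begin
      Det columnMatrix (pre ++ j ∷ L) (pre ++ j ∷ L) ≡⟨ cong (λ l → Det columnMatrix l l) (++-assoc pre (j ∷ []) L) ⟨
      Det columnMatrix ((pre ++ j ∷ []) ++ L) ((pre ++ j ∷ []) ++ L)
        ≈⟨ trim (pre ++ j ∷ []) L (subst (AllPairs _<_) (sym (++-assoc pre (j ∷ []) L)) sorted)
            (subst (All (1 ≤_)) (sym (++-assoc pre (j ∷ []) L)) pos) ⟩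
      Det columnMatrix ((pre ++ j ∷ []) ++ filter nonEmpty? L) ((pre ++ j ∷ []) ++ filter nonEmpty? L)
        ≡⟨ cong (λ l → Det columnMatrix l l)
            (trans (++-assoc pre (j ∷ []) (filter nonEmpty? L)) (cong (pre ++_) (sym (filter-accept nonEmpty? ne)))) ⟩
      Det columnMatrix (pre ++ filter nonEmpty? (j ∷ L)) (pre ++ filter nonEmpty? (j ∷ L)) ∎
    ... | no ¬ne = begin
      Det columnMatrix (pre ++ j ∷ L) (pre ++ j ∷ L)
        ≈⟨ Det-trim columnMatrix pre L j pre L j ≤-refl (columnMatrix-one la≡mu)
             (λ x∈ → columnMatrix-zero (≤-trans (conj-anti {la} la-part 1≤j (<⇒≤ (All.lookup (proj₁ split) x∈)))
                 (≤-reflexive la≡mu)) (All.lookup (proj₁ split) x∈))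
             (λ x∈ w∈ → below x∈ (All.lookup (proj₂ split) w∈) (All.lookup (AllP.++⁻ˡ pre pos) w∈)) ⟩
      Det columnMatrix (pre ++ L) (pre ++ L) ≈⟨ trim pre L (drop pre sorted)
          (AllP.++⁺ (AllP.++⁻ˡ pre pos) (All.tail (AllP.++⁻ʳ pre pos))) ⟩
      Det columnMatrix (pre ++ filter nonEmpty? L) (pre ++ filter nonEmpty? L)
        ≡⟨ cong (λ l → Det columnMatrix (pre ++ l) (pre ++ l)) (filter-reject nonEmpty? ¬ne) ⟨
      Det columnMatrix (pre ++ filter nonEmpty? (j ∷ L)) (pre ++ filter nonEmpty? (j ∷ L)) ∎
      where
        1≤j : 1 ≤ j
        1≤j = All.head (AllP.++⁻ʳ pre pos)
        la≡mu : conj la j ≡ conj mu j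
        la≡mu = ≤-antisym (≮⇒≥ λ lt → ¬ne (1≤j , lt)) (conj-⊆ {la} {mu} la-part mu-part mu⊆la 1≤j)
        splitting : ∀ pre → AllPairs _<_ (pre ++ j ∷ L) → All (j <_) L × All (_< j) pre
        splitting []        (j< ∷ _)      = j< , []
        splitting (w ∷ pre) (w< ∷ sorted) with splitting pre sorted
        ... | j< , pre< = j< , All.head (AllP.++⁻ʳ pre w<) ∷ pre<
        split = splitting pre sorted
        drop : ∀ pre → AllPairs _<_ (pre ++ j ∷ L) → AllPairs _<_ (pre ++ L)
        drop []        (_ ∷ sorted)  = sorted
        drop (w ∷ pre) (w< ∷ sorted) = AllP.++⁺ (AllP.++⁻ˡ pre w<) (All.tail (AllP.++⁻ʳ pre w<)) ∷ drop pre sorted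
        below : ∀ {x w} → x ∈ j ∷ L → w < j → 1 ≤ w → columnMatrix x w ≈ 0#
        below {x} {w} x∈ w<j 1≤w = columnMatrix-zero
          (≤-trans (conj-anti {la} la-part 1≤j (j≤ x∈)) (≤-trans (≤-reflexive la≡mu) (conj-anti {mu} mu-part 1≤w (<⇒≤ w<j))))
          (≤-trans w<j (j≤ x∈))
          where
            j≤ : ∀ {x} → x ∈ j ∷ L → j ≤ x
            j≤ (here refl) = ≤-refl
            j≤ (there x∈)  = <⇒≤ (All.lookup (proj₁ split) x∈)

    columnMatrix-X : ∀ {i j} → NonEmpty i → NonEmpty j → columnMatrix i j ≈ X (botOff i) (topOff j)
    columnMatrix-X {i} {j} ni nj = begin
      columnMatrix i j ≡⟨ cong (λ k → columnMatrixAt k i j)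
          (degree≡contents (+ conj la i) (+ i) (+ conj mu j) (+ j) r (+ conj la 1)) ⟩
      columnMatrixAt (topC j - botC i ℤ.+ + 1) i j
        ≡⟨ cong₂ (λ α β → eRel (topC j - botC i ℤ.+ + 1) (seg y α β) (seg z (α ℤ.+ topC j) (β ℤ.+ botC i)))
            (sym (flagA-top nj)) (sym (flagB-bottom ni)) ⟩
      flagged flagA flagB (botC i) (topC j)
        ≡⟨ cong₂ (flagged flagA flagB) (cont-off (In⇒row≤ℓ (bottom-In ni)))
            (trans (cont-off (In⇒row≤ℓ (top-In nj))) (shift base (+ off (suc (conj mu j) , j)))) ⟩
      X (botOff i) (topOff j) ∎
      where
        shift : ∀ b t → b ℤ.+ t ≡ b ℤ.+ (+ 1 ℤ.+ t) - + 1
        shift = ℤ-Solver.solve-∀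

  lhs-columns : lhsS la mu r n a b y z ≈ DetPairs X (map columnPair columns)
  lhs-columns = begin
    lhsS la mu r n a b y z ≈⟨ det≈Det n columnMatrix (λ i → suc (toℕ i)) (λ j → suc (toℕ j)) ⟩
    Det columnMatrix (tabulate {n = n} (λ i → suc (toℕ i))) (tabulate {n = n} (λ i → suc (toℕ i)))
      ≡⟨ cong (λ l → Det columnMatrix l l) (trans (tabulate-toℕ n suc) (sym (map-upTo suc n))) ⟩
    Det columnMatrix labels labels ≈⟨ trim [] labels sorted (AllP.map⁺ (All.universal (λ _ → s≤s z≤n) (upTo n))) ⟩
    Det columnMatrix columns columns
      ≈⟨ Det-map columnMatrix X botOff topOff columns columns (λ i∈ j∈ → columnMatrix-X (nonEmpty i∈) (nonEmpty j∈)) ⟩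
    Det X (map botOff columns) (map topOff columns) ≡⟨ cong₂ (Det X) (map-∘ columns) (map-∘ columns) ⟩
    DetPairs X (map columnPair columns) ∎
    where
      labels = map suc (upTo n)
      sorted : AllPairs _<_ labels
      sorted = AllPairsP.map⁺ (AllPairsP.applyUpTo⁺₁ (λ i → i) n (λ i<j _ → s≤s i<j))
      nonEmpty : ∀ {j} → j ∈ columns → NonEmpty j
      nonEmpty j∈ = proj₂ (∈-filter⁻ nonEmpty? {xs = labels} j∈)

  finalMatrix : ℕ → ℕ → Carrier
  finalMatrix = stage X direction (maxOff X X-upper)

  ribbonValue-ribbon : ∀ {p₀ q₀} → p₀ ≤ q₀ → ribbonValue (base ℤ.+ + p₀) (base ℤ.+ + q₀) ≈ ribbon X p₀
      (cuts direction p₀ q₀) (suc q₀)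
  ribbonValue-ribbon {p₀} {q₀} p≤q = begin
    ribbonValue (base ℤ.+ + p₀) (base ℤ.+ + q₀) ≡⟨ ribbonValue-strip (base ℤ.+ + p₀) (base ℤ.+ + q₀) ⟩
    stripValue (base ℤ.+ + p₀) ℤ.∣ (base ℤ.+ + q₀) - (base ℤ.+ + p₀) ∣
      ≡⟨ cong (stripValue (base ℤ.+ + p₀))
          (cong ℤ.∣_∣ (trans (difference base (+ q₀) (+ p₀)) (trans (ℤP.m-n≡m⊖n q₀ p₀) (ℤP.⊖-≥ p≤q)))) ⟩
    stripValue (base ℤ.+ + p₀) (q₀ ∸ p₀) ≈⟨ SS-strip flagA flagB base (dirUp Θ) p₀ (q₀ ∸ p₀) ⟩
    ribbon X p₀ (cuts direction p₀ (p₀ ℕ.+ (q₀ ∸ p₀))) (suc (p₀ ℕ.+ (q₀ ∸ p₀))) ≡⟨ cong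
        (λ e → ribbon X p₀ (cuts direction p₀ e) (suc e)) (ℕP.m+[n∸m]≡n p≤q) ⟩
    ribbon X p₀ (cuts direction p₀ q₀) (suc q₀) ∎
    where
      difference : ∀ b q p → (b ℤ.+ q) - (b ℤ.+ p) ≡ q - p
      difference = ℤ-Solver.solve-∀

  private
    final-upper : UpperUnitriangular finalMatrix
    final-upper = stage-unitriangular direction X-upper (maxOff X X-upper)

    base-suc : ∀ t → base ℤ.+ + suc t ≡ base ℤ.+ + t ℤ.+ + 1
    base-suc t = shift base (+ t)
      where
        shift : ∀ b t → b ℤ.+ (+ 1 ℤ.+ t) ≡ b ℤ.+ t ℤ.+ + 1
        shift = ℤ-Solver.solve-∀

    headOff≤tailOff′ : ∀ {i j} → ¬ (base ℤ.+ + tailOff j ℤ.+ + 1 ℤ.< base ℤ.+ + headOff i) → base ℤ.+ + headOff i ≢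
        base ℤ.+ + tailOff j ℤ.+ + 1
                     → headOff i ≤ tailOff j
    headOff≤tailOff′ {i} {j} ¬lt ¬e = ≤-pred (≤∧≢⇒<
      (≮⇒≥ λ q<p → ¬lt (subst (ℤ._< base ℤ.+ + headOff i) (base-suc (tailOff j)) (ℤP.+-monoʳ-< base (ℤ.+<+ q<p))))
      (λ e → ¬e (trans (cong (λ k → base ℤ.+ + k) e) (base-suc (tailOff j)))))

  -- The values 0 and 1 for undefined and empty strips are the unitriangularity of the final matrix:
  -- with column label `q + 1`, an undefined strip lies below the diagonal and an empty one on it.
  entry-final : ∀ i j → entry la mu r a b Θ y z i j ≈ finalMatrix (headOff i) (suc (tailOff j))
  entry-final i j = entry-cases i j (base ℤ.+ + headOff i) (base ℤ.+ + tailOff j) (finalMatrix (headOff i) (suc (tailOff j)))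
    (cont-off {headC (lookup Θ i)} (In⇒row≤ℓ (head-In i))) (cont-off {tailC (lookup Θ j)} (In⇒row≤ℓ (tail-In j)))
    (λ lt → proj₁ final-upper (≰⇒> λ p≤ → ℤP.<⇒≱ lt
        (subst (base ℤ.+ + headOff i ℤ.≤_) (base-suc (tailOff j)) (ℤP.+-monoʳ-≤ base (ℤ.+≤+ p≤)))))
    (λ e → ≈-trans (reflexive (cong (λ k → finalMatrix k (suc (tailOff j)))
      (ℤP.+-injective (∙-cancelˡ base (+ headOff i) (+ suc (tailOff j)) (trans e (sym (base-suc (tailOff j))))))))
          (proj₂ final-upper (suc (tailOff j))))
    (λ ¬lt ¬e → ≈-trans (stage-ribbon X direction (headOff≤tailOff′ ¬lt ¬e) (<⇒≤ (off<maxOff X X-upper (tail-In j))))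
        (≈-sym (ribbonValue-ribbon (headOff≤tailOff′ ¬lt ¬e))))

  rhs-ribbons : rhsDet la mu r a b Θ y z ≈ DetPairs finalMatrix (map ribbonPair (allFin (length Θ)))
  rhs-ribbons = begin
    rhsDet la mu r a b Θ y z ≈⟨ det-cong (length Θ) entry-final ⟩
    det (length Θ) (λ i j → finalMatrix (headOff i) (suc (tailOff j))) ≈⟨ det≈Det (length Θ) finalMatrix headOff
        (suc ∘ tailOff) ⟩
    Det finalMatrix (tabulate headOff) (tabulate (suc ∘ tailOff))
      ≡⟨ cong₂ (Det finalMatrix) (as-map headOff) (as-map (suc ∘ tailOff)) ⟩
    Det finalMatrix (map headOff (allFin (length Θ))) (map (suc ∘ tailOff) (allFin (length Θ)))
      ≡⟨ cong₂ (Det finalMatrix) (map-∘ (allFin (length Θ))) (map-∘ (allFin (length Θ))) ⟩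
    DetPairs finalMatrix (map ribbonPair (allFin (length Θ))) ∎
    where
      as-map : (f : Fin (length Θ) → ℕ) → tabulate f ≡ map f (allFin (length Θ))
      as-map f = sym (ListP.map-tabulate (λ i → i) f)

  lhs≈rhs : lhsS la mu r n a b y z ≈ rhsDet la mu r a b Θ y z
  lhs≈rhs = ≈-trans lhs-columns (≈-trans (columns≈ribbons X X-upper) (≈-sym rhs-ribbons))

mainTheorem6 : ∀ {c ℓ} (R : CommutativeRing c ℓ) (la mu : List ℕ) (r : ℤ)
    → IsPartition la → IsPartition mu → mu ⊆ₚ la
    → EdgeConnected (InSkew la mu)
    → (n : ℕ) → at la 1 ≤ n → (a b : Vec ℤ n) → ColumnFlags la mu n a b
    → (Θ : List (List Cell)) → Shape.OuterRibbonDecomp la mu r Θ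
    → (y z : ℤ → CommutativeRing.Carrier R)
    → CommutativeRing._≈_ R (RingDefs.lhsS R la mu r n a b y z)
    (RingDefs.rhsDet R la mu r a b Θ y z)
mainTheorem6 R la mu r la-part mu-part mu⊆la _ n la₁≤n a b _ Θ dec y z =
  Assembly.lhs≈rhs R la mu r la-part mu-part mu⊆la n la₁≤n a b Θ dec y z
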